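{- Let $\mathbb{F}_q$ be a finite field of characteristic different from $2$ with $q\equiv 1\pmod 3$, let $\rho\in\mathbb{F}_q$ be a primitive cube root of unity and let $t\in\mathbb{F}_q^*$ be a non-square. There exist exactly $$\frac{q+12-(q\bmod 12)}{12}$$ isomorphism classes (over $\mathbb{F}_q$) of elliptic curves over $\mathbb{F}_q$ with $4$ rational subgroups of order $3$ whose nonzero points are defined over $\mathbb{F}_{q^2}$ but not over $\mathbb{F}_q$. These classes are represented by the curves $y^2=x^3+t^2A\,x+t^3B$ with $$A=-\frac{(9a-1-2\rho)(3a-1-2\rho)(3a-1)(3a+1)}{144},$$ $$B=\frac{(1+9a^2)(9a^2-6a-6\rho a-1)(9a^2-6\rho a-1)}{864},$$ where $a\in\mathbb{F}_q\setminus\{0,\rho/3,(\rho+1)/3\}$; that is, every such curve has the stated property, and every elliptic curve over $\mathbb{F}_q$ with the stated property is isomorphic over $\mathbb{F}_q$ to at least one of them.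
   Context: A subgroup $G\subset E(\overline{\mathbb{F}}_q)$ is called rational (over $\mathbb{F}_q$) if it is stable, as a set, under the $q$-power Frobenius map $(x,y)\mapsto(x^q,y^q)$; its individual points need not be defined over $\mathbb{F}_q$. Here $q \bmod 12$ denotes the remainder in $\{0,\dots,11\}$ of the division of $q$ by $12$. -}

module Defs where

open import Algebra.Bundles using (CommutativeRing)
open import Algebra.Morphism.Structures using (IsRingHomomorphism)
import Algebra.Properties.Semiring.Exp as Exp
import Algebra.Properties.Semiring.Mult as Mult
open import Data.Fin.Base using (Fin)
open import Data.Maybe.Base as Maybe using (Maybe; nothing; just)
import Data.Maybe.Relation.Binary.Pointwise as Maybe
open import Data.Nat.Base as ℕ using (ℕ; suc)
open import Data.Product.Base as Product using (∃; ∃₂; _×_; _,_; proj₁; proj₂)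
import Data.Product.Relation.Binary.Pointwise.NonDependent as Product
open import Data.Unit.Polymorphic.Base using (⊤)
open import Data.Vec.Base as Vec using (Vec; []; _∷_)
open import Function.Definitions using (Bijective)
open import Level using (Level; _⊔_) renaming (suc to lsuc)
open import Relation.Binary.Core using (Rel)
open import Relation.Binary.Definitions using (Decidable; _Respects_)
open import Relation.Binary.PropositionalEquality.Core using (_≡_)
open import Relation.Nullary.Decidable.Core using (yes; no)
open import Relation.Nullary.Negation.Core using (¬_)
open import Relation.Unary using (Pred; _⊆_; _≐_)

private
  variable
    a c ℓ ℓ′ : Level

-- A has exactly n elements up to _≈_.
HasCardinality : (A : Set a) → Rel A ℓ′ → ℕ → Set (a ⊔ ℓ′)
HasCardinality A _≈_ n = ∃ λ (f : Fin n → A) → Bijective _≡_ _≈_ f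

-- Fields with decidable equality.  The Heyting fields of the library
-- carry an apartness relation, which plays no role here.
record Field c ℓ : Set (lsuc (c ⊔ ℓ)) where
  infix  4 _≟_
  infix  9 _⁻¹
  infixl 7 _/_

  field
    commutativeRing : CommutativeRing c ℓ

  open CommutativeRing commutativeRing public

  field
    _≟_     : Decidable _≈_
    1≉0     : 1# ≉ 0#
    inverse : ∀ x → x ≉ 0# → ∃ λ y → x * y ≈ 1#

  open Exp semiring public using (_^_)
  open Mult semiring public using () renaming (_×_ to _·_)

  -- Totalised by 0⁻¹ = 0.
  _⁻¹ : Carrier → Carrier
  x ⁻¹ with x ≟ 0#
  ... | yes _  = 0#
  ... | no x≉0 = proj₁ (inverse x x≉0)

  _/_ : Carrier → Carrier → Carrier
  x / y = x * y ⁻¹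

  IsPrimitiveRootOfUnity : ℕ → Carrier → Set ℓ
  IsPrimitiveRootOfUnity n x =
    x ^ n ≈ 1# × (∀ k → 0 ℕ.< k → k ℕ.< n → x ^ k ≉ 1#)

  NonSquare : Carrier → Set (c ⊔ ℓ)
  NonSquare x = ∀ y → y ^ 2 ≉ x

  -- c₀ + c₁ x + ⋯ + cₙ₋₁ xⁿ⁻¹ + xⁿ
  evalMonic : ∀ {n} → Vec Carrier n → Carrier → Carrier
  evalMonic []       x = 1#
  evalMonic (k ∷ ks) x = k + x * evalMonic ks x

FieldOfSize : Field c ℓ → ℕ → Set (c ⊔ ℓ)
FieldOfSize F n = HasCardinality F.Carrier F._≈_ n
  where module F = Field F

record _↪_ (F K : Field c ℓ) : Set (c ⊔ ℓ) where
  private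
    module F = Field F
    module K = Field K
  field
    ⟦_⟧                : F.Carrier → K.Carrier
    isRingHomomorphism : IsRingHomomorphism F.rawRing K.rawRing ⟦_⟧

record IsAlgebraicClosure {F K : Field c ℓ} (ι : F ↪ K) : Set (c ⊔ ℓ) where
  open _↪_ ι
  open Field K
  field
    algebraicallyClosed : ∀ {n} (ks : Vec Carrier (suc n)) →
                          ∃ λ x → evalMonic ks x ≈ 0#
    algebraic           : ∀ x → ∃₂ λ n (ks : Vec (Field.Carrier F) n) →
                          evalMonic (Vec.map ⟦_⟧ ks) x ≈ 0#

-- y² + a₁xy + a₃y = x³ + a₂x² + a₄x + a₆
record WeierstrassCurve (F : Field c ℓ) : Set c where
  open Field F using (Carrier)
  field
    a₁ a₂ a₃ a₄ a₆ : Carrier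

module _ {F : Field c ℓ} where
  open Field F

  discriminant : WeierstrassCurve F → Carrier
  discriminant E =
    - (b₂ ^ 2 * b₈) - 8 · b₄ ^ 3 - 27 · b₆ ^ 2 + 9 · b₂ * b₄ * b₆
    where
    open WeierstrassCurve E
    b₂ = a₁ ^ 2 + 4 · a₂
    b₄ = 2 · a₄ + a₁ * a₃
    b₆ = a₃ ^ 2 + 4 · a₆
    b₈ = a₁ ^ 2 * a₆ + 4 · a₂ * a₆ - a₁ * a₃ * a₄ + a₂ * a₃ ^ 2 - a₄ ^ 2

  IsElliptic : WeierstrassCurve F → Set ℓ
  IsElliptic E = discriminant E ≉ 0#

  -- Isomorphism over F: a substitution x = u²x′ + r, y = u³y′ + u²sx′ + t
  -- with u ≠ 0 carries the equation of E to that of E′.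
  infix 4 _≅_
  record _≅_ (E E′ : WeierstrassCurve F) : Set (c ⊔ ℓ) where
    open WeierstrassCurve E
    open WeierstrassCurve E′ renaming
      (a₁ to a₁′; a₂ to a₂′; a₃ to a₃′; a₄ to a₄′; a₆ to a₆′)
    field
      u r s t : Carrier
      u≉0     : u ≉ 0#
      a₁-eq   : u * a₁′     ≈ a₁ + 2 · s
      a₂-eq   : u ^ 2 * a₂′ ≈ a₂ - s * a₁ + 3 · r - s ^ 2
      a₃-eq   : u ^ 3 * a₃′ ≈ a₃ + r * a₁ + 2 · t
      a₄-eq   : u ^ 4 * a₄′ ≈ a₄ - s * a₃ + 2 · r * a₂ - (t + r * s) * a₁
                              + 3 · r ^ 2 - 2 · s * t
      a₆-eq   : u ^ 6 * a₆′ ≈ a₆ + r * a₄ + r ^ 2 * a₂ + r ^ 3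
                              - t * a₃ - t ^ 2 - r * t * a₁

shortWeierstrass : (F : Field c ℓ) (A B : Field.Carrier F) → WeierstrassCurve F
shortWeierstrass F A B =
  record { a₁ = 0# ; a₂ = 0# ; a₃ = 0# ; a₄ = A ; a₆ = B }
  where open Field F

baseChange : {F K : Field c ℓ} → F ↪ K → WeierstrassCurve F → WeierstrassCurve K
baseChange ι E = record
  { a₁ = ⟦ a₁ ⟧ ; a₂ = ⟦ a₂ ⟧ ; a₃ = ⟦ a₃ ⟧ ; a₄ = ⟦ a₄ ⟧ ; a₆ = ⟦ a₆ ⟧ }
  where
  open _↪_ ι
  open WeierstrassCurve E

-- The affine plane together with a point 𝒪 at infinity.
Point : Field c ℓ → Set c
Point K = Maybe (Carrier × Carrier)
  where open Field K

pattern 𝒪       = nothing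
pattern aff x y = just (x , y)

-- The operations below are defined on all points, but meaningful only for
-- points on the curve.
module _ {K : Field c ℓ} where
  open Field K

  infix 4 _≈ₚ_
  _≈ₚ_ : Rel (Point K) (c ⊔ ℓ)
  _≈ₚ_ = Maybe.Pointwise (Product.Pointwise _≈_ _≈_)

  frobenius : ℕ → Point K → Point K
  frobenius q = Maybe.map (Product.map (_^ q) (_^ q))

  module _ (E : WeierstrassCurve K) where
    open WeierstrassCurve E

    OnCurve : Pred (Point K) ℓ
    OnCurve 𝒪         = ⊤
    OnCurve (aff x y) =
      y ^ 2 + a₁ * x * y + a₃ * y ≈ x ^ 3 + a₂ * x ^ 2 + a₄ * x + a₆

    negate : Point K → Point K
    negate 𝒪         = 𝒪
    negate (aff x y) = aff x (- y - a₁ * x - a₃)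

    -- The third intersection point, reflected, of the curve with the line
    -- of slope m through (x₁ , y₁), when x₁ and x₂ are the abscissae of the
    -- other two.
    chord : (m x₁ y₁ x₂ : Carrier) → Point K
    chord m x₁ y₁ x₂ = negate (aff x₃ (y₁ + m * (x₃ - x₁)))
      where
      x₃ = m ^ 2 + a₁ * m - a₂ - x₁ - x₂

    -- For x₁ = x₂ the denominator y₁ + y₂ + a₁x₁ + a₃ vanishes precisely when
    -- the points are opposite; otherwise, on the curve, y₁ = y₂ and it is the
    -- denominator 2y₁ + a₁x₁ + a₃ of the slope of the tangent.
    add : Point K → Point K → Point K
    add 𝒪           Q = Q
    add P@(aff _ _) 𝒪 = P
    add (aff x₁ y₁) (aff x₂ y₂) with x₁ ≟ x₂ | y₁ + y₂ + a₁ * x₁ + a₃ ≟ 0#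
    ... | no _  | _     = chord ((y₂ - y₁) / (x₂ - x₁)) x₁ y₁ x₂
    ... | yes _ | yes _ = 𝒪
    ... | yes _ | no _  =
      chord ((3 · x₁ ^ 2 + 2 · a₂ * x₁ + a₄ - a₁ * y₁)
             / (y₁ + y₂ + a₁ * x₁ + a₃)) x₁ y₁ x₂

    record Subgroup : Set (lsuc (c ⊔ ℓ)) where
      field
        Member        : Pred (Point K) (c ⊔ ℓ)
        resp          : Member Respects _≈ₚ_
        onCurve       : Member ⊆ OnCurve
        𝒪-member      : Member 𝒪
        add-closed    : ∀ {P Q} → Member P → Member Q → Member (add P Q)
        negate-closed : ∀ {P} → Member P → Member (negate P)

  module _ {E : WeierstrassCurve K} (G : Subgroup E) where
    open Subgroup G

    HasOrder : ℕ → Set (c ⊔ ℓ)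
    HasOrder = HasCardinality (∃ Member) (λ P Q → proj₁ P ≈ₚ proj₁ Q)

    FrobeniusStable : ℕ → Set (c ⊔ ℓ)
    FrobeniusStable q = ∀ {P} → Member P → Member (frobenius q P)

    NonzeroPoints : Pred (Point K) ℓ′ → Set (c ⊔ ℓ ⊔ ℓ′)
    NonzeroPoints Φ = ∀ {P} → Member P → ¬ (P ≈ₚ 𝒪) → Φ P

DefinedOver : {L K : Field c ℓ} → L ↪ K → Pred (Point K) (c ⊔ ℓ)
DefinedOver          κ 𝒪         = ⊤
DefinedOver {K = K}  κ (aff x y) = (∃ λ a → ⟦ a ⟧ ≈ x) × (∃ λ b → ⟦ b ⟧ ≈ y)
  where
  open _↪_ κ
  open Field K

-- E has exactly 4 rational subgroups of order 3 whose nonzero points are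
-- defined over L but not over F.  Used with F, L, K being 𝔽_q, 𝔽_q², and an
-- algebraic closure of 𝔽_q.
HasFourSubgroups : {F L K : Field c ℓ} → F ↪ K → L ↪ K → ℕ →
                   WeierstrassCurve F → Set (lsuc (c ⊔ ℓ))
HasFourSubgroups ι κ q E =
  HasCardinality
    (∃ λ (G : Subgroup (baseChange ι E)) →
       HasOrder G 3
       × FrobeniusStable G q
       × NonzeroPoints G (λ P → DefinedOver κ P × ¬ DefinedOver ι P))
    (λ G H → Member (proj₁ G) ≐ Member (proj₁ H))
    4
  where open Subgroup

module Family (F : Field c ℓ) (ρ : Field.Carrier F) where
  open Field F

  A : Carrier → Carrier
  A a = - ((9 · a - 1# - 2 · ρ) * (3 · a - 1# - 2 · ρ)
           * (3 · a - 1#) * (3 · a + 1#))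
        / (144 · 1#)

  B : Carrier → Carrier
  B a = (1# + 9 · a ^ 2)
        * (9 · a ^ 2 - 6 · a - 6 · ρ * a - 1#)
        * (9 · a ^ 2 - 6 · ρ * a - 1#)
        / (864 · 1#)

  Admissible : Carrier → Set ℓ
  Admissible a = a ≉ 0# × a ≉ ρ / (3 · 1#) × a ≉ (ρ + 1#) / (3 · 1#)

  curve : (t a : Carrier) → WeierstrassCurve F
  curve t a = shortWeierstrass F (t ^ 2 * A a) (t ^ 3 * B a)

-- A subgroup of order 3 is {O, ±P} for a flex P, and Frobenius acts on it as required
-- exactly if x(P) ∈ F and y(P) ∈ F √t (in short coordinates).  If this holds for two
-- subgroups, the slope of the first flex is 3e√t with e ∈ F, and the second abscissa yields
-- f ∈ F such that the curve is y² = x³ + t² A(e,f) x + t³ B(e,f), where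
--   A(e,f) = -3e (e³ + 8f³),  B(e,f) = -2 (e⁶ - 20e³f³ - 8f⁶),
--   4A³ + 27B² = -6912 f³ (e³ - f³)³.
-- Conversely all four abscissae of flexes of such a curve, 3te² and -t(e + 2ωf)² for
-- ω³ = 1, are of this kind.  The family of the theorem is f = 1/6, e = (1 + 3(1 + 2ρ)a) / 6.
--
-- Up to scaling the parameter is l = e/f ∈ F ∖ {1, ρ, ρ²}.  The isomorphism classes are the
-- orbits of the tetrahedral group generated by l ↦ ρl and l ↦ (l + 2) / (l - 1).  They have
-- 12 elements, except for the orbit of the 4 roots of A and that of the 6 roots of B, which
-- are rational exactly if 3 is a square.  So q = 7 + 12k with k + 1 classes, or
-- q = 13 + 12k with k + 2 classes.

module Submission where

open import Defs
open import Algebra.Bundles using (CommutativeRing)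
open import Algebra.Morphism.Structures using (IsRingHomomorphism)
import Algebra.Properties.CommutativeMonoid.Sum as Sum
import Algebra.Properties.CommutativeSemiring.Exp as CommutativeExp
import Algebra.Properties.Ring as RingProperties
import Algebra.Properties.Semiring.Exp as Exp
import Algebra.Properties.Semiring.Mult as Mult
import Algebra.Solver.Ring.NaturalCoefficients.Default as NaturalSolver
open import Data.Bool.Base using (Bool; true; T; _∧_)
open import Data.Empty using (⊥; ⊥-elim)
open import Data.Fin.Base as Fin using (Fin; zero; suc)
import Data.Fin.Permutation as Perm
import Data.Fin.Properties as Fin
open import Data.List.Base as List using (List; []; _∷_; length)
import Data.List.Membership.Setoid as Membership
import Data.List.Membership.Setoid.Properties as MembershipProperties
import Data.List.Properties as List
open import Data.List.Relation.Unary.All as All using (All; []; _∷_)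
import Data.List.Relation.Unary.All.Properties as AllProperties
open import Data.List.Relation.Unary.AllPairs using (AllPairs; []; _∷_)
import Data.List.Relation.Unary.AllPairs.Properties as AllPairsProperties
open import Data.List.Relation.Unary.Any as Any using (Any; here; there)
import Data.List.Relation.Unary.Any.Properties as AnyProperties
import Data.List.Relation.Unary.Unique.Setoid as Unique
import Data.List.Relation.Unary.Unique.Setoid.Properties as UniqueProperties
open import Data.Maybe.Relation.Binary.Pointwise using (just; nothing)
open import Data.Nat.Base as ℕ using (ℕ; zero; suc; _∸_; _%_)
import Data.Nat.DivMod as ℕ
import Data.Nat.Properties as ℕ
open import Data.Product.Base using (∃; ∃₂; _×_; _,_; proj₁; proj₂)
open import Data.Sum.Base using (_⊎_; inj₁; inj₂; [_,_]′)
open import Data.Unit.Base using (tt)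
open import Data.Vec.Base as Vec using (Vec; []; _∷_)
open import Data.Vec.N-ary using (N-ary; _$ⁿ_)
open import Function.Base using (_∘_)
open import Level using (_⊔_) renaming (suc to ℓsuc)
open import Relation.Binary.Bundles using (DecSetoid)
open import Relation.Binary.PropositionalEquality as ≡ using (_≡_; refl)
open import Relation.Nullary using (¬_; Dec; yes; no; contradiction; ¬?; _×-dec_; _⊎-dec_; _→-dec_)
open import Relation.Nullary.Decidable using (toWitness)
open import Relation.Unary using (_≐_)

-- Reflection of polynomial identities over ℤ[ρ], where ρ² + ρ + 1 = 0.

-- The parameter l is a coordinate on the modular curve of full level 3: up to constants, A(l, 1)
-- and B(l, 1) are the invariants of the cubic x³ + y³ + z³ = 3lxyz. The values 1, ρ, ρ² and
-- infinity are the cusps, and the tetrahedral group permutes the four subgroups of order 3. Each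
-- flex abscissa gives e up to sign and then f up to a cube root of unity, so up to sign a curve has
-- 4 · 3 descriptions (e, f). All of them lie over F because ρ and √-3 do. Hence parameters in one
-- orbit give curves that are isomorphic over F itself and not merely over its closure, and the
-- twist by t cancels from the conditions for an isomorphism. The group law is used without
-- associativity, so a subgroup of order 3 is analysed by counting its members. It is then replaced
-- by a pair (x, w) of elements of F. From there on all arguments are polynomial identities, each
-- certified by explicit multipliers of the relations that it uses.

infixl 6 _:+_ _:-_
infixl 7 _:*_
infix  8 :-_
infixr 8 _:^_ _:·_

data Expr (n : ℕ) : Set where
  var             : Fin n → Expr n
  :0 :1 :ρ        : Expr n
  :-_             : Expr n → Expr n
  _:+_ _:-_ _:*_  : Expr n → Expr n → Expr n
  _:^_            : Expr n → ℕ → Expr n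
  _:·_            : ℕ → Expr n → Expr n

-- The cofactor of `p` - 1 in `p` ^ `k` - 1: the multiplier by which a relation `p` = 1 is applied
-- to a `k`-th power.
:geometric : ∀ {n} → ℕ → Expr n → Expr n
:geometric zero    p = :0
:geometric (suc k) p = :geometric k p :+ p :^ k

infix  4 _:=_
infixr 3 _⊛_:=_⇒_

-- k ⊛ p := q ⇒ C is the claim that p = q implies C; the multiplier k is
-- the cofactor of p - q in the intended proof.
data Claim (n : ℕ) : Set where
  _:=_     : Expr n → Expr n → Claim n
  _⊛_:=_⇒_ : (k p q : Expr n) → Claim n → Claim n

-- Vanishes identically exactly when the multipliers form a correct certificate, so checking a claim
-- is a single normalisation and needs no search in an ideal.
defect : ∀ {n} → Claim n → Expr n
defect (p := q)         = p :- q
defect (k ⊛ p := q ⇒ C) = defect C :- k :* (p :- q)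

vars : ∀ {n} → Vec (Expr n) n
vars = Vec.tabulate var

-- a + bρ + cρ²; negatives come from -1 = ρ + ρ².
record Coeff : Set where
  constructor coeff
  field
    c₀ c₁ c₂ : ℕ

-- Representations are not unique: because of 1 + ρ + ρ² = 0, the triples with three equal entries
-- are those that represent zero. Equality is therefore only tested as the vanishing of a
-- difference.
isZeroᶜ : Coeff → Bool
isZeroᶜ (coeff a b c) = (a ℕ.≡ᵇ b) ∧ (b ℕ.≡ᵇ c)

_+ᶜ_ _*ᶜ_ : Coeff → Coeff → Coeff
coeff a b c +ᶜ coeff d e f = coeff (a ℕ.+ d) (b ℕ.+ e) (c ℕ.+ f)
coeff a b c *ᶜ coeff d e f = coeff (a ℕ.* d ℕ.+ (b ℕ.* f ℕ.+ c ℕ.* e))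
                                   (a ℕ.* e ℕ.+ b ℕ.* d ℕ.+ c ℕ.* f)
                                   (a ℕ.* f ℕ.+ b ℕ.* e ℕ.+ c ℕ.* d)

Poly : ℕ → Set
Poly zero    = Coeff
Poly (suc n) = List (Poly n)

isZero : ∀ n → Poly n → Bool
isZero zero    c       = isZeroᶜ c
isZero (suc n) []      = true
isZero (suc n) (p ∷ l) = isZero n p ∧ isZero (suc n) l

0ᵖ : ∀ n → Poly n
0ᵖ zero    = coeff 0 0 0
0ᵖ (suc n) = []

constant : ∀ n → Coeff → Poly n
constant zero    c = c
constant (suc n) c = constant n c ∷ []

variable′ : ∀ n → Fin n → Poly n
variable′ (suc n) zero    = 0ᵖ n ∷ constant n (coeff 1 0 0) ∷ []
variable′ (suc n) (suc i) = variable′ n i ∷ []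

plus : ∀ n → Poly n → Poly n → Poly n
plus zero    c       d       = c +ᶜ d
plus (suc n) []      m       = m
plus (suc n) (p ∷ l) []      = p ∷ l
plus (suc n) (p ∷ l) (r ∷ m) = plus n p r ∷ plus (suc n) l m

negate-coeff : Coeff → Coeff
negate-coeff (coeff a b c) = coeff (b ℕ.+ c) (a ℕ.+ c) (a ℕ.+ b)

minus : ∀ n → Poly n → Poly n
minus zero    k       = negate-coeff k
minus (suc n) []      = []
minus (suc n) (p ∷ l) = minus n p ∷ minus (suc n) l

times : ∀ n → Poly n → Poly n → Poly n
scale : ∀ n → Poly n → List (Poly n) → List (Poly n)

times zero    c       d = c *ᶜ d
times (suc n) []      m = []
times (suc n) (p ∷ l) [] = []
times (suc n) (p ∷ l) m@(_ ∷ _) =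
  plus (suc n) (scale n p m) (0ᵖ n ∷ times (suc n) l m)

scale n p []      = []
scale n p (r ∷ m) = times n p r ∷ scale n p m

power : ∀ n → Poly n → ℕ → Poly n
power n p zero    = constant n (coeff 1 0 0)
power n p (suc k) = times n p (power n p k)

normalise : ∀ {n} → Expr n → Poly n
normalise {n} (var i)  = variable′ n i
normalise {n} :0       = 0ᵖ n
normalise {n} :1       = constant n (coeff 1 0 0)
normalise {n} :ρ       = constant n (coeff 0 1 0)
normalise {n} (:- p)   = minus n (normalise p)
normalise {n} (p :+ q) = plus n (normalise p) (normalise q)
normalise {n} (p :- q) =
  plus n (normalise p) (minus n (normalise q))
normalise {n} (p :* q) = times n (normalise p) (normalise q)
normalise {n} (p :^ k) = power n (normalise p) k
normalise {n} (k :· p) = times n (constant n (coeff k 0 0)) (normalise p)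

IsEisenstein : ∀ {c ℓ} (R : CommutativeRing c ℓ) → CommutativeRing.Carrier R → Set ℓ
IsEisenstein R ρ = 1# + ρ + ρ * ρ ≈ 0#
  where open CommutativeRing R

module Reflection {c ℓ} (R : CommutativeRing c ℓ) (ρ : CommutativeRing.Carrier R)
                  (1+ρ+ρ²≈0 : IsEisenstein R ρ) where

  open CommutativeRing R renaming (refl to ≈-refl)
  open Exp semiring using (_^_; ^-congˡ)
  open Mult semiring using (×-homo-+; ×1-homo-*; ×-congʳ; ×-assoc-*)
    renaming (_×_ to _·_)
  open RingProperties ring using (x∙y⁻¹≈ε⇒x≈y; +-inverseˡ-unique; x≈y⇒x∙y⁻¹≈ε; -0#≈0#; -‿distribʳ-*; -‿+-comm)
  open import Relation.Binary.Reasoning.Setoid setoid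

  private
    module S = NaturalSolver commutativeSemiring

  ⟦_⟧ : ∀ {n} → Expr n → Vec Carrier n → Carrier
  ⟦ var i ⟧  v = Vec.lookup v i
  ⟦ :0 ⟧     v = 0#
  ⟦ :1 ⟧     v = 1#
  ⟦ :ρ ⟧     v = ρ
  ⟦ :- p ⟧   v = - ⟦ p ⟧ v
  ⟦ p :+ q ⟧ v = ⟦ p ⟧ v + ⟦ q ⟧ v
  ⟦ p :- q ⟧ v = ⟦ p ⟧ v - ⟦ q ⟧ v
  ⟦ p :* q ⟧ v = ⟦ p ⟧ v * ⟦ q ⟧ v
  ⟦ p :^ k ⟧ v = ⟦ p ⟧ v ^ k
  ⟦ k :· p ⟧ v = k · ⟦ p ⟧ v

  Holds : ∀ {n} → Claim n → Vec Carrier n → Set ℓ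
  Holds (p := q)         v = ⟦ p ⟧ v ≈ ⟦ q ⟧ v
  Holds (k ⊛ p := q ⇒ C) v = ⟦ p ⟧ v ≈ ⟦ q ⟧ v → Holds C v

  private
    -- The auxiliary solver works in semirings, so ρ³ - 1 is not factored directly. Adding 1 + ρ +
    -- ρ² = 0 reduces the claim to ρ³ + (1 + ρ + ρ²) = ρ (1 + ρ + ρ²) + 1, which has no subtraction.
    ρ³≈1 : ρ * (ρ * ρ) ≈ 1#
    ρ³≈1 = x∙y⁻¹≈ε⇒x≈y _ _ (begin
      ρ * (ρ * ρ) - 1#
        ≈⟨ +-congʳ (+-identityʳ _) ⟨
      ρ * (ρ * ρ) + 0# - 1#
        ≈⟨ +-congʳ (+-congˡ (zeroʳ 1#)) ⟨
      ρ * (ρ * ρ) + 1# * 0# - 1#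
        ≈⟨ +-congʳ (+-congˡ (*-congˡ 1+ρ+ρ²≈0)) ⟨
      ρ * (ρ * ρ) + 1# * (1# + ρ + ρ * ρ) - 1#
        ≈⟨ +-congʳ (S.solve 1 (λ x → x S.:* (x S.:* x) S.:+ S.con 1 S.:* (S.con 1 S.:+ x S.:+ x S.:* x)
             S.:= x S.:* (S.con 1 S.:+ x S.:+ x S.:* x) S.:+ S.con 1) refl′ ρ) ⟩
      ρ * (1# + ρ + ρ * ρ) + 1# - 1#
        ≈⟨ +-assoc _ _ _ ⟩
      ρ * (1# + ρ + ρ * ρ) + (1# - 1#)
        ≈⟨ +-cong (*-congˡ 1+ρ+ρ²≈0) (-‿inverseʳ 1#) ⟩
      ρ * 0# + 0#
        ≈⟨ +-identityʳ _ ⟩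
      ρ * 0#
        ≈⟨ zeroʳ ρ ⟩
      0# ∎)
      where
      refl′ = ≈-refl

    ⟦_⟧ᶜ : Coeff → Carrier
    ⟦ coeff a b c ⟧ᶜ = a · 1# + b · 1# * ρ + c · 1# * (ρ * ρ)

    ⟦⟧ᶜ-zero : ∀ k → T (isZeroᶜ k) → ⟦ k ⟧ᶜ ≈ 0#
    ⟦⟧ᶜ-zero (coeff a b c) z with a ℕ.≡ᵇ b in ab | b ℕ.≡ᵇ c in bc
    ... | true | true with ℕ.≡ᵇ⇒≡ a b (≡.subst T (≡.sym ab) tt)
                         | ℕ.≡ᵇ⇒≡ b c (≡.subst T (≡.sym bc) tt)
    ...   | refl | refl = begin
      a · 1# + a · 1# * ρ + a · 1# * (ρ * ρ)
        ≈⟨ S.solve 2 (λ k x → k S.:+ k S.:* x S.:+ k S.:* (x S.:* x)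
             S.:= k S.:* (S.con 1 S.:+ x S.:+ x S.:* x)) ≈-refl (a · 1#) ρ ⟩
      a · 1# * (1# + ρ + ρ * ρ)
        ≈⟨ *-congˡ 1+ρ+ρ²≈0 ⟩
      a · 1# * 0#
        ≈⟨ zeroʳ _ ⟩
      0# ∎

    ⟦⟧ᶜ-homo-+ : ∀ k l → ⟦ k +ᶜ l ⟧ᶜ ≈ ⟦ k ⟧ᶜ + ⟦ l ⟧ᶜ
    ⟦⟧ᶜ-homo-+ (coeff a b c) (coeff d e f) = begin
      (a ℕ.+ d) · 1# + (b ℕ.+ e) · 1# * ρ + (c ℕ.+ f) · 1# * (ρ * ρ)
        ≈⟨ +-cong (+-cong (×-homo-+ 1# a d) (*-congʳ (×-homo-+ 1# b e)))
                  (*-congʳ (×-homo-+ 1# c f)) ⟩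
      (a · 1# + d · 1#) + (b · 1# + e · 1#) * ρ + (c · 1# + f · 1#) * (ρ * ρ)
        ≈⟨ S.solve 8 (λ a b c d e f x y →
             (a S.:+ d) S.:+ (b S.:+ e) S.:* x S.:+ (c S.:+ f) S.:* y
             S.:= (a S.:+ b S.:* x S.:+ c S.:* y) S.:+ (d S.:+ e S.:* x S.:+ f S.:* y))
             ≈-refl (a · 1#) (b · 1#) (c · 1#) (d · 1#) (e · 1#) (f · 1#) ρ (ρ * ρ) ⟩
      (a · 1# + b · 1# * ρ + c · 1# * (ρ * ρ)) + (d · 1# + e · 1# * ρ + f · 1# * (ρ * ρ)) ∎

    -- `_*ᶜ_` multiplies modulo x³ - 1. Reinserting ρ³ = 1 wherever an exponent was reduced leaves a
    -- plain identity of polynomials in ρ.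
    ⟦⟧ᶜ-homo-* : ∀ k l → ⟦ k *ᶜ l ⟧ᶜ ≈ ⟦ k ⟧ᶜ * ⟦ l ⟧ᶜ
    ⟦⟧ᶜ-homo-* (coeff a b c) (coeff d e f) = begin
      (a ℕ.* d ℕ.+ (b ℕ.* f ℕ.+ c ℕ.* e)) · 1#
        + (a ℕ.* e ℕ.+ b ℕ.* d ℕ.+ c ℕ.* f) · 1# * ρ
        + (a ℕ.* f ℕ.+ b ℕ.* e ℕ.+ c ℕ.* d) · 1# * (ρ * ρ)
        ≈⟨ +-cong (+-cong
             (trans (×-homo-+ 1# (a ℕ.* d) _) (+-cong (×1-homo-* a d)
               (trans (sum b f c e) (sym (trans (*-congˡ ρ³≈1) (*-identityʳ _))))))
             (*-congʳ (sum₃ a e b d c f)))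
             (*-congʳ (sum₃ a f b e c d)) ⟩
      (a · 1# * (d · 1#) + (b · 1# * (f · 1#) + c · 1# * (e · 1#)) * (ρ * (ρ * ρ)))
        + (a · 1# * (e · 1#) + b · 1# * (d · 1#) + c · 1# * (f · 1#)) * ρ
        + (a · 1# * (f · 1#) + b · 1# * (e · 1#) + c · 1# * (d · 1#)) * (ρ * ρ)
        ≈⟨ +-congʳ (+-congˡ (*-congʳ (+-congˡ (trans (*-congˡ ρ³≈1) (*-identityʳ _))))) ⟨
      (a · 1# * (d · 1#) + (b · 1# * (f · 1#) + c · 1# * (e · 1#)) * (ρ * (ρ * ρ)))
        + (a · 1# * (e · 1#) + b · 1# * (d · 1#) + c · 1# * (f · 1#) * (ρ * (ρ * ρ))) * ρ
        + (a · 1# * (f · 1#) + b · 1# * (e · 1#) + c · 1# * (d · 1#)) * (ρ * ρ)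
        ≈⟨ S.solve 7 (λ a b c d e f x →
             (a S.:* d S.:+ (b S.:* f S.:+ c S.:* e) S.:* (x S.:* (x S.:* x)))
             S.:+ (a S.:* e S.:+ b S.:* d S.:+ c S.:* f S.:* (x S.:* (x S.:* x))) S.:* x
             S.:+ (a S.:* f S.:+ b S.:* e S.:+ c S.:* d) S.:* (x S.:* x)
             S.:= (a S.:+ b S.:* x S.:+ c S.:* (x S.:* x))
                  S.:* (d S.:+ e S.:* x S.:+ f S.:* (x S.:* x)))
             ≈-refl (a · 1#) (b · 1#) (c · 1#) (d · 1#) (e · 1#) (f · 1#) ρ ⟩
      (a · 1# + b · 1# * ρ + c · 1# * (ρ * ρ)) * (d · 1# + e · 1# * ρ + f · 1# * (ρ * ρ)) ∎
      where
      sum : ∀ b f c e → (b ℕ.* f ℕ.+ c ℕ.* e) · 1# ≈ b · 1# * (f · 1#) + c · 1# * (e · 1#)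
      sum b f c e = trans (×-homo-+ 1# (b ℕ.* f) (c ℕ.* e))
                            (+-cong (×1-homo-* b f) (×1-homo-* c e))
      sum₃ : ∀ a e b d c f → (a ℕ.* e ℕ.+ b ℕ.* d ℕ.+ c ℕ.* f) · 1#
             ≈ a · 1# * (e · 1#) + b · 1# * (d · 1#) + c · 1# * (f · 1#)
      sum₃ a e b d c f = trans (×-homo-+ 1# (a ℕ.* e ℕ.+ b ℕ.* d) (c ℕ.* f))
                                 (+-cong (sum a e b d) (×1-homo-* c f))

    eval : ∀ n → Poly n → Vec Carrier n → Carrier
    eval zero    k       v       = ⟦ k ⟧ᶜ
    eval (suc n) []      v       = 0#
    eval (suc n) (p ∷ l) (x ∷ v) = eval n p v + x * eval (suc n) l (x ∷ v)

    eval-zero : ∀ n p v → T (isZero n p) → eval n p v ≈ 0#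
    eval-zero zero    k       v       z = ⟦⟧ᶜ-zero k z
    eval-zero (suc n) []      v       z = ≈-refl
    eval-zero (suc n) (p ∷ l) (x ∷ v) z with isZero n p in zp | isZero (suc n) l in zl
    ... | true | true = begin
      eval n p v + x * eval (suc n) l (x ∷ v)
        ≈⟨ +-cong (eval-zero n p v (≡.subst T (≡.sym zp) tt))
                  (*-congˡ (eval-zero (suc n) l (x ∷ v) (≡.subst T (≡.sym zl) tt))) ⟩
      0# + x * 0# ≈⟨ +-identityˡ _ ⟩
      x * 0#      ≈⟨ zeroʳ x ⟩
      0#          ∎

    eval-constant : ∀ n k v → eval n (constant n k) v ≈ ⟦ k ⟧ᶜ
    eval-constant zero    k v       = ≈-refl
    eval-constant (suc n) k (x ∷ v) = begin
      eval n (constant n k) v + x * 0# ≈⟨ +-congˡ (zeroʳ x) ⟩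
      eval n (constant n k) v + 0#     ≈⟨ +-identityʳ _ ⟩
      eval n (constant n k) v          ≈⟨ eval-constant n k v ⟩
      ⟦ k ⟧ᶜ                           ∎

    ⟦k⟧ᶜ : ∀ k → ⟦ coeff k 0 0 ⟧ᶜ ≈ k · 1#
    ⟦k⟧ᶜ k = S.solve 2 (λ k x → k S.:+ S.con 0 S.:* x S.:+ S.con 0 S.:* (x S.:* x) S.:= k)
               ≈-refl (k · 1#) ρ

    eval-0ᵖ : ∀ n v → eval n (0ᵖ n) v ≈ 0#
    eval-0ᵖ zero    v = ⟦k⟧ᶜ 0
    eval-0ᵖ (suc n) v = ≈-refl

    ⟦1⟧ᶜ : ⟦ coeff 1 0 0 ⟧ᶜ ≈ 1#
    ⟦1⟧ᶜ = trans (⟦k⟧ᶜ 1) (+-identityʳ 1#)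

    ⟦ρ⟧ᶜ : ⟦ coeff 0 1 0 ⟧ᶜ ≈ ρ
    ⟦ρ⟧ᶜ = S.solve 1 (λ x → S.con 0 S.:+ (S.con 1 S.:+ S.con 0) S.:* x S.:+ S.con 0 S.:* (x S.:* x) S.:= x)
               ≈-refl ρ

    eval-minus : ∀ n p v → eval n (minus n p) v ≈ - eval n p v
    eval-minus zero    (coeff a b c) v = +-inverseˡ-unique _ _ (begin
      ⟦ negate-coeff (coeff a b c) ⟧ᶜ + ⟦ coeff a b c ⟧ᶜ
        ≈⟨ +-congʳ (+-cong (+-cong (×-homo-+ 1# b c) (*-congʳ (×-homo-+ 1# a c)))
                           (*-congʳ (×-homo-+ 1# a b))) ⟩
      ((b · 1# + c · 1#) + (a · 1# + c · 1#) * ρ + (a · 1# + b · 1#) * (ρ * ρ)) + ⟦ coeff a b c ⟧ᶜ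
        ≈⟨ S.solve 4 (λ a b c x →
             ((b S.:+ c) S.:+ (a S.:+ c) S.:* x S.:+ (a S.:+ b) S.:* (x S.:* x))
               S.:+ (a S.:+ b S.:* x S.:+ c S.:* (x S.:* x))
             S.:= (a S.:+ b S.:+ c) S.:* (S.con 1 S.:+ x S.:+ x S.:* x))
             ≈-refl (a · 1#) (b · 1#) (c · 1#) ρ ⟩
      (a · 1# + b · 1# + c · 1#) * (1# + ρ + ρ * ρ)
        ≈⟨ *-congˡ 1+ρ+ρ²≈0 ⟩
      (a · 1# + b · 1# + c · 1#) * 0#
        ≈⟨ zeroʳ _ ⟩
      0# ∎)
    eval-minus (suc n) []      v       = sym -0#≈0#
    eval-minus (suc n) (p ∷ l) (x ∷ v) = begin
      eval n (minus n p) v + x * eval (suc n) (minus (suc n) l) (x ∷ v)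
        ≈⟨ +-cong (eval-minus n p v) (*-congˡ (eval-minus (suc n) l (x ∷ v))) ⟩
      - eval n p v + x * (- eval (suc n) l (x ∷ v))
        ≈⟨ +-congˡ (-‿distribʳ-* x _) ⟨
      - eval n p v - x * eval (suc n) l (x ∷ v)
        ≈⟨ -‿+-comm _ _ ⟩
      - (eval n p v + x * eval (suc n) l (x ∷ v)) ∎

    eval-variable : ∀ n i v → eval n (variable′ n i) v ≈ Vec.lookup v i
    eval-variable (suc n) zero    (x ∷ v) = begin
      eval n (0ᵖ n) v + x * (eval n (constant n _) v + x * 0#)
        ≈⟨ +-cong (eval-0ᵖ n v)
             (*-congˡ (+-congʳ (trans (eval-constant n _ v) ⟦1⟧ᶜ))) ⟩
      0# + x * (1# + x * 0#)
        ≈⟨ S.solve 1 (λ x → S.con 0 S.:+ x S.:* (S.con 1 S.:+ x S.:* S.con 0) S.:= x) ≈-refl x ⟩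
      x ∎
    eval-variable (suc n) (suc i) (x ∷ v) =
      trans (+-congˡ (zeroʳ x)) (trans (+-identityʳ _) (eval-variable n i v))

    eval-plus : ∀ n p q v → eval n (plus n p q) v ≈ eval n p v + eval n q v
    eval-plus zero    k       l       v       = ⟦⟧ᶜ-homo-+ k l
    eval-plus (suc n) []      m       v       = sym (+-identityˡ _)
    eval-plus (suc n) (p ∷ l) []      v       = sym (+-identityʳ _)
    eval-plus (suc n) (p ∷ l) (r ∷ m) (x ∷ v) = begin
      eval n (plus n p r) v + x * eval (suc n) (plus (suc n) l m) (x ∷ v)
        ≈⟨ +-cong (eval-plus n p r v) (*-congˡ (eval-plus (suc n) l m (x ∷ v))) ⟩
      (eval n p v + eval n r v) + x * (eval (suc n) l (x ∷ v) + eval (suc n) m (x ∷ v))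
        ≈⟨ S.solve 5 (λ x p r l m → (p S.:+ r) S.:+ x S.:* (l S.:+ m)
                        S.:= (p S.:+ x S.:* l) S.:+ (r S.:+ x S.:* m))
             ≈-refl x _ _ _ _ ⟩
      (eval n p v + x * eval (suc n) l (x ∷ v)) + (eval n r v + x * eval (suc n) m (x ∷ v)) ∎

    eval-times : ∀ n p q v → eval n (times n p q) v ≈ eval n p v * eval n q v
    eval-scale : ∀ n p m x v → eval (suc n) (scale n p m) (x ∷ v)
                               ≈ eval n p v * eval (suc n) m (x ∷ v)

    eval-times zero    k       l v       = ⟦⟧ᶜ-homo-* k l
    eval-times (suc n) []      m v       = sym (zeroˡ _)
    eval-times (suc n) (p ∷ l) [] v = sym (zeroʳ _)
    eval-times (suc n) (p ∷ l) m@(_ ∷ _) (x ∷ v) = begin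
      eval (suc n) (plus (suc n) (scale n p m) (0ᵖ n ∷ times (suc n) l m)) (x ∷ v)
        ≈⟨ eval-plus (suc n) (scale n p m) (0ᵖ n ∷ times (suc n) l m) (x ∷ v) ⟩
      eval (suc n) (scale n p m) (x ∷ v)
        + (eval n (0ᵖ n) v + x * eval (suc n) (times (suc n) l m) (x ∷ v))
        ≈⟨ +-cong (eval-scale n p m x v)
             (+-cong (eval-0ᵖ n v) (*-congˡ (eval-times (suc n) l m (x ∷ v)))) ⟩
      eval n p v * eval (suc n) m (x ∷ v)
        + (0# + x * (eval (suc n) l (x ∷ v) * eval (suc n) m (x ∷ v)))
        ≈⟨ S.solve 4 (λ x p l m → p S.:* m S.:+ (S.con 0 S.:+ x S.:* (l S.:* m))
                        S.:= (p S.:+ x S.:* l) S.:* m) ≈-refl x _ _ _ ⟩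
      (eval n p v + x * eval (suc n) l (x ∷ v)) * eval (suc n) m (x ∷ v) ∎

    eval-scale n p []      x v = sym (zeroʳ _)
    eval-scale n p (r ∷ m) x v = begin
      eval n (times n p r) v + x * eval (suc n) (scale n p m) (x ∷ v)
        ≈⟨ +-cong (eval-times n p r v) (*-congˡ (eval-scale n p m x v)) ⟩
      eval n p v * eval n r v + x * (eval n p v * eval (suc n) m (x ∷ v))
        ≈⟨ S.solve 4 (λ x p r m → p S.:* r S.:+ x S.:* (p S.:* m)
                        S.:= p S.:* (r S.:+ x S.:* m)) ≈-refl x _ _ _ ⟩
      eval n p v * (eval n r v + x * eval (suc n) m (x ∷ v)) ∎

    eval-power : ∀ n p k v → eval n (power n p k) v ≈ eval n p v ^ k
    eval-power n p zero    v = trans (eval-constant n _ v) ⟦1⟧ᶜ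
    eval-power n p (suc k) v =
      trans (eval-times n p (power n p k) v) (*-congˡ (eval-power n p k v))

    eval-normalise : ∀ {n} p (v : Vec Carrier n) → eval n (normalise p) v ≈ ⟦ p ⟧ v
    eval-normalise {n} (var i)  v = eval-variable n i v
    eval-normalise {n} :0       v = eval-0ᵖ n v
    eval-normalise {n} :1       v = trans (eval-constant n _ v) ⟦1⟧ᶜ
    eval-normalise {n} :ρ       v = trans (eval-constant n _ v) ⟦ρ⟧ᶜ
    eval-normalise {n} (:- p)   v =
      trans (eval-minus n (normalise p) v) (-‿cong (eval-normalise p v))
    eval-normalise {n} (p :+ q) v =
      trans (eval-plus n (normalise p) (normalise q) v)
              (+-cong (eval-normalise p v) (eval-normalise q v))
    eval-normalise {n} (p :- q) v =
      trans (eval-plus n (normalise p) _ v) (+-cong (eval-normalise p v)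
                (trans (eval-minus n (normalise q) v) (-‿cong (eval-normalise q v))))
    eval-normalise {n} (p :* q) v =
      trans (eval-times n (normalise p) (normalise q) v)
              (*-cong (eval-normalise p v) (eval-normalise q v))
    eval-normalise {n} (p :^ k) v =
      trans (eval-power n (normalise p) k v) (^-congˡ k (eval-normalise p v))
    eval-normalise {n} (k :· p) v = begin
      eval n (times n (constant n (coeff k 0 0)) (normalise p)) v
        ≈⟨ eval-times n (constant n (coeff k 0 0)) (normalise p) v ⟩
      eval n (constant n (coeff k 0 0)) v * eval n (normalise p) v
        ≈⟨ *-cong (trans (eval-constant n _ v) (⟦k⟧ᶜ k)) (eval-normalise p v) ⟩
      k · 1# * ⟦ p ⟧ v
        ≈⟨ ×-assoc-* k 1# _ ⟩
      k · (1# * ⟦ p ⟧ v)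
        ≈⟨ ×-congʳ k (*-identityˡ _) ⟩
      k · ⟦ p ⟧ v ∎

    holds : ∀ {n} (C : Claim n) v → ⟦ defect C ⟧ v ≈ 0# → Holds C v
    holds (p := q)         v d≈0 = x∙y⁻¹≈ε⇒x≈y _ _ d≈0
    holds (k ⊛ p := q ⇒ C) v d≈0 p≈q = holds C v (begin
      ⟦ defect C ⟧ v                             ≈⟨ x∙y⁻¹≈ε⇒x≈y _ _ d≈0 ⟩
      ⟦ k ⟧ v * (⟦ p ⟧ v - ⟦ q ⟧ v)              ≈⟨ *-congˡ (x≈y⇒x∙y⁻¹≈ε p≈q) ⟩
      ⟦ k ⟧ v * 0#                               ≈⟨ zeroʳ _ ⟩
      0#                                         ∎)

  abstract
    -- Once the defect normalises to zero, the implicit argument has the unit type and is filled in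
    -- by itself, so every identity is verified by computation at the place where it is used.
    solve : ∀ {n} (v : Vec Carrier n) (C : N-ary n (Expr n) (Claim n))
            {_ : T (isZero n (normalise (defect (C $ⁿ vars))))} → Holds (C $ⁿ vars) v
    solve {n} v C {z} = holds (C $ⁿ vars) v (trans
      (sym (eval-normalise (defect (C $ⁿ vars)) v))
      (eval-zero n (normalise (defect (C $ⁿ vars))) v z))

  ⟦_⟧-cong : ∀ {n} (p : Expr n) {v w} → (∀ i → Vec.lookup v i ≈ Vec.lookup w i) →
             ⟦ p ⟧ v ≈ ⟦ p ⟧ w
  ⟦ var i ⟧-cong  v≈w = v≈w i
  ⟦ :0 ⟧-cong     v≈w = ≈-refl
  ⟦ :1 ⟧-cong     v≈w = ≈-refl
  ⟦ :ρ ⟧-cong     v≈w = ≈-refl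
  ⟦ :- p ⟧-cong   v≈w = -‿cong (⟦ p ⟧-cong v≈w)
  ⟦ p :+ q ⟧-cong v≈w = +-cong (⟦ p ⟧-cong v≈w) (⟦ q ⟧-cong v≈w)
  ⟦ p :- q ⟧-cong v≈w = +-cong (⟦ p ⟧-cong v≈w) (-‿cong (⟦ q ⟧-cong v≈w))
  ⟦ p :* q ⟧-cong v≈w = *-cong (⟦ p ⟧-cong v≈w) (⟦ q ⟧-cong v≈w)
  ⟦ p :^ k ⟧-cong v≈w = ^-congˡ k (⟦ p ⟧-cong v≈w)
  ⟦ k :· p ⟧-cong v≈w = ×-congʳ k (⟦ p ⟧-cong v≈w)

-- Fields in which 6ρ ≠ 0 = ρ² + ρ + 1

record EisensteinField c ℓ : Set (ℓsuc (c ⊔ ℓ)) where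
  field
    fieldᴱ : Field c ℓ
  open Field fieldᴱ public hiding (zero)
  field
    ρ         : Carrier
    eisenstein : IsEisenstein commutativeRing ρ
    2≉0       : 2 · 1# ≉ 0#
    3≉0       : 3 · 1# ≉ 0#

module FieldProperties {c ℓ} (F : Field c ℓ) where
  open Field F hiding (zero) renaming (refl to ≈-refl)
  open import Relation.Binary.Reasoning.Setoid setoid
  open RingProperties ring using (-‿involutive; x≈y⇒x∙y⁻¹≈ε; x∙y⁻¹≈ε⇒x≈y)

  *-inverseʳ : ∀ {x} → x ≉ 0# → x * x ⁻¹ ≈ 1#
  *-inverseʳ {x} x≉0 with x ≟ 0#
  ... | yes x≈0 = contradiction x≈0 x≉0
  ... | no  p   = proj₂ (inverse x p)

  *-cancelˡ : ∀ {x y z} → x ≉ 0# → x * y ≈ x * z → y ≈ z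
  *-cancelˡ {x} {y} {z} x≉0 xy≈xz = begin
    y                ≈⟨ *-identityˡ y ⟨
    1# * y           ≈⟨ *-congʳ x⁻¹x≈1 ⟨
    (x ⁻¹ * x) * y   ≈⟨ *-assoc _ _ _ ⟩
    x ⁻¹ * (x * y)   ≈⟨ *-congˡ xy≈xz ⟩
    x ⁻¹ * (x * z)   ≈⟨ *-assoc _ _ _ ⟨
    (x ⁻¹ * x) * z   ≈⟨ *-congʳ x⁻¹x≈1 ⟩
    1# * z           ≈⟨ *-identityˡ z ⟩
    z                ∎
    where
    x⁻¹x≈1 = trans (*-comm _ _) (*-inverseʳ x≉0)

  x*y≈0⇒x≈0⊎y≈0 : ∀ {x y} → x * y ≈ 0# → x ≈ 0# ⊎ y ≈ 0#
  x*y≈0⇒x≈0⊎y≈0 {x} xy≈0 with x ≟ 0#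
  ... | yes x≈0 = inj₁ x≈0
  ... | no  x≉0 = inj₂ (*-cancelˡ x≉0 (trans xy≈0 (sym (zeroʳ x))))

  *-≉0 : ∀ {x y} → x ≉ 0# → y ≉ 0# → x * y ≉ 0#
  *-≉0 x≉0 y≉0 xy≈0 = [ x≉0 , y≉0 ]′ (x*y≈0⇒x≈0⊎y≈0 xy≈0)

  ^-≉0 : ∀ {x} n → x ≉ 0# → x ^ n ≉ 0#
  ^-≉0 zero    x≉0 = 1≉0
  ^-≉0 (suc n) x≉0 = *-≉0 x≉0 (^-≉0 n x≉0)

  ≉0-resp : ∀ {x y} → x ≈ y → y ≉ 0# → x ≉ 0#
  ≉0-resp x≈y y≉0 x≈0 = y≉0 (trans (sym x≈y) x≈0)

  *-≉0ˡ : ∀ {x y} → x * y ≉ 0# → x ≉ 0#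
  *-≉0ˡ {y = y} xy≉0 x≈0 = xy≉0 (trans (*-congʳ x≈0) (zeroˡ y))

  *-≉0ʳ : ∀ {x y} → x * y ≉ 0# → y ≉ 0#
  *-≉0ʳ {x} xy≉0 y≈0 = xy≉0 (trans (*-congˡ y≈0) (zeroʳ x))

  -‿≉0 : ∀ {x} → x ≉ 0# → - x ≉ 0#
  -‿≉0 {x} x≉0 -x≈0 = x≉0 (begin
    x      ≈⟨ -‿involutive x ⟨
    - - x  ≈⟨ -‿cong -x≈0 ⟩
    - 0#   ≈⟨ +-identityˡ _ ⟨
    0# - 0# ≈⟨ -‿inverseʳ 0# ⟩
    0#     ∎)

  x≉y⇒x-y≉0 : ∀ {x y} → x ≉ y → x - y ≉ 0#
  x≉y⇒x-y≉0 x≉y x-y≈0 = x≉y (x∙y⁻¹≈ε⇒x≈y _ _ x-y≈0)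

  x-y≉0⇒x≉y : ∀ {x y} → x - y ≉ 0# → x ≉ y
  x-y≉0⇒x≉y x-y≉0 x≈y = x-y≉0 (x≈y⇒x∙y⁻¹≈ε x≈y)

  x-y≈0⇒x≈y : ∀ {x y} → x - y ≈ 0# → x ≈ y
  x-y≈0⇒x≈y = x∙y⁻¹≈ε⇒x≈y _ _

module EisensteinProperties {c ℓ} (F : EisensteinField c ℓ) where
  open EisensteinField F renaming (refl to ≈-refl) public
  open FieldProperties fieldᴱ public
  open Reflection commutativeRing ρ eisenstein public

  x²≈y²⇒x≈±y : ∀ {x y} → x ^ 2 ≈ y ^ 2 → x ≈ y ⊎ x ≈ - y
  x²≈y²⇒x≈±y {x} {y} x²≈y² with x*y≈0⇒x≈0⊎y≈0
    (solve (x ∷ y ∷ []) (λ x y → :1 ⊛ x :^ 2 := y :^ 2 ⇒ (x :- y) :* (x :+ y) := :0) x²≈y²)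
  ... | inj₁ x-y≈0 = inj₁ (solve (x ∷ y ∷ []) (λ x y → :1 ⊛ x :- y := :0 ⇒ x := y) x-y≈0)
  ... | inj₂ x+y≈0 = inj₂ (solve (x ∷ y ∷ []) (λ x y → :1 ⊛ x :+ y := :0 ⇒ x := :- y) x+y≈0)

  /-*-cancel : ∀ {x y} → y ≉ 0# → (x / y) * y ≈ x
  /-*-cancel {x} {y} y≉0 = solve (x ∷ y ∷ y ⁻¹ ∷ []) (λ x y y⁻¹ →
    x ⊛ y :* y⁻¹ := :1 ⇒ (x :* y⁻¹) :* y := x) (*-inverseʳ y≉0)

  -- A square root of -3.
  θ : Carrier
  θ = 1# + 2 · ρ

  :θ : ∀ {n} → Expr n
  :θ = :1 :+ 2 :· :ρ

  θ≉0 : θ ≉ 0#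
  θ≉0 = *-≉0ˡ {y = θ} (≉0-resp (solve [] (:θ :* :θ := :- (3 :· :1))) (-‿≉0 3≉0))

  ρ≉0 : ρ ≉ 0#
  ρ≉0 = *-≉0ˡ {y = ρ ^ 2} (≉0-resp (solve [] (:ρ :* :ρ :^ 2 := :1)) 1≉0)

  1-ρ≉0 : 1# - ρ ≉ 0#
  1-ρ≉0 = *-≉0ˡ {y = 1# - ρ ^ 2}
    (≉0-resp (solve [] ((:1 :- :ρ) :* (:1 :- :ρ :^ 2) := 3 :· :1)) 3≉0)

  -- The inverse of 6; the inverse of 2 is then `3 · h`.
  h : Carrier
  h = (2 · 1# * (3 · 1#)) ⁻¹

  6h≈1 : 6 · h ≈ 1#
  6h≈1 = solve (h ∷ []) (λ h → :1 ⊛ 2 :· :1 :* 3 :· :1 :* h := :1 ⇒ 6 :· h := :1)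
    (*-inverseʳ (*-≉0 2≉0 3≉0))

  h≉0 : h ≉ 0#
  h≉0 = *-≉0ʳ {x = 2 · 1# * (3 · 1#)} (≉0-resp (*-inverseʳ (*-≉0 2≉0 3≉0)) 1≉0)

-- Finite fields inside larger fields

module Embedding {c ℓ} {F K : Field c ℓ} (ι : F ↪ K) where
  private
    module F = Field F
    module K = Field K
  open _↪_ ι public
  open IsRingHomomorphism isRingHomomorphism public
    using (⟦⟧-cong; +-homo; *-homo; -‿homo; 0#-homo; 1#-homo)
  open import Relation.Binary.Reasoning.Setoid K.setoid

  -- A nonzero difference is a unit, and a ring homomorphism cannot send a unit to 0 in a field.
  ⟦⟧-injective : ∀ {x y} → ⟦ x ⟧ K.≈ ⟦ y ⟧ → x F.≈ y
  ⟦⟧-injective {x} {y} ⟦x⟧≈⟦y⟧ with x F.- y F.≟ F.0#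
  ... | yes x-y≈0 = FieldProperties.x-y≈0⇒x≈y F x-y≈0
  ... | no  x-y≉0 = contradiction (begin
    K.1#                                        ≈⟨ 1#-homo ⟨
    ⟦ F.1# ⟧                                    ≈⟨ ⟦⟧-cong (FieldProperties.*-inverseʳ F x-y≉0) ⟨
    ⟦ (x F.- y) F.* (x F.- y) F.⁻¹ ⟧            ≈⟨ *-homo _ _ ⟩
    ⟦ x F.- y ⟧ K.* ⟦ (x F.- y) F.⁻¹ ⟧          ≈⟨ K.*-congʳ (+-homo x (F.- y)) ⟩
    (⟦ x ⟧ K.+ ⟦ F.- y ⟧) K.* _                 ≈⟨ K.*-congʳ (K.+-cong ⟦x⟧≈⟦y⟧ (-‿homo y)) ⟩
    (⟦ y ⟧ K.+ K.- ⟦ y ⟧) K.* _                 ≈⟨ K.*-congʳ (K.-‿inverseʳ ⟦ y ⟧) ⟩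
    K.0# K.* _                                  ≈⟨ K.zeroˡ _ ⟩
    K.0#                                        ∎) K.1≉0

  ⟦⟧-≉0 : ∀ {x} → x F.≉ F.0# → ⟦ x ⟧ K.≉ K.0#
  ⟦⟧-≉0 x≉0 ⟦x⟧≈0 = x≉0 (⟦⟧-injective (K.trans ⟦x⟧≈0 (K.sym 0#-homo)))

  ^-homo : ∀ x n → ⟦ x F.^ n ⟧ K.≈ ⟦ x ⟧ K.^ n
  ^-homo x zero    = 1#-homo
  ^-homo x (suc n) = K.trans (*-homo x _) (K.*-congˡ (^-homo x n))

  ·-homo : ∀ n x → ⟦ n F.· x ⟧ K.≈ n K.· ⟦ x ⟧
  ·-homo zero    x = 0#-homo
  ·-homo (suc n) x = K.trans (+-homo x _) (K.+-congˡ (·-homo n x))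

module Enumerated {c ℓ} (F : Field c ℓ) {n} (size : FieldOfSize F n) where
  open Field F hiding (zero) renaming (refl to ≈-refl)

  enum : Fin n → Carrier
  enum = proj₁ size

  enum-injective : ∀ {i j} → enum i ≈ enum j → i ≡ j
  enum-injective = proj₁ (proj₂ size)

  index : Carrier → Fin n
  index x = proj₁ (proj₂ (proj₂ size) x)

  enum-index : ∀ x → enum (index x) ≈ x
  enum-index x = proj₂ (proj₂ (proj₂ size) x) refl

-- Fermat's little theorem

module Fermat {c ℓ} (F : Field c ℓ) {n} (size : FieldOfSize F n) where
  open Field F hiding (zero) renaming (refl to ≈-refl)
  open FieldProperties F
  open Enumerated F size
  open Exp semiring using (^-congˡ)
  open import Relation.Binary.Reasoning.Setoid setoid
  private
    module Prod = Sum *-commutativeMonoid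
    open Prod using () renaming (sum to product)

    product-≉0 : ∀ {n} (f : Fin n → Carrier) → (∀ i → f i ≉ 0#) → product f ≉ 0#
    product-≉0 {zero}  f f≉0 = 1≉0
    product-≉0 {suc n} f f≉0 = *-≉0 (f≉0 zero) (product-≉0 (f ∘ suc) (f≉0 ∘ suc))

    product-single : ∀ {n} (f : Fin n → Carrier) i → (∀ j → ¬ j ≡ i → f j ≈ 1#) → product f ≈ f i
    product-single {suc n} f i f≈1 = begin
      product f                                ≈⟨ Prod.sum-remove f ⟩
      f i * product (f ∘ Fin.punchIn i)        ≈⟨ *-congˡ (Prod.sum-cong-≋ λ j → f≈1 _ (Fin.punchInᵢ≢i i j)) ⟩
      f i * product {n} (λ _ → 1#)             ≈⟨ *-congˡ (Prod.sum-replicate-zero n) ⟩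
      f i * 1#                                 ≈⟨ *-identityʳ _ ⟩
      f i                                      ∎

    ifZero : Carrier → (x y : Carrier) → Carrier
    ifZero y u v with y ≟ 0#
    ... | yes _ = u
    ... | no  _ = v

    ifZero-yes : ∀ {y} u v → y ≈ 0# → ifZero y u v ≈ u
    ifZero-yes {y} u v y≈0 with y ≟ 0#
    ... | yes _   = ≈-refl
    ... | no  y≉0 = contradiction y≈0 y≉0

    ifZero-no : ∀ {y} u v → y ≉ 0# → ifZero y u v ≈ v
    ifZero-no {y} u v y≉0 with y ≟ 0#
    ... | yes y≈0 = contradiction y≈0 y≉0
    ... | no  _   = ≈-refl

    -- Replacing 0 by 1 turns the product over all elements into the product over the nonzero ones,
    -- without enumerating the latter.
    unit : Carrier → Carrier
    unit y = ifZero y 1# y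

    unit-≉0 : ∀ y → unit y ≉ 0#
    unit-≉0 y with y ≟ 0#
    ... | yes _   = 1≉0
    ... | no  y≉0 = y≉0

    unit-cong : ∀ {y z} → y ≈ z → unit y ≈ unit z
    unit-cong {y} {z} y≈z with z ≟ 0#
    ... | yes z≈0 = ifZero-yes 1# y (trans y≈z z≈0)
    ... | no  z≉0 = trans (ifZero-no 1# y (≉0-resp y≈z z≉0)) y≈z

    -- Multiplication by x permutes the units and multiplies their product by
    -- ∏ d = xⁿ⁻¹, which is therefore 1.
    module _ (x : Carrier) (x≉0 : x ≉ 0#) where
      d c′ u : Fin n → Carrier
      d  i = ifZero (enum i) 1# x
      c′ i = ifZero (enum i) x 1#
      u  i = unit (enum i)

      unit-* : ∀ y → unit (x * y) ≈ ifZero y 1# x * unit y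
      unit-* y with y ≟ 0#
      ... | yes y≈0 = trans (ifZero-yes 1# _ (trans (*-congˡ y≈0) (zeroʳ x))) (sym (*-identityˡ _))
      ... | no  y≉0 = ifZero-no 1# _ (*-≉0 x≉0 y≉0)

      d*c : ∀ y → ifZero y 1# x * ifZero y x 1# ≈ x
      d*c y with y ≟ 0#
      ... | yes _ = *-identityˡ x
      ... | no  _ = *-identityʳ x

      mul : Carrier → Fin n → Fin n
      mul y i = index (y * enum i)

      mul-mul : ∀ y z → y * z ≈ 1# → ∀ i → mul y (mul z i) ≡ i
      mul-mul y z yz≈1 i = enum-injective (begin
        enum (mul y (mul z i))   ≈⟨ enum-index _ ⟩
        y * enum (mul z i)       ≈⟨ *-congˡ (enum-index _) ⟩
        y * (z * enum i)         ≈⟨ *-assoc _ _ _ ⟨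
        (y * z) * enum i         ≈⟨ *-congʳ yz≈1 ⟩
        1# * enum i              ≈⟨ *-identityˡ _ ⟩
        enum i                   ∎)

      π : Perm.Permutation n n
      π = Perm.permutation (mul x) (mul (x ⁻¹))
            (mul-mul x (x ⁻¹) (*-inverseʳ x≉0))
            (mul-mul (x ⁻¹) x (trans (*-comm _ _) (*-inverseʳ x≉0)))

      ∏d≈1 : product d ≈ 1#
      ∏d≈1 = *-cancelˡ (product-≉0 u (λ i → unit-≉0 (enum i))) (begin
        product u * product d        ≈⟨ *-comm _ _ ⟩
        product d * product u        ≈⟨ Prod.∑-distrib-+ d u ⟨
        product (λ i → d i * u i)    ≈⟨ Prod.sum-cong-≋ (λ i → unit-* (enum i)) ⟨
        product (λ i → unit (x * enum i)) ≈⟨ Prod.sum-cong-≋ (λ i → unit-cong (enum-index (x * enum i))) ⟨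
        product (u ∘ mul x)          ≈⟨ Prod.sum-permute u π ⟨
        product u                    ≈⟨ *-identityʳ _ ⟨
        product u * 1#               ∎)

      ∏c≈x : product c′ ≈ x
      ∏c≈x = trans
        (product-single c′ (index 0#) (λ j j≢ → ifZero-no x 1# (λ ej≈0 →
          j≢ (enum-injective (trans ej≈0 (sym (enum-index 0#)))))))
        (ifZero-yes x 1# (enum-index 0#))

      x^n≈x : x ^ n ≈ x
      x^n≈x = begin
        x ^ n                          ≈⟨ Prod.sum-replicate n ⟨
        product {n} (λ _ → x)          ≈⟨ Prod.sum-cong-≋ (λ i → d*c (enum i)) ⟨
        product (λ i → d i * c′ i)     ≈⟨ Prod.∑-distrib-+ d c′ ⟩
        product d * product c′         ≈⟨ *-cong ∏d≈1 ∏c≈x ⟩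
        1# * x                         ≈⟨ *-identityˡ x ⟩
        x                              ∎

    0^n≈0 : ∀ {m} → Fin m → 0# ^ m ≈ 0#
    0^n≈0 {suc m} _ = zeroˡ _

  fermat : ∀ x → x ^ n ≈ x
  fermat x with x ≟ 0#
  ... | no  x≉0 = x^n≈x x x≉0
  ... | yes x≈0 = trans (^-congˡ n x≈0) (trans (0^n≈0 (index 0#)) (sym x≈0))

  1<n : 1 ℕ.< n
  1<n = two (λ z≡o → 1≉0 (trans (sym (enum-index 1#))
          (trans (reflexive (≡.cong enum (≡.sym z≡o))) (enum-index 0#))))
    where
    two : ∀ {m} {i j : Fin m} → ¬ i ≡ j → 1 ℕ.< m
    two {suc zero}    {zero} {zero} i≢j = contradiction refl i≢j
    two {suc (suc m)}               _   = ℕ.s≤s (ℕ.s≤s ℕ.z≤n)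

-- Roots of monic polynomials

module Roots {c ℓ} (F : Field c ℓ) where
  open Field F hiding (zero) renaming (refl to ≈-refl)
  open FieldProperties F
  open import Relation.Binary.Reasoning.Setoid setoid
  private
    module S = NaturalSolver commutativeSemiring

  -- Synthetic division by x - a.
  quotient : ∀ {n} → Vec Carrier (suc n) → Carrier → Vec Carrier n
  quotient (k ∷ [])       a = []
  quotient (k ∷ ks@(_ ∷ _)) a = evalMonic ks a ∷ quotient ks a

  -- This is p(x) - p(a) = (x - a) q(x), with the negative terms moved to the other side for the
  -- semiring solver.
  evalMonic-quotient : ∀ {n} (ks : Vec Carrier (suc n)) a x →
    evalMonic ks x + a * evalMonic (quotient ks a) x ≈ evalMonic ks a + x * evalMonic (quotient ks a) x
  evalMonic-quotient (k ∷ []) a x = S.solve 3 (λ k a x →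
      k S.:+ x S.:* S.con 1 S.:+ a S.:* S.con 1 S.:= k S.:+ a S.:* S.con 1 S.:+ x S.:* S.con 1) ≈-refl k a x
  evalMonic-quotient (k ∷ ks@(_ ∷ _)) a x = begin
    (k + x * p) + a * (r + x * q) ≈⟨ S.solve 6 (λ k x p a r q →
        k S.:+ x S.:* p S.:+ a S.:* (r S.:+ x S.:* q)
        S.:= k S.:+ a S.:* r S.:+ x S.:* (p S.:+ a S.:* q)) ≈-refl k x p a r q ⟩
    k + a * r + x * (p + a * q)   ≈⟨ +-congˡ (*-congˡ (evalMonic-quotient ks a x)) ⟩
    k + a * r + x * (r + x * q)   ∎
    where
    p = evalMonic ks x
    r = evalMonic ks a
    q = evalMonic (quotient ks a) x

  -- Induction on the degree: after division by the linear factor of one root, the others are roots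
  -- of the quotient because they differ from it.
  few-roots : ∀ {n} (ks : Vec Carrier n) (r : Fin (suc n) → Carrier) →
              (∀ i → evalMonic ks (r i) ≈ 0#) → (∀ {i j} → r i ≈ r j → i ≡ j) → ⊥
  few-roots []       r root inj = 1≉0 (root zero)
  few-roots (k ∷ ks) r root inj = few-roots (quotient (k ∷ ks) a) (r ∘ suc) root′
      (Fin.suc-injective ∘ inj)
    where
    a = r zero
    root′ : ∀ i → evalMonic (quotient (k ∷ ks) a) (r (suc i)) ≈ 0#
    root′ i with q ← evalMonic (quotient (k ∷ ks) a) (r (suc i)) in eq
            with evalMonic-quotient (k ∷ ks) a (r (suc i))
    ... | e rewrite eq with q ≟ 0#
    ...   | yes q≈0 = q≈0
    ...   | no  q≉0 with () ← inj {zero} {suc i} (*-cancelˡ q≉0 (begin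
      q * a                                  ≈⟨ *-comm q a ⟩
      a * q                                  ≈⟨ +-identityˡ _ ⟨
      0# + a * q                             ≈⟨ +-congʳ (root (suc i)) ⟨
      evalMonic (k ∷ ks) (r (suc i)) + a * q ≈⟨ e ⟩
      evalMonic (k ∷ ks) a + r (suc i) * q   ≈⟨ +-congʳ (root zero) ⟩
      0# + r (suc i) * q                     ≈⟨ +-identityˡ _ ⟩
      r (suc i) * q                          ≈⟨ *-comm _ q ⟩
      q * r (suc i)                          ∎))

module FixedPoints {c ℓ} {F K : Field c ℓ} (ι : F ↪ K) {n} (size : FieldOfSize F n) where
  private
    module F = Field F
  open Field K hiding (zero) renaming (refl to ≈-refl)
  open Embedding ι
  open FieldProperties K
  open Enumerated F size
  open Fermat F size using (fermat; 1<n)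
  open RingProperties ring using (-1*x≈-x)

  ⟦⟧-fixed : ∀ x → ⟦ x ⟧ ^ n ≈ ⟦ x ⟧
  ⟦⟧-fixed x = trans (sym (^-homo x n)) (⟦⟧-cong (fermat x))

  private
    x^n-x : ∀ {m} → 1 ℕ.< m → Vec Carrier m
    x^n-x {suc (suc m)} (ℕ.s≤s (ℕ.s≤s _)) = 0# ∷ - 1# ∷ Vec.replicate m 0#

    evalMonic-0 : ∀ m x → evalMonic (Vec.replicate m 0#) x ≈ x ^ m
    evalMonic-0 zero    x = ≈-refl
    evalMonic-0 (suc m) x = trans (+-identityˡ _) (*-congˡ (evalMonic-0 m x))

    evalMonic-x^n-x : ∀ {m} (1<m : 1 ℕ.< m) {x} → x ^ m ≈ x → evalMonic (x^n-x 1<m) x ≈ 0#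
    evalMonic-x^n-x {suc (suc m)} (ℕ.s≤s (ℕ.s≤s _)) {x} fixed = begin
      0# + x * (- 1# + x * evalMonic (Vec.replicate m 0#) x) ≈⟨ +-identityˡ _ ⟩
      x * (- 1# + x * evalMonic (Vec.replicate m 0#) x)      ≈⟨ *-congˡ (+-congˡ (*-congˡ (evalMonic-0 m x))) ⟩
      x * (- 1# + x * x ^ m)                                 ≈⟨ distribˡ _ _ _ ⟩
      x * (- 1#) + x * (x * x ^ m)                           ≈⟨ +-cong (trans (*-comm _ _) (-1*x≈-x x)) fixed ⟩
      - x + x                                                ≈⟨ -‿inverseˡ x ⟩
      0#                                                     ∎
      where open import Relation.Binary.Reasoning.Setoid setoid

  -- By Fermat's theorem the images of the n elements of F are n roots of xⁿ - x, so a fixed element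
  -- outside the image would be one root too many.
  fixed⇒∈image : ∀ {z} → z ^ n ≈ z → ∃ λ a → ⟦ a ⟧ ≈ z
  fixed⇒∈image {z} z^n≈z with Fin.any? (λ i → ⟦ enum i ⟧ ≟ z)
  ... | yes (i , ⟦eᵢ⟧≈z) = enum i , ⟦eᵢ⟧≈z
  ... | no  ∄i           = ⊥-elim (Roots.few-roots K (x^n-x 1<n) r
        (λ i → evalMonic-x^n-x 1<n (fixed i)) inj)
    where
    r : Fin (suc n) → Carrier
    r zero    = z
    r (suc i) = ⟦ enum i ⟧
    fixed : ∀ i → r i ^ n ≈ r i
    fixed zero    = z^n≈z
    fixed (suc i) = ⟦⟧-fixed (enum i)
    inj : ∀ {i j} → r i ≈ r j → i ≡ j
    inj {zero}  {zero}  _ = refl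
    inj {zero}  {suc j} e = contradiction (j , sym e) ∄i
    inj {suc i} {zero}  e = contradiction (i , e) ∄i
    inj {suc i} {suc j} e = ≡.cong suc (enum-injective (⟦⟧-injective e))

-- Subgroups of order 3 and flexes

module PointSetoid {c ℓ} (K : Field c ℓ) where
  ≈ₚ-refl : ∀ {P : Point K} → _≈ₚ_ {K = K} P P
  ≈ₚ-refl {𝒪}       = nothing
  ≈ₚ-refl {aff x y} = just (Field.refl K , Field.refl K)

  reflexiveₚ : ∀ {P Q : Point K} → P ≡ Q → _≈ₚ_ {K = K} P Q
  reflexiveₚ refl = ≈ₚ-refl

  ≈ₚ-sym : ∀ {P Q : Point K} → _≈ₚ_ {K = K} P Q → _≈ₚ_ {K = K} Q P
  ≈ₚ-sym (just (e , e′)) = just (Field.sym K e , Field.sym K e′)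
  ≈ₚ-sym nothing         = nothing

  ≈ₚ-trans : ∀ {P Q R : Point K} → _≈ₚ_ {K = K} P Q → _≈ₚ_ {K = K} Q R → _≈ₚ_ {K = K} P R
  ≈ₚ-trans (just (e , e′)) (just (d , d′)) = just (Field.trans K e d , Field.trans K e′ d′)
  ≈ₚ-trans nothing         nothing         = nothing

abstract
  third : (i j : Fin 3) → ∃ λ k → ¬ k ≡ i × ¬ k ≡ j
  third i j = toWitness {a? = Fin.all? λ i → Fin.all? λ j →
    Fin.any? λ k → ¬? (k Fin.≟ i) ×-dec ¬? (k Fin.≟ j)} tt i j

  exhaust : ∀ (i j k l : Fin 3) → ¬ i ≡ j → ¬ i ≡ k → ¬ j ≡ k → l ≡ i ⊎ l ≡ j ⊎ l ≡ k
  exhaust = toWitness {a? = Fin.all? λ i → Fin.all? λ j → Fin.all? λ k → Fin.all? λ l →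
    ¬? (i Fin.≟ j) →-dec ¬? (i Fin.≟ k) →-dec ¬? (j Fin.≟ k) →-dec
    (l Fin.≟ i ⊎-dec l Fin.≟ j ⊎-dec l Fin.≟ k)} tt

module Invariants {c ℓ} {F : Field c ℓ} (E : WeierstrassCurve F) where
  open Field F
  open WeierstrassCurve E

  b₂ b₄ b₆ c₄ c₆ : Carrier
  b₂ = a₁ ^ 2 + 4 · a₂
  b₄ = 2 · a₄ + a₁ * a₃
  b₆ = a₃ ^ 2 + 4 · a₆
  c₄ = b₂ ^ 2 - 24 · b₄
  c₆ = (6 · 1#) ^ 2 * (b₂ * b₄) - b₂ ^ 3 - (6 · 1#) ^ 3 * b₆

  -- Negation of points changes the sign of this function, which therefore vanishes at the points of
  -- order 2. On the curve its square is the cubic 4x³ + b₂x² + 2b₄x + b₆.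
  η : Carrier → Carrier → Carrier
  η x y = 2 · y + a₁ * x + a₃

:b₂ : ∀ {n} → (a₁ a₂ : Expr n) → Expr n
:b₂ a₁ a₂ = a₁ :^ 2 :+ 4 :· a₂

:b₄ : ∀ {n} → (a₁ a₃ a₄ : Expr n) → Expr n
:b₄ a₁ a₃ a₄ = 2 :· a₄ :+ a₁ :* a₃

:b₆ : ∀ {n} → (a₃ a₆ : Expr n) → Expr n
:b₆ a₃ a₆ = a₃ :^ 2 :+ 4 :· a₆

:c₄ :c₆ : ∀ {n} → (a₁ a₂ a₃ a₄ a₆ : Expr n) → Expr n
:c₄ a₁ a₂ a₃ a₄ a₆ = :b₂ a₁ a₂ :^ 2 :- 24 :· :b₄ a₁ a₃ a₄
:c₆ a₁ a₂ a₃ a₄ a₆ = (6 :· :1) :^ 2 :* (:b₂ a₁ a₂ :* :b₄ a₁ a₃ a₄) :- :b₂ a₁ a₂ :^ 3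
                     :- (6 :· :1) :^ 3 :* :b₆ a₃ a₆

:η : ∀ {n} → (a₁ a₃ x y : Expr n) → Expr n
:η a₁ a₃ x y = 2 :· y :+ a₁ :* x :+ a₃

:Δ : ∀ {n} → (a₁ a₂ a₃ a₄ a₆ : Expr n) → Expr n
:Δ a₁ a₂ a₃ a₄ a₆ = :- (b₂ :^ 2 :* b₈) :- 8 :· b₄ :^ 3 :- 27 :· b₆ :^ 2 :+ 9 :· b₂ :* b₄ :* b₆
  where
  b₂ = :b₂ a₁ a₂
  b₄ = :b₄ a₁ a₃ a₄
  b₆ = :b₆ a₃ a₆
  b₈ = a₁ :^ 2 :* a₆ :+ 4 :· a₂ :* a₆ :- a₁ :* a₃ :* a₄ :+ a₂ :* a₃ :^ 2 :- a₄ :^ 2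

:left : ∀ {n} → (a₁ a₃ x y : Expr n) → Expr n
:left a₁ a₃ x y = y :^ 2 :+ a₁ :* x :* y :+ a₃ :* y

:right : ∀ {n} → (a₂ a₄ a₆ x : Expr n) → Expr n
:right a₂ a₄ a₆ x = x :^ 3 :+ a₂ :* x :^ 2 :+ a₄ :* x :+ a₆

:slope : ∀ {n} → (a₁ a₂ a₄ x y : Expr n) → Expr n
:slope a₁ a₂ a₄ x y = 3 :· x :^ 2 :+ 2 :· a₂ :* x :+ a₄ :- a₁ :* y

module Flexes {c ℓ} (K : EisensteinField c ℓ) (E : WeierstrassCurve (EisensteinField.fieldᴱ K)) where
  open EisensteinProperties K
  open WeierstrassCurve E
  open Invariants E public
  open PointSetoid fieldᴱ public

  infix 4 _≈ᴾ_
  _≈ᴾ_ : Point fieldᴱ → Point fieldᴱ → Set (c ⊔ ℓ)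
  _≈ᴾ_ = _≈ₚ_ {K = fieldᴱ}

  1728Δ≈c₄³-c₆² : (12 · 1#) ^ 3 * discriminant E ≈ c₄ ^ 3 - c₆ ^ 2
  1728Δ≈c₄³-c₆² = solve (a₁ ∷ a₂ ∷ a₃ ∷ a₄ ∷ a₆ ∷ []) λ a₁ a₂ a₃ a₄ a₆ →
    (12 :· :1) :^ 3 :* :Δ a₁ a₂ a₃ a₄ a₆ := :c₄ a₁ a₂ a₃ a₄ a₆ :^ 3 :- :c₆ a₁ a₂ a₃ a₄ a₆ :^ 2

  12≉0 : 12 · 1# ≉ 0#
  12≉0 = ≉0-resp (solve [] (12 :· :1 := 2 :· :1 :* 2 :· :1 :* 3 :· :1)) (*-≉0 (*-≉0 2≉0 2≉0) 3≉0)

  c₄³≉c₆² : IsElliptic E → c₄ ^ 3 ≉ c₆ ^ 2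
  c₄³≉c₆² Δ≉0 = x-y≉0⇒x≉y (≉0-resp (sym 1728Δ≈c₄³-c₆²) (*-≉0 (^-≉0 3 12≉0) Δ≉0))

  isElliptic : c₄ ^ 3 ≉ c₆ ^ 2 → IsElliptic E
  isElliptic c₄³≉c₆² = *-≉0ʳ (≉0-resp 1728Δ≈c₄³-c₆² (x≉y⇒x-y≉0 c₄³≉c₆²))

  -- The tangent of slope m at (x , y) meets the curve to the third order.
  record Flex (x y : Carrier) : Set (c ⊔ ℓ) where
    field
      onCurve : OnCurve E (aff x y)
      η≉0     : η x y ≉ 0#
      m       : Carrier
      tangent : m * η x y ≈ 3 · x ^ 2 + 2 · a₂ * x + a₄ - a₁ * y
      flex    : m ^ 2 + a₁ * m - a₂ ≈ 3 · x

  neg : Carrier → Carrier → Carrier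
  neg x y = - y - a₁ * x - a₃

  neg-≈⇒η≈0 : ∀ {x y} → neg x y ≈ y → η x y ≈ 0#
  neg-≈⇒η≈0 {x} {y} = solve (a₁ ∷ a₃ ∷ x ∷ y ∷ []) λ a₁ a₃ x y →
    (:- :1) ⊛ :- y :- a₁ :* x :- a₃ := y ⇒ :η a₁ a₃ x y := :0

  sum≈η : ∀ {x y} → y + y + a₁ * x + a₃ ≈ η x y
  sum≈η {x} {y} = solve (a₁ ∷ a₃ ∷ x ∷ y ∷ []) λ a₁ a₃ x y →
    y :+ y :+ a₁ :* x :+ a₃ := :η a₁ a₃ x y

  -- The slope is handed out as an unknown with its defining equation, so that polynomial
  -- certificates can treat it as a variable.
  add-tangent : ∀ {x₁ y₁ x₂ y₂} → x₁ ≈ x₂ → y₁ + y₂ + a₁ * x₁ + a₃ ≉ 0# → ∃ λ m →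
    m * (y₁ + y₂ + a₁ * x₁ + a₃) ≈ 3 · x₁ ^ 2 + 2 · a₂ * x₁ + a₄ - a₁ * y₁ ×
    add E (aff x₁ y₁) (aff x₂ y₂) ≡ chord E m x₁ y₁ x₂
  add-tangent {x₁} {y₁} {x₂} {y₂} x₁≈x₂ s≉0 with x₁ ≟ x₂ | y₁ + y₂ + a₁ * x₁ + a₃ ≟ 0#
  ... | no x₁≉x₂ | _       = contradiction x₁≈x₂ x₁≉x₂
  ... | yes _    | yes s≈0 = contradiction s≈0 s≉0
  ... | yes _    | no _    = _ , /-*-cancel s≉0 , refl

  add-secant : ∀ {x₁ y₁ x₂ y₂} → x₁ ≉ x₂ →
    add E (aff x₁ y₁) (aff x₂ y₂) ≡ chord E ((y₂ - y₁) / (x₂ - x₁)) x₁ y₁ x₂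
  add-secant {x₁} {y₁} {x₂} {y₂} x₁≉x₂ with x₁ ≟ x₂ | y₁ + y₂ + a₁ * x₁ + a₃ ≟ 0#
  ... | yes x₁≈x₂ | _     = contradiction x₁≈x₂ x₁≉x₂
  ... | no _      | yes _ = refl
  ... | no _      | no _  = refl

  Spans : Carrier → Carrier → Point fieldᴱ → Set (c ⊔ ℓ)
  Spans x y Q = Q ≈ᴾ 𝒪 ⊎ Q ≈ᴾ aff x y ⊎ Q ≈ᴾ aff x (neg x y)

  -- Completes the cube: in this coordinate the quadratic term disappears and the remaining
  -- coefficients are -3c₄ and -2c₆.
  curveX : Carrier → Carrier
  curveX x = 12 · x + b₂

  curve-eq : ∀ {x y} → OnCurve E (aff x y) →
    12 · 1# * ((6 · 1#) ^ 2 * η x y ^ 2) ≈ curveX x ^ 3 - 3 · c₄ * curveX x - 2 · c₆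
  curve-eq {x} {y} = solve (a₁ ∷ a₂ ∷ a₃ ∷ a₄ ∷ a₆ ∷ x ∷ y ∷ []) λ a₁ a₂ a₃ a₄ a₆ x y →
    let X = 12 :· x :+ :b₂ a₁ a₂ in
    (12 :· :1) :^ 3
      ⊛ :left a₁ a₃ x y := :right a₂ a₄ a₆ x ⇒
    12 :· :1 :* ((6 :· :1) :^ 2 :* :η a₁ a₃ x y :^ 2)
      := X :^ 3 :- 3 :· :c₄ a₁ a₂ a₃ a₄ a₆ :* X :- 2 :· :c₆ a₁ a₂ a₃ a₄ a₆

  private
    cubic : Carrier → Carrier
    cubic X = X ^ 3 - 3 · c₄ * X - 2 · c₆

    -- The roots of the cubic have sum zero, so `p + 2 · q ≈ 0#` makes `q` the third root as well.
    -- Then the cubic is (X - q)² (X + 2q), whence c₄ = q² and c₆ = -q³.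
    double-root : ∀ {p q} → p ≉ q → p + 2 · q ≈ 0# → cubic p ≈ 0# → cubic q ≈ 0# →
                  c₄ ^ 3 ≈ c₆ ^ 2
    double-root {p} {q} p≉q p+2q≈0 Fp Fq =
      solve (c₄ ∷ c₆ ∷ q ∷ []) (λ c₄ c₆ q →
        (c₄ :^ 2 :+ c₄ :* q :^ 2 :+ q :^ 4) ⊛ c₄ := q :^ 2 ⇒
        (q :^ 3 :- c₆) ⊛ c₆ := :- q :^ 3 ⇒
        c₄ :^ 3 := c₆ :^ 2) c₄≈q² c₆≈-q³
      where
      q≉0 : q ≉ 0#
      q≉0 q≈0 = p≉q (solve (p ∷ q ∷ []) (λ p q → :1 ⊛ p :+ 2 :· q := :0 ⇒
        (:- (3 :· :1)) ⊛ q := :0 ⇒ p := q) p+2q≈0 q≈0)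
      9q≉0 : 3 · 1# * (3 · 1#) * q ≉ 0#
      9q≉0 = *-≉0 (*-≉0 3≉0 3≉0) q≉0
      c₄≈q² : c₄ ≈ q ^ 2
      c₄≈q² = *-cancelˡ 9q≉0 (solve (c₄ ∷ c₆ ∷ p ∷ q ∷ []) (λ c₄ c₆ p q →
        (:- (p :^ 2 :- 2 :· p :* q :+ 4 :· q :^ 2 :- 3 :· c₄)) ⊛ p :+ 2 :· q := :0 ⇒
        :1 ⊛ p :^ 3 :- 3 :· c₄ :* p :- 2 :· c₆ := :0 ⇒
        (:- :1) ⊛ q :^ 3 :- 3 :· c₄ :* q :- 2 :· c₆ := :0 ⇒
        3 :· :1 :* 3 :· :1 :* q :* c₄ := 3 :· :1 :* 3 :· :1 :* q :* q :^ 2)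
        p+2q≈0 Fp Fq)
      c₆≈-q³ : c₆ ≈ - q ^ 3
      c₆≈-q³ = *-cancelˡ 2≉0 (solve (c₄ ∷ c₆ ∷ q ∷ []) (λ c₄ c₆ q →
        (:- (3 :· q)) ⊛ c₄ := q :^ 2 ⇒
        (:- :1) ⊛ q :^ 3 :- 3 :· c₄ :* q :- 2 :· c₆ := :0 ⇒
        2 :· :1 :* c₆ := 2 :· :1 :* (:- q :^ 3)) c₄≈q² Fq)

    -- The line is Y = 0 in the short model, and the cubic has no double root.
    secant-double : ∀ {x y x′ y′} → IsElliptic E → OnCurve E (aff x y) → OnCurve E (aff x′ y′) →
      η x y ≈ 0# → η x′ y′ ≈ 0# → x ≉ x′ →
      let m = (y′ - y) / (x′ - x)
          x₃ = m ^ 2 + a₁ * m - a₂ - x - x′ in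
      x₃ ≉ x × x₃ ≉ x′
    secant-double {x} {y} {x′} {y′} Δ≉0 on on′ η≈0 η′≈0 x≉x′ =
      (λ x₃≈x → c₄³≉c₆² Δ≉0 (double-root (X≉X′ ∘ sym)
        (solve (b₂ ∷ x ∷ x′ ∷ x₃ ∷ []) (λ b₂ x x′ x₃ →
          (:- (12 :· :1)) ⊛ x₃ := x ⇒
          :1 ⊛ 12 :· x₃ :+ 12 :· x :+ 12 :· x′ :+ 3 :· b₂ := :0 ⇒
          (12 :· x′ :+ b₂) :+ 2 :· (12 :· x :+ b₂) := :0) x₃≈x sum)
        (root on′ η′≈0) (root on η≈0))) ,
      (λ x₃≈x′ → c₄³≉c₆² Δ≉0 (double-root X≉X′
        (solve (b₂ ∷ x ∷ x′ ∷ x₃ ∷ []) (λ b₂ x x′ x₃ →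
          (:- (12 :· :1)) ⊛ x₃ := x′ ⇒
          :1 ⊛ 12 :· x₃ :+ 12 :· x :+ 12 :· x′ :+ 3 :· b₂ := :0 ⇒
          (12 :· x :+ b₂) :+ 2 :· (12 :· x′ :+ b₂) := :0) x₃≈x′ sum)
        (root on η≈0) (root on′ η′≈0)))
      where
      m = (y′ - y) / (x′ - x)
      x₃ = m ^ 2 + a₁ * m - a₂ - x - x′
      x′-x≉0 : x′ - x ≉ 0#
      x′-x≉0 = x≉y⇒x-y≉0 (x≉x′ ∘ sym)
      X≉X′ : curveX x ≉ curveX x′
      X≉X′ X≈X′ = x≉x′ (*-cancelˡ 12≉0 (solve (b₂ ∷ x ∷ x′ ∷ []) (λ b₂ x x′ →
        :1 ⊛ 12 :· x :+ b₂ := 12 :· x′ :+ b₂ ⇒ 12 :· :1 :* x := 12 :· :1 :* x′) X≈X′))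
      root : ∀ {x y} → OnCurve E (aff x y) → η x y ≈ 0# → cubic (curveX x) ≈ 0#
      root {x} {y} on η≈0 = trans (sym (curve-eq on)) (solve (η x y ∷ []) (λ η →
        12 :· :1 :* ((6 :· :1) :^ 2 :* η) ⊛ η := :0 ⇒ 12 :· :1 :* ((6 :· :1) :^ 2 :* η :^ 2) := :0) η≈0)
      -- Along the secant `η` is a linear function of slope 2m + a₁, and it vanishes at two
      -- different abscissae.
      2m+a₁≈0 : 2 · m + a₁ ≈ 0#
      2m+a₁≈0 = *-cancelˡ x′-x≉0 (solve (a₁ ∷ a₃ ∷ x ∷ y ∷ x′ ∷ y′ ∷ m ∷ []) (λ a₁ a₃ x y x′ y′ m →
        (2 :· :1) ⊛ m :* (x′ :- x) := y′ :- y ⇒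
        (:- :1) ⊛ :η a₁ a₃ x y := :0 ⇒
        :1 ⊛ :η a₁ a₃ x′ y′ := :0 ⇒
        (x′ :- x) :* (2 :· m :+ a₁) := (x′ :- x) :* :0) (/-*-cancel x′-x≉0) η≈0 η′≈0)
      sum : 12 · x₃ + 12 · x + 12 · x′ + 3 · b₂ ≈ 0#
      sum = solve (a₁ ∷ a₂ ∷ x ∷ x′ ∷ m ∷ []) (λ a₁ a₂ x x′ m →
        3 :· (2 :· m :+ a₁) ⊛ 2 :· m :+ a₁ := :0 ⇒
        12 :· (m :^ 2 :+ a₁ :* m :- a₂ :- x :- x′) :+ 12 :· x :+ 12 :· x′ :+ 3 :· :b₂ a₁ a₂ := :0)
        2m+a₁≈0

  flex-neg : ∀ {x y} → Flex x y → Flex x (neg x y)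
  flex-neg {x} {y} f = record
    { onCurve = solve (a₁ ∷ a₂ ∷ a₃ ∷ a₄ ∷ a₆ ∷ x ∷ y ∷ []) (λ a₁ a₂ a₃ a₄ a₆ x y →
        let y′ = :- y :- a₁ :* x :- a₃ in
        :1 ⊛ :left a₁ a₃ x y := :right a₂ a₄ a₆ x ⇒
        :left a₁ a₃ x y′ := :right a₂ a₄ a₆ x) onCurve
    ; η≉0     = ≉0-resp (solve (a₁ ∷ a₃ ∷ x ∷ y ∷ []) (λ a₁ a₃ x y →
        :η a₁ a₃ x (:- y :- a₁ :* x :- a₃) := :- :η a₁ a₃ x y)) (-‿≉0 η≉0)
    ; m       = - m - a₁
    ; tangent = solve (a₁ ∷ a₂ ∷ a₃ ∷ a₄ ∷ x ∷ y ∷ m ∷ []) (λ a₁ a₂ a₃ a₄ x y m →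
        let y′ = :- y :- a₁ :* x :- a₃ in
        :1 ⊛ m :* :η a₁ a₃ x y := :slope a₁ a₂ a₄ x y ⇒
        (:- m :- a₁) :* :η a₁ a₃ x y′ := :slope a₁ a₂ a₄ x y′) tangent
    ; flex    = solve (a₁ ∷ a₂ ∷ x ∷ m ∷ []) (λ a₁ a₂ x m →
        :1 ⊛ m :^ 2 :+ a₁ :* m :- a₂ := 3 :· x ⇒
        (:- m :- a₁) :^ 2 :+ a₁ :* (:- m :- a₁) :- a₂ := 3 :· x) flex
    }
    where open Flex f

  neg-neg : ∀ {x y} → neg x (neg x y) ≈ y
  neg-neg {x} {y} = solve (a₁ ∷ a₃ ∷ x ∷ y ∷ []) λ a₁ a₃ x y →
    :- (:- y :- a₁ :* x :- a₃) :- a₁ :* x :- a₃ := y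

  neg-cong : ∀ {x x′ y y′} → x ≈ x′ → y ≈ y′ → neg x y ≈ neg x′ y′
  neg-cong {x} {x′} {y} {y′} = solve (a₁ ∷ a₃ ∷ x ∷ x′ ∷ y ∷ y′ ∷ []) λ a₁ a₃ x x′ y y′ →
    (:- a₁) ⊛ x := x′ ⇒ (:- :1) ⊛ y := y′ ⇒
    :- y :- a₁ :* x :- a₃ := :- y′ :- a₁ :* x′ :- a₃

  onCurve-resp : ∀ {x x′ y y′} → x ≈ x′ → y ≈ y′ → OnCurve E (aff x y) → OnCurve E (aff x′ y′)
  onCurve-resp {x} {x′} {y} {y′} = solve (a₁ ∷ a₂ ∷ a₃ ∷ a₄ ∷ a₆ ∷ x ∷ x′ ∷ y ∷ y′ ∷ [])
    λ a₁ a₂ a₃ a₄ a₆ x x′ y y′ →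
    (x :^ 2 :+ x :* x′ :+ x′ :^ 2 :+ a₂ :* (x :+ x′) :+ a₄ :- a₁ :* y) ⊛ x := x′ ⇒
    (:- (y :+ y′ :+ a₁ :* x′ :+ a₃)) ⊛ y := y′ ⇒
    :1 ⊛ :left a₁ a₃ x y := :right a₂ a₄ a₆ x ⇒
    :left a₁ a₃ x′ y′ := :right a₂ a₄ a₆ x′

  flex-resp : ∀ {x x′ y} → x ≈ x′ → Flex x y → Flex x′ y
  flex-resp {x} {x′} {y} x≈x′ f = record
    { onCurve = onCurve-resp x≈x′ ≈-refl onCurve
    ; η≉0     = ≉0-resp (sym (+-congʳ (+-congˡ (*-congˡ x≈x′)))) η≉0
    ; m       = m
    ; tangent = solve (a₁ ∷ a₂ ∷ a₃ ∷ a₄ ∷ x ∷ x′ ∷ y ∷ m ∷ []) (λ a₁ a₂ a₃ a₄ x x′ y m →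
        (3 :· (x :+ x′) :+ 2 :· a₂ :- m :* a₁) ⊛ x := x′ ⇒
        :1 ⊛ m :* :η a₁ a₃ x y := :slope a₁ a₂ a₄ x y ⇒
        m :* :η a₁ a₃ x′ y := :slope a₁ a₂ a₄ x′ y) x≈x′ tangent
    ; flex    = solve (a₁ ∷ a₂ ∷ x ∷ x′ ∷ m ∷ []) (λ a₁ a₂ x x′ m →
        (3 :· :1) ⊛ x := x′ ⇒ :1 ⊛ m :^ 2 :+ a₁ :* m :- a₂ := 3 :· x ⇒
        m :^ 2 :+ a₁ :* m :- a₂ := 3 :· x′) x≈x′ flex
    }
    where open Flex f

  -- The tangent at a flex has its third intersection there too, so doubling is negation. The
  -- summands are known only up to `_≈_`, hence the slope `M` computed by `add` must first be
  -- identified with `m`.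
  add-flex : ∀ {x y x₁ y₁ x₂ y₂} → Flex x y → x₁ ≈ x → y₁ ≈ y → x₂ ≈ x → y₂ ≈ y →
             add E (aff x₁ y₁) (aff x₂ y₂) ≈ᴾ aff x (neg x y)
  add-flex {x} {y} {x₁} {y₁} {x₂} {y₂} f x₁≈x y₁≈y x₂≈x y₂≈y =
    ≡.subst (_≈ᴾ aff x (neg x y)) (≡.sym (proj₂ (proj₂ sum))) (just (x₃≈x , neg≈))
    where
    open Flex f
    s≈η : y₁ + y₂ + a₁ * x₁ + a₃ ≈ η x y
    s≈η = trans (+-congʳ (+-cong (+-cong y₁≈y y₂≈y) (*-congˡ x₁≈x))) sum≈η
    s≉0 : y₁ + y₂ + a₁ * x₁ + a₃ ≉ 0#
    s≉0 = ≉0-resp s≈η η≉0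
    sum = add-tangent (trans x₁≈x (sym x₂≈x)) s≉0
    M = proj₁ sum
    M-tangent = proj₁ (proj₂ sum)
    M≈m : M ≈ m
    M≈m = *-cancelˡ s≉0 (solve (a₁ ∷ a₂ ∷ a₃ ∷ a₄ ∷ x ∷ y ∷ m ∷ x₁ ∷ y₁ ∷ y₂ ∷ M ∷ [])
      (λ a₁ a₂ a₃ a₄ x y m x₁ y₁ y₂ M →
        let s = y₁ :+ y₂ :+ a₁ :* x₁ :+ a₃ in
        :1 ⊛ M :* s := :slope a₁ a₂ a₄ x₁ y₁ ⇒
        (:- :1) ⊛ m :* :η a₁ a₃ x y := :slope a₁ a₂ a₄ x y ⇒
        (3 :· (x₁ :+ x) :+ 2 :· a₂ :- m :* a₁) ⊛ x₁ := x ⇒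
        (:- a₁ :- m) ⊛ y₁ := y ⇒
        (:- m) ⊛ y₂ := y ⇒
        s :* M := s :* m) M-tangent tangent x₁≈x y₁≈y y₂≈y)
    x₃ = M ^ 2 + a₁ * M - a₂ - x₁ - x₂
    x₃≈x : x₃ ≈ x
    x₃≈x = solve (a₁ ∷ a₂ ∷ x ∷ m ∷ M ∷ x₁ ∷ x₂ ∷ []) (λ a₁ a₂ x m M x₁ x₂ →
      (M :+ m :+ a₁) ⊛ M := m ⇒
      :1 ⊛ m :^ 2 :+ a₁ :* m :- a₂ := 3 :· x ⇒
      (:- :1) ⊛ x₁ := x ⇒ (:- :1) ⊛ x₂ := x ⇒
      M :^ 2 :+ a₁ :* M :- a₂ :- x₁ :- x₂ := x) M≈m flex x₁≈x x₂≈x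
    neg≈ : - (y₁ + M * (x₃ - x₁)) - a₁ * x₃ - a₃ ≈ neg x y
    neg≈ = solve (a₁ ∷ a₃ ∷ x ∷ y ∷ M ∷ x₁ ∷ y₁ ∷ x₃ ∷ []) (λ a₁ a₃ x y M x₁ y₁ x₃ →
      (:- :1) ⊛ y₁ := y ⇒ (:- M :- a₁) ⊛ x₃ := x ⇒ M ⊛ x₁ := x ⇒
      :- (y₁ :+ M :* (x₃ :- x₁)) :- a₁ :* x₃ :- a₃ := :- y :- a₁ :* x :- a₃) y₁≈y x₃≈x x₁≈x

  add-opposite : ∀ {x y x₁ y₁ x₂ y₂} → x₁ ≈ x → y₁ ≈ y → x₂ ≈ x → y₂ ≈ neg x y →
                 add E (aff x₁ y₁) (aff x₂ y₂) ≡ 𝒪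
  add-opposite {x} {y} {x₁} {y₁} {x₂} {y₂} x₁≈x y₁≈y x₂≈x y₂≈-y
    with x₁ ≟ x₂ | y₁ + y₂ + a₁ * x₁ + a₃ ≟ 0#
  ... | no x₁≉x₂ | _       = contradiction (trans x₁≈x (sym x₂≈x)) x₁≉x₂
  ... | yes _    | yes _   = refl
  ... | yes _    | no s≉0  = contradiction (solve (a₁ ∷ a₃ ∷ x ∷ y ∷ x₁ ∷ y₁ ∷ y₂ ∷ [])
    (λ a₁ a₃ x y x₁ y₁ y₂ →
      a₁ ⊛ x₁ := x ⇒ :1 ⊛ y₁ := y ⇒ :1 ⊛ y₂ := :- y :- a₁ :* x :- a₃ ⇒
      y₁ :+ y₂ :+ a₁ :* x₁ :+ a₃ := :0) x₁≈x y₁≈y y₂≈-y) s≉0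

  same-abscissa : ∀ {x x′ y y′} → x ≈ x′ → OnCurve E (aff x y) → OnCurve E (aff x′ y′) →
                  y ≈ y′ ⊎ y ≈ neg x′ y′
  same-abscissa {x} {x′} {y} {y′} x≈x′ on on′
    with x*y≈0⇒x≈0⊎y≈0 (solve (a₁ ∷ a₂ ∷ a₃ ∷ a₄ ∷ a₆ ∷ x′ ∷ y ∷ y′ ∷ [])
      (λ a₁ a₂ a₃ a₄ a₆ x y y′ →
        :1 ⊛ :left a₁ a₃ x y := :right a₂ a₄ a₆ x ⇒
        (:- :1) ⊛ :left a₁ a₃ x y′ := :right a₂ a₄ a₆ x ⇒
        (y :- y′) :* (y :- (:- y′ :- a₁ :* x :- a₃)) := :0)
      (onCurve-resp x≈x′ ≈-refl on) on′)
  ... | inj₁ d = inj₁ (x-y≈0⇒x≈y d)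
  ... | inj₂ d = inj₂ (x-y≈0⇒x≈y d)

  spans-⊆ : ∀ {x x′ y y′ Q} → x ≈ x′ → y ≈ y′ ⊎ y ≈ neg x′ y′ → Spans x y Q → Spans x′ y′ Q
  spans-⊆ x≈x′ _ (inj₁ e) = inj₁ e
  spans-⊆ x≈x′ (inj₁ y≈y′) (inj₂ (inj₁ e)) = inj₂ (inj₁ (≈ₚ-trans e (just (x≈x′ , y≈y′))))
  spans-⊆ x≈x′ (inj₁ y≈y′) (inj₂ (inj₂ e)) =
    inj₂ (inj₂ (≈ₚ-trans e (just (x≈x′ , neg-cong x≈x′ y≈y′))))
  spans-⊆ x≈x′ (inj₂ y≈-y′) (inj₂ (inj₁ e)) = inj₂ (inj₂ (≈ₚ-trans e (just (x≈x′ , y≈-y′))))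
  spans-⊆ x≈x′ (inj₂ y≈-y′) (inj₂ (inj₂ e)) =
    inj₂ (inj₁ (≈ₚ-trans e (just (x≈x′ , trans (neg-cong x≈x′ y≈-y′) neg-neg))))

  spans⇒member : ∀ (G : Subgroup E) {x y Q} → Subgroup.Member G (aff x y) → Spans x y Q →
                 Subgroup.Member G Q
  spans⇒member G p (inj₁ e)        = Subgroup.resp G (≈ₚ-sym e) (Subgroup.𝒪-member G)
  spans⇒member G p (inj₂ (inj₁ e)) = Subgroup.resp G (≈ₚ-sym e) p
  spans⇒member G p (inj₂ (inj₂ e)) = Subgroup.resp G (≈ₚ-sym e) (Subgroup.negate-closed G p)

  module FlexSubgroup {x y : Carrier} (f : Flex x y) where
    private
      module f = Flex f
      P -P : Point fieldᴱ
      P  = aff x y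
      -P = aff x (neg x y)
      ≈neg-neg : ∀ {z} → z ≈ y → z ≈ neg x (neg x y)
      ≈neg-neg z≈y = trans z≈y (sym neg-neg)

    subgroup : Subgroup E
    subgroup = record
      { Member        = Spans x y
      ; resp          = λ { P≈Q (inj₁ e)        → inj₁ (≈ₚ-trans (≈ₚ-sym P≈Q) e)
                          ; P≈Q (inj₂ (inj₁ e)) → inj₂ (inj₁ (≈ₚ-trans (≈ₚ-sym P≈Q) e))
                          ; P≈Q (inj₂ (inj₂ e)) → inj₂ (inj₂ (≈ₚ-trans (≈ₚ-sym P≈Q) e)) }
      ; onCurve       = λ { (inj₁ nothing)                  → _
                          ; (inj₂ (inj₁ (just (e , e′)))) →
                              onCurve-resp (sym e) (sym e′) f.onCurve
                          ; (inj₂ (inj₂ (just (e , e′)))) →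
                              onCurve-resp (sym e) (sym e′) (Flex.onCurve (flex-neg f)) }
      ; 𝒪-member      = inj₁ nothing
      ; add-closed    = add-closed
      ; negate-closed = λ { (inj₁ nothing)                  → inj₁ nothing
                          ; (inj₂ (inj₁ (just (e , e′)))) → inj₂ (inj₂ (just (e , neg-cong e e′)))
                          ; (inj₂ (inj₂ (just (e , e′)))) →
                              inj₂ (inj₁ (just (e , trans (neg-cong e e′) neg-neg))) }
      }
      where
      add-closed : ∀ {Q R} → Spans x y Q → Spans x y R → Spans x y (add E Q R)
      add-closed (inj₁ nothing) r = r
      add-closed q@(inj₂ (inj₁ (just _))) (inj₁ nothing) = q
      add-closed q@(inj₂ (inj₂ (just _))) (inj₁ nothing) = q
      add-closed (inj₂ (inj₁ (just (e , e′)))) (inj₂ (inj₁ (just (d , d′)))) =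
        inj₂ (inj₂ (add-flex f e e′ d d′))
      add-closed (inj₂ (inj₁ (just (e , e′)))) (inj₂ (inj₂ (just (d , d′)))) =
        inj₁ (reflexiveₚ (add-opposite e e′ d d′))
      add-closed (inj₂ (inj₂ (just (e , e′)))) (inj₂ (inj₁ (just (d , d′)))) =
        inj₁ (reflexiveₚ (add-opposite e e′ d (≈neg-neg d′)))
      add-closed (inj₂ (inj₂ (just (e , e′)))) (inj₂ (inj₂ (just (d , d′)))) =
        inj₂ (inj₁ (≈ₚ-trans (add-flex (flex-neg f) e e′ d d′) (just (≈-refl , neg-neg))))

    hasOrder-3 : HasOrder subgroup 3
    hasOrder-3 = point , injective , surjective
      where
      point : Fin 3 → ∃ (Spans x y)
      point zero             = 𝒪 , inj₁ nothing
      point (suc zero)       = P , inj₂ (inj₁ ≈ₚ-refl)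
      point (suc (suc zero)) = -P , inj₂ (inj₂ ≈ₚ-refl)
      injective : ∀ {i j} → proj₁ (point i) ≈ᴾ proj₁ (point j) → i ≡ j
      injective {zero}           {zero}           _              = refl
      injective {suc zero}       {suc zero}       _              = refl
      injective {suc (suc zero)} {suc (suc zero)} _              = refl
      injective {suc zero}       {suc (suc zero)} (just (_ , e)) =
        contradiction (neg-≈⇒η≈0 (sym e)) f.η≉0
      injective {suc (suc zero)} {suc zero}       (just (_ , e)) =
        contradiction (neg-≈⇒η≈0 e) f.η≉0
      injective {zero}           {suc zero}       ()
      injective {zero}           {suc (suc zero)} ()
      injective {suc zero}       {zero}           ()
      injective {suc (suc zero)} {zero}           ()
      surjective : ∀ (Q : ∃ (Spans x y)) → ∃ λ i → ∀ {j} → j ≡ i → proj₁ (point j) ≈ᴾ proj₁ Q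
      surjective (Q , inj₁ e)        = zero , λ { refl → ≈ₚ-sym e }
      surjective (Q , inj₂ (inj₁ e)) = suc zero , λ { refl → ≈ₚ-sym e }
      surjective (Q , inj₂ (inj₂ e)) = suc (suc zero) , λ { refl → ≈ₚ-sym e }

  -- Every subgroup of order 3 is generated by a flex

  module Order3 (G : Subgroup E) (order : HasOrder G 3) (Δ≉0 : IsElliptic E) where
    open Subgroup G

    private
      point : Fin 3 → Point fieldᴱ
      point i = proj₁ (proj₁ order i)

      member : ∀ i → Member (point i)
      member i = proj₂ (proj₁ order i)

      index : ∀ {Q} → Member Q → Fin 3
      index q = proj₁ (proj₂ (proj₂ order) (_ , q))

      point-index : ∀ {Q} (q : Member Q) → point (index q) ≈ᴾ Q
      point-index q = proj₂ (proj₂ (proj₂ order) (_ , q)) refl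

      index-injective : ∀ {Q R} {q : Member Q} {r : Member R} → index q ≡ index r → Q ≈ᴾ R
      index-injective {q = q} {r} e = ≈ₚ-trans (≈ₚ-sym (point-index q))
        (≡.subst (λ i → point i ≈ᴾ _) (≡.sym e) (point-index r))

    private
      third-point : ∀ {Q R} (q : Member Q) (r : Member R) →
                    ∃ λ S → Member S × ¬ S ≈ᴾ Q × ¬ S ≈ᴾ R
      third-point q r with k , k≢q , k≢r ← third (index q) (index r) =
        point k , member k ,
        (λ e → k≢q (proj₁ (proj₂ order) (≈ₚ-trans e (≈ₚ-sym (point-index q))))) ,
        (λ e → k≢r (proj₁ (proj₂ order) (≈ₚ-trans e (≈ₚ-sym (point-index r)))))

      exhaust-points : ∀ {Q R S T} → Member Q → Member R → Member S → Member T →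
        ¬ Q ≈ᴾ R → ¬ Q ≈ᴾ S → ¬ R ≈ᴾ S → T ≈ᴾ Q ⊎ T ≈ᴾ R ⊎ T ≈ᴾ S
      exhaust-points q r s t Q≉R Q≉S R≉S
        with exhaust (index q) (index r) (index s) (index t)
          (Q≉R ∘ index-injective {q = q} {r}) (Q≉S ∘ index-injective {q = q} {s})
          (R≉S ∘ index-injective {q = r} {s})
      ... | inj₁ e        = inj₁ (index-injective {q = t} {q} e)
      ... | inj₂ (inj₁ e) = inj₂ (inj₁ (index-injective {q = t} {r} e))
      ... | inj₂ (inj₂ e) = inj₂ (inj₂ (index-injective {q = t} {s} e))

      -- Lagrange's theorem would rest on associativity; counting takes its place. If P = -P, then
      -- the third member Q has -Q = P or -Q = Q. The first gives Q = P. In the second either the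
      -- abscissae agree and again Q = P, or P + Q is a fourth member, as its abscissa is neither
      -- that of P nor that of Q.
      no-2-torsion : ∀ {x y} → Member (aff x y) → η x y ≉ 0#
      no-2-torsion {x} {y} p η≈0 with third-point 𝒪-member p
      ... | 𝒪        , q , Q≉𝒪 , Q≉P = Q≉𝒪 nothing
      ... | aff x′ y′ , q , Q≉𝒪 , Q≉P
        with exhaust-points 𝒪-member p q (negate-closed q) (λ ()) (λ ()) (Q≉P ∘ ≈ₚ-sym)
      ...   | inj₂ (inj₁ (just (x′≈x , -y′≈y))) = Q≉P (just (x′≈x ,
                solve (a₁ ∷ a₃ ∷ x ∷ y ∷ x′ ∷ y′ ∷ []) (λ a₁ a₃ x y x′ y′ →
                  (:- a₁) ⊛ x′ := x ⇒ (:- :1) ⊛ :- y′ :- a₁ :* x′ :- a₃ := y ⇒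
                  (:- :1) ⊛ :η a₁ a₃ x y := :0 ⇒ y′ := y) x′≈x -y′≈y η≈0))
      ...   | inj₂ (inj₂ (just (_ , -y′≈y′))) with x ≟ x′
      ...     | yes x≈x′ = Q≉P (just (sym x≈x′ , *-cancelˡ 2≉0
                (solve (a₁ ∷ a₃ ∷ x ∷ y ∷ x′ ∷ y′ ∷ []) (λ a₁ a₃ x y x′ y′ →
                  a₁ ⊛ x := x′ ⇒ (:- :1) ⊛ :- y′ :- a₁ :* x′ :- a₃ := y′ ⇒
                  (:- :1) ⊛ :η a₁ a₃ x y := :0 ⇒
                  2 :· :1 :* y′ := 2 :· :1 :* y) x≈x′ -y′≈y′ η≈0)))
      ...     | no  x≉x′ = elsewhere
        (secant-double Δ≉0 (onCurve p) (onCurve q) η≈0 (neg-≈⇒η≈0 -y′≈y′) x≉x′)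
        (exhaust-points 𝒪-member p q
          (≡.subst Member (add-secant x≉x′) (add-closed p q)) (λ ()) (λ ()) (Q≉P ∘ ≈ₚ-sym))
        where
        elsewhere : ∀ {x₃ y₃} → x₃ ≉ x × x₃ ≉ x′ →
          ¬ (aff x₃ y₃ ≈ᴾ 𝒪 ⊎ aff x₃ y₃ ≈ᴾ aff x y ⊎ aff x₃ y₃ ≈ᴾ aff x′ y′)
        elsewhere (x₃≉x , _) (inj₂ (inj₁ (just (x₃≈x , _))))  = x₃≉x x₃≈x
        elsewhere (_ , x₃≉x′) (inj₂ (inj₂ (just (x₃≈x′ , _)))) = x₃≉x′ x₃≈x′

    private
      -- P + P is an affine point among O, P and -P, so it has the abscissa of P. For the tangent at
      -- P this is the flex condition.
      flexAt : ∀ {x y} → Member (aff x y) → η x y ≉ 0# → (∀ {Q} → Member Q → Spans x y Q) →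
        (∃ λ m → m * (y + y + a₁ * x + a₃) ≈ 3 · x ^ 2 + 2 · a₂ * x + a₄ - a₁ * y ×
                 add E (aff x y) (aff x y) ≡ chord E m x y x) → Flex x y
      flexAt {x} {y} p η≉0 spans (m , tangent , double) = record
        { onCurve = onCurve p
        ; η≉0     = η≉0
        ; m       = m
        ; tangent = trans (*-congˡ (sym sum≈η)) tangent
        ; flex    = solve (a₁ ∷ a₂ ∷ x ∷ m ∷ []) (λ a₁ a₂ x m →
            :1 ⊛ m :^ 2 :+ a₁ :* m :- a₂ :- x :- x := x ⇒
            m :^ 2 :+ a₁ :* m :- a₂ := 3 :· x)
            (abscissa (spans (≡.subst Member double (add-closed p p))))
        }
        where
        abscissa : ∀ {x₃ z} → Spans x y (aff x₃ z) → x₃ ≈ x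
        abscissa (inj₂ (inj₁ (just (e , _)))) = e
        abscissa (inj₂ (inj₂ (just (e , _)))) = e

      spans : ∀ {x y} → Member (aff x y) → η x y ≉ 0# → ∀ {Q} → Member Q → Spans x y Q
      spans p η≉0 q = exhaust-points 𝒪-member p (negate-closed p) q (λ ()) (λ ())
        λ { (just (_ , e)) → η≉0 (neg-≈⇒η≈0 (sym e)) }

      generatedBy : (∃ λ P → Member P × ¬ P ≈ᴾ 𝒪 × ¬ P ≈ᴾ 𝒪) →
        ∃₂ λ x y → Flex x y × Member (aff x y) × (∀ {Q} → Member Q → Spans x y Q)
      generatedBy (𝒪       , _ , P≉𝒪 , _) = contradiction nothing P≉𝒪
      generatedBy (aff x y , p , _   , _) =
        x , y , flexAt p η≉0 (spans p η≉0) (add-tangent ≈-refl (≉0-resp sum≈η η≉0)) , p , spans p η≉0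
        where
        η≉0 : η x y ≉ 0#
        η≉0 = no-2-torsion p

    abstract
      generator : ∃₂ λ x y → Flex x y × Member (aff x y) × (∀ {Q} → Member Q → Spans x y Q)
      generator = generatedBy (third-point 𝒪-member 𝒪-member)

-- Twists of the curves y² = x³ + A(e,f) x + B(e,f), whose flexes are rational

module HesseForms {c ℓ} (F : EisensteinField c ℓ) where
  open EisensteinProperties F

  -- Up to constants, the invariants c₄ and c₆ of the Hesse cubic x³ + y³ + z³ = 3lxyz, made
  -- homogeneous of degrees 4 and 6 by l = e/f.
  formA formB : Carrier → Carrier → Carrier
  formA e f = - (3 · (e * (e ^ 3 + 8 · f ^ 3)))
  formB e f = - (2 · (e ^ 6 - 20 · (e ^ 3 * f ^ 3) - 8 · f ^ 6))

  :formA :formB : ∀ {n} → (e f : Expr n) → Expr n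
  :formA e f = :- (3 :· (e :* (e :^ 3 :+ 8 :· f :^ 3)))
  :formB e f = :- (2 :· (e :^ 6 :- 20 :· (e :^ 3 :* f :^ 3) :- 8 :· f :^ 6))

  4A³+27B² : ∀ e f → 4 · formA e f ^ 3 + 27 · formB e f ^ 2
             ≈ - ((27 · 1#) * (2 · 1#) ^ 8 * (f ^ 3 * (e ^ 3 - f ^ 3) ^ 3))
  4A³+27B² e f = solve (e ∷ f ∷ []) λ e f →
    4 :· :formA e f :^ 3 :+ 27 :· :formB e f :^ 2
    := :- ((27 :· :1) :* (2 :· :1) :^ 8 :* (f :^ 3 :* (e :^ 3 :- f :^ 3) :^ 3))

  Nonsingular : Carrier → Carrier → Set ℓ
  Nonsingular e f = f ≉ 0# × e ^ 3 ≉ f ^ 3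

  27≉0 : 27 · 1# ≉ 0#
  27≉0 = ≉0-resp (solve [] (27 :· :1 := (3 :· :1) :^ 3)) (^-≉0 3 3≉0)

  4A³+27B²≉0 : ∀ {e f} → Nonsingular e f → 4 · formA e f ^ 3 + 27 · formB e f ^ 2 ≉ 0#
  4A³+27B²≉0 {e} {f} (f≉0 , e³≉f³) = ≉0-resp (4A³+27B² e f) (-‿≉0
    (*-≉0 (*-≉0 27≉0 (^-≉0 8 2≉0)) (*-≉0 (^-≉0 3 f≉0) (^-≉0 3 (x≉y⇒x-y≉0 e³≉f³)))))

  nonsingular : ∀ {e f} → 4 · formA e f ^ 3 + 27 · formB e f ^ 2 ≉ 0# → Nonsingular e f
  nonsingular {e} {f} Δ≉0 = *-≉0ˡ {y = f ^ 2} f³≉0 , x-y≉0⇒x≉y (*-≉0ˡ {y = (e ^ 3 - f ^ 3) ^ 2} d³≉0)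
    where
    -Δ≉0 : (27 · 1#) * (2 · 1#) ^ 8 * (f ^ 3 * (e ^ 3 - f ^ 3) ^ 3) ≉ 0#
    -Δ≉0 x≈0 = Δ≉0 (trans (4A³+27B² e f) (trans (-‿cong x≈0)
                 (solve [] (:- :0 := :0))))
    f³≉0 : f ^ 3 ≉ 0#
    f³≉0 = *-≉0ˡ (*-≉0ʳ -Δ≉0)
    d³≉0 : (e ^ 3 - f ^ 3) ^ 3 ≉ 0#
    d³≉0 = *-≉0ʳ (*-≉0ʳ -Δ≉0)

  ω : Fin 3 → Carrier
  ω zero             = 1#
  ω (suc zero)       = ρ
  ω (suc (suc zero)) = ρ ^ 2

  ω≉0 : ∀ k → ω k ≉ 0#
  ω≉0 zero             = 1≉0
  ω≉0 (suc zero)       = ρ≉0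
  ω≉0 (suc (suc zero)) = ^-≉0 2 ρ≉0

  -- e³ - f³ = (e - f) (e - ρf) (e - ρ²f)
  e-ωf≉0 : ∀ {e f} → e ^ 3 ≉ f ^ 3 → ∀ k → e - ω k * f ≉ 0#
  e-ωf≉0 {e} {f} e³≉f³ = λ
    { zero             → *-≉0ˡ (*-≉0ˡ e³-f³)
    ; (suc zero)       → *-≉0ʳ (*-≉0ˡ e³-f³)
    ; (suc (suc zero)) → *-≉0ʳ e³-f³ }
    where
    e³-f³ : (e - 1# * f) * (e - ρ * f) * (e - ρ ^ 2 * f) ≉ 0#
    e³-f³ = ≉0-resp (solve (e ∷ f ∷ []) (λ e f →
      (e :- :1 :* f) :* (e :- :ρ :* f) :* (e :- :ρ :^ 2 :* f) := e :^ 3 :- f :^ 3)) (x≉y⇒x-y≉0 e³≉f³)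

  -- A flex of t y² = x³ + A x + B: its slope m, which is eliminated here, satisfies
  -- 2t m y = 3x² + A and t m² = 3x.
  record TwistedFlex (t A B x y : Carrier) : Set ℓ where
    field
      curve : t * y ^ 2 ≈ x ^ 3 + A * x + B
      flex  : (3 · x ^ 2 + A) ^ 2 ≈ 12 · x * (t * y ^ 2)
      y≉0   : y ≉ 0#

  TwistedFlex-resp : ∀ {t A A′ B B′ x y} → A ≈ A′ → B ≈ B′ →
                     TwistedFlex t A B x y → TwistedFlex t A′ B′ x y
  TwistedFlex-resp A≈A′ B≈B′ φ = record
    { curve = trans curve (+-cong (+-congˡ (*-congʳ A≈A′)) B≈B′)
    ; flex  = trans (*-cong (+-congˡ (sym A≈A′)) (*-congʳ (+-congˡ (sym A≈A′)))) flex
    ; y≉0   = y≉0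
    }
    where open TwistedFlex φ

  TwistedFlex-scale : ∀ {t A B x y u} → u ≉ 0# → TwistedFlex t A B x y →
                      TwistedFlex t (u ^ 4 * A) (u ^ 6 * B) (u ^ 2 * x) (u ^ 3 * y)
  TwistedFlex-scale {t} {A} {B} {x} {y} {u} u≉0 φ = record
    { curve = solve (t ∷ u ∷ A ∷ B ∷ x ∷ y ∷ []) (λ t u A B x y →
        u :^ 6 ⊛ t :* y :^ 2 := x :^ 3 :+ A :* x :+ B ⇒
        t :* (u :^ 3 :* y) :^ 2
          := (u :^ 2 :* x) :^ 3 :+ (u :^ 4 :* A) :* (u :^ 2 :* x) :+ u :^ 6 :* B) curve
    ; flex  = solve (t ∷ u ∷ A ∷ x ∷ y ∷ []) (λ t u A x y →
        u :^ 8 ⊛ (3 :· x :^ 2 :+ A) :^ 2 := 12 :· x :* (t :* y :^ 2) ⇒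
        (3 :· (u :^ 2 :* x) :^ 2 :+ u :^ 4 :* A) :^ 2
          := 12 :· (u :^ 2 :* x) :* (t :* (u :^ 3 :* y) :^ 2)) flex
    ; y≉0   = *-≉0 (^-≉0 3 u≉0) y≉0
    }
    where open TwistedFlex φ

  module FourFlexes (t e f : Carrier) (t≉0 : t ≉ 0#) (ns : Nonsingular e f) where
    private
      f≉0   = proj₁ ns
      e³≉f³ = proj₂ ns

    A B : Carrier
    A = t ^ 2 * formA e f
    B = t ^ 3 * formB e f

    -- The points with index `suc k` are the one with index `zero` for the parameters (e + 2ωf) / θ
    -- and (e - ωf) / θ, which yield the same A and B. Since θ² = -3, the abscissa 3te² becomes -t(e
    -- + 2ωf)², and one factor θ survives in the ordinate.
    X Y : Fin 4 → Carrier
    X zero    = 3 · (t * e ^ 2)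
    X (suc k) = - (t * (e + 2 · (ω k * f)) ^ 2)
    Y zero    = 4 · (t * (e ^ 3 - f ^ 3))
    Y (suc k) = 4 · (t * (θ * (f * (ω k * e ^ 2 + ω k ^ 2 * (e * f) + f ^ 2))))

    private
      :A :B : ∀ {n} → (t e f : Expr n) → Expr n
      :A t e f = t :^ 2 :* :formA e f
      :B t e f = t :^ 3 :* :formB e f

      :curve :flex : ∀ {n} → (X Y t e f : Expr n) → Claim n
      :curve X Y t e f = t :* Y :^ 2 := X :^ 3 :+ :A t e f :* X :+ :B t e f
      :flex  X Y t e f = (3 :· X :^ 2 :+ :A t e f) :^ 2 := 12 :· X :* (t :* Y :^ 2)

      :X₀ :Y₀ : ∀ {n} → (t e f : Expr n) → Expr n
      :X₀ t e f = 3 :· (t :* e :^ 2)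
      :Y₀ t e f = 4 :· (t :* (e :^ 3 :- f :^ 3))

      :X :Y : ∀ {n} → (ω t e f : Expr n) → Expr n
      :X ω t e f = :- (t :* (e :+ 2 :· (ω :* f)) :^ 2)
      :Y ω t e f = 4 :· (t :* (:θ :* (f :* (ω :* e :^ 2 :+ ω :^ 2 :* (e :* f) :+ f :^ 2))))

      :curveAt :flexAt : ∀ {n} → (ω t e f : Expr n) → Claim n
      :curveAt ω t e f = :curve (:X ω t e f) (:Y ω t e f) t e f
      :flexAt  ω t e f = :flex (:X ω t e f) (:Y ω t e f) t e f

      curve : ∀ i → t * Y i ^ 2 ≈ X i ^ 3 + A * X i + B
      curve zero = solve (t ∷ e ∷ f ∷ []) λ t e f → :curve (:X₀ t e f) (:Y₀ t e f) t e f
      curve (suc zero) = solve (t ∷ e ∷ f ∷ []) (:curveAt :1)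
      curve (suc (suc zero)) = solve (t ∷ e ∷ f ∷ []) (:curveAt :ρ)
      curve (suc (suc (suc zero))) = solve (t ∷ e ∷ f ∷ []) (:curveAt (:ρ :^ 2))

      flex : ∀ i → (3 · X i ^ 2 + A) ^ 2 ≈ 12 · X i * (t * Y i ^ 2)
      flex zero = solve (t ∷ e ∷ f ∷ []) λ t e f → :flex (:X₀ t e f) (:Y₀ t e f) t e f
      flex (suc zero) = solve (t ∷ e ∷ f ∷ []) (:flexAt :1)
      flex (suc (suc zero)) = solve (t ∷ e ∷ f ∷ []) (:flexAt :ρ)
      flex (suc (suc (suc zero))) = solve (t ∷ e ∷ f ∷ []) (:flexAt (:ρ :^ 2))

      4≉0 : 4 · 1# ≉ 0#
      4≉0 = ≉0-resp (solve [] (4 :· :1 := 2 :· :1 :* 2 :· :1)) (*-≉0 2≉0 2≉0)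

      4·≉0 : ∀ {x} → x ≉ 0# → 4 · x ≉ 0#
      4·≉0 {x} x≉0 = ≉0-resp (solve (x ∷ []) (λ x → 4 :· x := 4 :· :1 :* x)) (*-≉0 4≉0 x≉0)

      e-f≉0   = e-ωf≉0 e³≉f³ zero
      e-ρf≉0  = e-ωf≉0 e³≉f³ (suc zero)
      e-ρ²f≉0 = e-ωf≉0 e³≉f³ (suc (suc zero))

      -- Up to the unit ω this is (e³ - f³) / (e - ωf), the product of the other two linear factors
      -- of e³ - f³.
      factor≉0 : ∀ k → ω k * e ^ 2 + ω k ^ 2 * (e * f) + f ^ 2 ≉ 0#
      factor≉0 zero = ≉0-resp (solve (e ∷ f ∷ []) λ e f →
        :1 :* e :^ 2 :+ :1 :^ 2 :* (e :* f) :+ f :^ 2 := (e :- :ρ :* f) :* (e :- :ρ :^ 2 :* f))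
        (*-≉0 e-ρf≉0 e-ρ²f≉0)
      factor≉0 (suc zero) = ≉0-resp (solve (e ∷ f ∷ []) λ e f →
        :ρ :* e :^ 2 :+ :ρ :^ 2 :* (e :* f) :+ f :^ 2 := :ρ :* ((e :- :1 :* f) :* (e :- :ρ :^ 2 :* f)))
        (*-≉0 ρ≉0 (*-≉0 e-f≉0 e-ρ²f≉0))
      factor≉0 (suc (suc zero)) = ≉0-resp (solve (e ∷ f ∷ []) λ e f →
        :ρ :^ 2 :* e :^ 2 :+ (:ρ :^ 2) :^ 2 :* (e :* f) :+ f :^ 2
          := :ρ :^ 2 :* ((e :- :1 :* f) :* (e :- :ρ :* f)))
        (*-≉0 (^-≉0 2 ρ≉0) (*-≉0 e-f≉0 e-ρf≉0))

      Y≉0 : ∀ i → Y i ≉ 0#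
      Y≉0 zero    = 4·≉0 (*-≉0 t≉0 (x≉y⇒x-y≉0 e³≉f³))
      Y≉0 (suc k) = 4·≉0 (*-≉0 t≉0 (*-≉0 θ≉0 (*-≉0 f≉0 (factor≉0 k))))

    twistedFlex : ∀ i → TwistedFlex t A B (X i) (Y i)
    twistedFlex i = record { curve = curve i ; flex = flex i ; y≉0 = Y≉0 i }

    private
      :X₀-X : ∀ {n} → (ω t e f : Expr n) → Claim n
      :X₀-X ω t e f = :X₀ t e f :- :X ω t e f
        := 4 :· (t :* ω :^ 2 :* (ω :* e :^ 2 :+ ω :^ 2 :* (e :* f) :+ f :^ 2))

      X₀-X : ∀ k → X zero - X (suc k) ≈ 4 · (t * ω k ^ 2 * (ω k * e ^ 2 + ω k ^ 2 * (e * f) + f ^ 2))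
      X₀-X zero             = solve (t ∷ e ∷ f ∷ []) (:X₀-X :1)
      X₀-X (suc zero)       = solve (t ∷ e ∷ f ∷ []) (:X₀-X :ρ)
      X₀-X (suc (suc zero)) = solve (t ∷ e ∷ f ∷ []) (:X₀-X (:ρ :^ 2))

      X₀≉X : ∀ k → X zero ≉ X (suc k)
      X₀≉X k = x-y≉0⇒x≉y (≉0-resp (X₀-X k)
        (4·≉0 (*-≉0 (*-≉0 t≉0 (^-≉0 2 (ω≉0 k))) (factor≉0 k))))

      X₁≉X₂ : X (suc zero) ≉ X (suc (suc zero))
      X₁≉X₂ = x-y≉0⇒x≉y (≉0-resp (solve (t ∷ e ∷ f ∷ []) λ t e f →
        :X :1 t e f :- :X :ρ t e f := 4 :· (t :* ((:ρ :- :1) :* (f :* (e :- :ρ :^ 2 :* f)))))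
        (4·≉0 (*-≉0 t≉0 (*-≉0 ρ-1≉0 (*-≉0 f≉0 e-ρ²f≉0)))))
        where
        ρ-1≉0 : ρ - 1# ≉ 0#
        ρ-1≉0 = ≉0-resp (solve [] (:ρ :- :1 := :- (:1 :- :ρ))) (-‿≉0 1-ρ≉0)

      X₁≉X₃ : X (suc zero) ≉ X (suc (suc (suc zero)))
      X₁≉X₃ = x-y≉0⇒x≉y (≉0-resp (solve (t ∷ e ∷ f ∷ []) λ t e f →
        :X :1 t e f :- :X (:ρ :^ 2) t e f
          := 4 :· (t :* (:ρ :^ 2 :* ((:1 :- :ρ) :* (f :* (e :- :ρ :* f))))))
        (4·≉0 (*-≉0 t≉0 (*-≉0 (^-≉0 2 ρ≉0) (*-≉0 1-ρ≉0 (*-≉0 f≉0 e-ρf≉0))))))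

      X₂≉X₃ : X (suc (suc zero)) ≉ X (suc (suc (suc zero)))
      X₂≉X₃ = x-y≉0⇒x≉y (≉0-resp (solve (t ∷ e ∷ f ∷ []) λ t e f →
        :X :ρ t e f :- :X (:ρ :^ 2) t e f
          := :- (4 :· (t :* (:ρ :* ((:1 :- :ρ) :* (f :* (e :- :1 :* f)))))))
        (-‿≉0 (4·≉0 (*-≉0 t≉0 (*-≉0 ρ≉0 (*-≉0 1-ρ≉0 (*-≉0 f≉0 e-f≉0)))))))

    X-injective : ∀ {i j} → X i ≈ X j → i ≡ j
    X-injective {zero}                {zero}                _ = refl
    X-injective {suc zero}            {suc zero}            _ = refl
    X-injective {suc (suc zero)}      {suc (suc zero)}      _ = refl
    X-injective {suc (suc (suc zero))} {suc (suc (suc zero))} _ = refl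
    X-injective {zero}                {suc k}               e = contradiction e (X₀≉X k)
    X-injective {suc k}               {zero}                e = contradiction (sym e) (X₀≉X k)
    X-injective {suc zero}            {suc (suc zero)}      e = contradiction e X₁≉X₂
    X-injective {suc (suc zero)}      {suc zero}            e = contradiction (sym e) X₁≉X₂
    X-injective {suc zero}            {suc (suc (suc zero))} e = contradiction e X₁≉X₃
    X-injective {suc (suc (suc zero))} {suc zero}           e = contradiction (sym e) X₁≉X₃
    X-injective {suc (suc zero)}      {suc (suc (suc zero))} e = contradiction e X₂≉X₃
    X-injective {suc (suc (suc zero))} {suc (suc zero)}     e = contradiction (sym e) X₂≉X₃

    abstract
      -- Eliminating the ordinate from the two equations leaves the 3-division polynomial 3x⁴ + 6Ax²
      -- + 12Bx - A², which is 3 times the product of the four x - X i.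
      exhaustive : ∀ {x y} → TwistedFlex t A B x y → ∃ λ i → x ≈ X i
      exhaustive {x} {y} φ
        with x*y≈0⇒x≈0⊎y≈0 (*-cancelˡ 3≉0 (solve (t ∷ e ∷ f ∷ x ∷ y ∷ []) (λ t e f x y →
          (:- :1) ⊛ (3 :· x :^ 2 :+ :A t e f) :^ 2 := 12 :· x :* (t :* y :^ 2) ⇒
          (:- (12 :· x)) ⊛ t :* y :^ 2 := x :^ 3 :+ :A t e f :* x :+ :B t e f ⇒
          3 :· :1 :* ((x :- :X₀ t e f) :* (x :- :X :1 t e f) :* ((x :- :X :ρ t e f) :* (x :- :X (:ρ :^ 2) t e f)))
            := 3 :· :1 :* :0) (TwistedFlex.flex φ) (TwistedFlex.curve φ)))
      ... | inj₁ p with x*y≈0⇒x≈0⊎y≈0 p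
      ...   | inj₁ d = zero , x-y≈0⇒x≈y d
      ...   | inj₂ d = suc zero , x-y≈0⇒x≈y d
      exhaustive {x} {y} φ | inj₂ p with x*y≈0⇒x≈0⊎y≈0 p
      ...   | inj₁ d = suc (suc zero) , x-y≈0⇒x≈y d
      ...   | inj₂ d = suc (suc (suc zero)) , x-y≈0⇒x≈y d

-- Rational subgroups over the algebraic closure and twisted flexes

module EisensteinEmbedding {c ℓ} (F : EisensteinField c ℓ) {K : Field c ℓ}
                           (ι : EisensteinField.fieldᴱ F ↪ K) where
  private
    module F = EisensteinProperties F
    module K = Field K
  open Embedding ι

  codomain : EisensteinField c ℓ
  codomain = record
    { fieldᴱ     = K
    ; ρ          = ⟦ F.ρ ⟧
    ; eisenstein = K.trans (K.+-cong (K.+-congʳ (K.sym 1#-homo)) (K.sym (*-homo _ _)))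
                  (K.trans (K.+-congʳ (K.sym (+-homo _ _)))
                  (K.trans (K.sym (+-homo _ _))
                  (K.trans (⟦⟧-cong F.eisenstein) 0#-homo)))
    ; 2≉0        = n≉0 2 F.2≉0
    ; 3≉0        = n≉0 3 F.3≉0
    }
    where
    n≉0 : ∀ n → n F.· F.1# F.≉ F.0# → n K.· K.1# K.≉ K.0#
    n≉0 n n≉0 e = ⟦⟧-≉0 n≉0 (K.trans (·-homo n F.1#)
      (K.trans (Mult.×-congʳ K.semiring n 1#-homo) e))

  private
    module 𝕂 = EisensteinProperties codomain

    lookup-map : ∀ {n} (v : Vec F.Carrier n) i → ⟦ Vec.lookup v i ⟧ K.≈ Vec.lookup (Vec.map ⟦_⟧ v) i
    lookup-map (x ∷ v) zero    = K.refl
    lookup-map (x ∷ v) (suc i) = lookup-map v i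

    ⟦⟧-homo : ∀ {n} (p : Expr n) v → ⟦ F.⟦ p ⟧ v ⟧ K.≈ 𝕂.⟦ p ⟧ (Vec.map ⟦_⟧ v)
    ⟦⟧-homo (var i)  v = lookup-map v i
    ⟦⟧-homo :0       v = 0#-homo
    ⟦⟧-homo :1       v = 1#-homo
    ⟦⟧-homo :ρ       v = K.refl
    ⟦⟧-homo (:- p)   v = K.trans (-‿homo _) (K.-‿cong (⟦⟧-homo p v))
    ⟦⟧-homo (p :+ q) v = K.trans (+-homo _ _) (K.+-cong (⟦⟧-homo p v) (⟦⟧-homo q v))
    ⟦⟧-homo (p :- q) v = K.trans (+-homo _ _)
      (K.+-cong (⟦⟧-homo p v) (K.trans (-‿homo _) (K.-‿cong (⟦⟧-homo q v))))
    ⟦⟧-homo (p :* q) v = K.trans (*-homo _ _) (K.*-cong (⟦⟧-homo p v) (⟦⟧-homo q v))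
    ⟦⟧-homo (p :^ k) v = K.trans (^-homo _ k) (Exp.^-congˡ K.semiring k (⟦⟧-homo p v))
    ⟦⟧-homo (k :· p) v = K.trans (·-homo k _) (Mult.×-congʳ K.semiring k (⟦⟧-homo p v))

  expand : ∀ {n} (v : Vec F.Carrier n) (p : N-ary n (Expr n) (Expr n)) →
           ⟦ F.⟦ p $ⁿ vars ⟧ v ⟧ K.≈ 𝕂.⟦ p $ⁿ vars ⟧ (Vec.map ⟦_⟧ v)
  expand v p = ⟦⟧-homo (p $ⁿ vars) v

  preserve : ∀ {n} (v : Vec F.Carrier n) (p r : N-ary n (Expr n) (Expr n)) →
             F.⟦ p $ⁿ vars ⟧ v F.≈ F.⟦ r $ⁿ vars ⟧ v →
             𝕂.⟦ p $ⁿ vars ⟧ (Vec.map ⟦_⟧ v) K.≈ 𝕂.⟦ r $ⁿ vars ⟧ (Vec.map ⟦_⟧ v)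
  preserve v p r e = K.trans (K.sym (expand v p)) (K.trans (⟦⟧-cong e) (expand v r))

  -- Relations between elements of F are derived in K with the help of √t and then brought back by
  -- injectivity.
  reflect : ∀ {n} (v : Vec F.Carrier n) (p r : N-ary n (Expr n) (Expr n)) →
            𝕂.⟦ p $ⁿ vars ⟧ (Vec.map ⟦_⟧ v) K.≈ 𝕂.⟦ r $ⁿ vars ⟧ (Vec.map ⟦_⟧ v) →
            F.⟦ p $ⁿ vars ⟧ v F.≈ F.⟦ r $ⁿ vars ⟧ v
  reflect v p r e = ⟦⟧-injective (K.trans (expand v p) (K.trans e (K.sym (expand v r))))

:cubic : ∀ {n} → (a₁ a₂ a₃ a₄ a₆ x : Expr n) → Expr n
:cubic a₁ a₂ a₃ a₄ a₆ x =
  4 :· x :^ 3 :+ :b₂ a₁ a₂ :* x :^ 2 :+ 2 :· (:b₄ a₁ a₃ a₄ :* x) :+ :b₆ a₃ a₆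

:quadratic : ∀ {n} → (a₁ a₂ a₃ a₄ x : Expr n) → Expr n
:quadratic a₁ a₂ a₃ a₄ x = 6 :· x :^ 2 :+ :b₂ a₁ a₂ :* x :+ :b₄ a₁ a₃ a₄

module DescendedFlexes {c ℓ} (F : EisensteinField c ℓ) (t : EisensteinField.Carrier F) where
  open EisensteinProperties F

  -- A flex with abscissa x and 2y + a₁x + a₃ = w√t, where (6x² + b₂x + b₄) / (w√t) is
  -- the slope in the coordinate 2y + a₁x + a₃, whose square is 12x + b₂ at a flex.
  record DescendedFlex (E : WeierstrassCurve fieldᴱ) (x w : Carrier) : Set ℓ where
    open Invariants E
    field
      curve : t * w ^ 2 ≈ 4 · x ^ 3 + b₂ * x ^ 2 + 2 · (b₄ * x) + b₆
      flex  : (6 · x ^ 2 + b₂ * x + b₄) ^ 2 ≈ (12 · x + b₂) * (t * w ^ 2)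
      w≉0   : w ≉ 0#

  open HesseForms F using (TwistedFlex)

  -- The short model of E obtained from X = 36x + 3b₂, Y = 108(2y + a₁x + a₃).
  shortA shortB : WeierstrassCurve fieldᴱ → Carrier
  shortA E = - (27 · 1# * Invariants.c₄ E)
  shortB E = - (27 · 1# * 2 · 1# * Invariants.c₆ E)

  private
    :shortA :shortB : ∀ {n} → (a₁ a₂ a₃ a₄ a₆ : Expr n) → Expr n
    :shortA a₁ a₂ a₃ a₄ a₆ = :- (27 :· :1 :* :c₄ a₁ a₂ a₃ a₄ a₆)
    :shortB a₁ a₂ a₃ a₄ a₆ = :- (27 :· :1 :* 2 :· :1 :* :c₆ a₁ a₂ a₃ a₄ a₆)

  toShortModel : ∀ E {x w} → DescendedFlex E x w →
    TwistedFlex t (shortA E) (shortB E) (36 · 1# * x + 3 · Invariants.b₂ E) (27 · 1# * 4 · 1# * w)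
  toShortModel E {x} {w} φ = record
    { curve = solve (a₁ ∷ a₂ ∷ a₃ ∷ a₄ ∷ a₆ ∷ t ∷ x ∷ w ∷ []) (λ a₁ a₂ a₃ a₄ a₆ t x w →
        let X = 36 :· :1 :* x :+ 3 :· :b₂ a₁ a₂ in
        (27 :· :1 :* 4 :· :1) :^ 2 ⊛ t :* w :^ 2
          := :cubic a₁ a₂ a₃ a₄ a₆ x ⇒
        t :* (27 :· :1 :* 4 :· :1 :* w) :^ 2
          := X :^ 3 :+ :shortA a₁ a₂ a₃ a₄ a₆ :* X :+ :shortB a₁ a₂ a₃ a₄ a₆) curve
    ; flex = solve (a₁ ∷ a₂ ∷ a₃ ∷ a₄ ∷ a₆ ∷ t ∷ x ∷ w ∷ []) (λ a₁ a₂ a₃ a₄ a₆ t x w →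
        let X = 36 :· :1 :* x :+ 3 :· :b₂ a₁ a₂ in
        (27 :· :1 :* 24 :· :1) :^ 2 ⊛ (:quadratic a₁ a₂ a₃ a₄ x) :^ 2
          := (12 :· x :+ :b₂ a₁ a₂) :* (t :* w :^ 2) ⇒
        (3 :· X :^ 2 :+ :shortA a₁ a₂ a₃ a₄ a₆) :^ 2
          := 12 :· X :* (t :* (27 :· :1 :* 4 :· :1 :* w) :^ 2)) flex
    ; y≉0 = ≉0-resp (solve (w ∷ []) (λ w → 27 :· :1 :* 4 :· :1 :* w := (3 :· :1) :^ 3 :* (2 :· :1) :^ 2 :* w))
        (*-≉0 (*-≉0 (^-≉0 3 3≉0) (^-≉0 2 2≉0)) w≉0)
    }
    where
    open WeierstrassCurve E
    open DescendedFlex φ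

  -- On a short model 2y + a₁x + a₃ is 2y, and `3 · h` is one half.
  halve : ∀ {A B x w} → DescendedFlex (shortWeierstrass fieldᴱ A B) x w →
          TwistedFlex t A B x (w * 3 · h)
  halve {A} {B} {x} {w} φ = record
    { curve = solve (t ∷ A ∷ B ∷ x ∷ w ∷ h ∷ []) (λ t A B x w h →
        (9 :· h :^ 2) ⊛ t :* w :^ 2
          := 4 :· x :^ 3 :+ :b₂ :0 :0 :* x :^ 2 :+ 2 :· (:b₄ :0 :0 A :* x) :+ :b₆ :0 B ⇒
        ((6 :· h :+ :1) :* (x :^ 3 :+ A :* x :+ B)) ⊛ 6 :· h := :1 ⇒
        t :* (w :* 3 :· h) :^ 2 := x :^ 3 :+ A :* x :+ B) curve 6h≈1
    ; flex = solve (t ∷ A ∷ B ∷ x ∷ w ∷ h ∷ []) (λ t A B x w h →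
        (9 :· h :^ 2) ⊛ (6 :· x :^ 2 :+ :b₂ :0 :0 :* x :+ :b₄ :0 :0 A) :^ 2
          := (12 :· x :+ :b₂ :0 :0) :* (t :* w :^ 2) ⇒
        (:- ((6 :· h :+ :1) :* (3 :· x :^ 2 :+ A) :^ 2)) ⊛ 6 :· h := :1 ⇒
        (3 :· x :^ 2 :+ A) :^ 2 := 12 :· x :* (t :* (w :* 3 :· h) :^ 2)) flex 6h≈1
    ; y≉0 = *-≉0 w≉0 (≉0-resp (solve (h ∷ []) (λ h → 3 :· h := 3 :· :1 :* h)) (*-≉0 3≉0 h≉0))
    }
    where open DescendedFlex φ

-- Frobenius, √t and the descent of subgroups

module QuadraticTwist {c ℓ} (F : EisensteinField c ℓ) (L K : Field c ℓ)
  (ι : EisensteinField.fieldᴱ F ↪ K) (κ : L ↪ K) (q : ℕ)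
  (sizeF : FieldOfSize (EisensteinField.fieldᴱ F) q) (sizeL : FieldOfSize L (q ℕ.^ 2))
  (closure : IsAlgebraicClosure ι)
  (t : EisensteinField.Carrier F) (t≉0 : EisensteinField._≉_ F t (EisensteinField.0# F))
  (nonSquare : EisensteinField.NonSquare F t) where

  private
    module F = EisensteinProperties F
    module ι where
      open Embedding ι public
      open FixedPoints ι sizeF public
      open EisensteinEmbedding F ι public
    module κ = FixedPoints κ sizeL
  open EisensteinProperties ι.codomain hiding (⟦_⟧)
  open ι using (⟦_⟧)
  open DescendedFlexes F t using (DescendedFlex)
  open Exp semiring using (^-congˡ; ^-assocʳ)
  open CommutativeExp commutativeSemiring using (^-distrib-*)

  private
    squareRoot : ∃ λ s → s ^ 2 ≈ ⟦ t ⟧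
    squareRoot with s , e ← IsAlgebraicClosure.algebraicallyClosed closure (- ⟦ t ⟧ ∷ 0# ∷ []) =
      s , solve (s ∷ ⟦ t ⟧ ∷ []) (λ s t →
        :1 ⊛ :- t :+ s :* (:0 :+ s :* :1) := :0 ⇒ s :^ 2 := t) e

  s : Carrier
  s = proj₁ squareRoot

  s²≈t : s ^ 2 ≈ ⟦ t ⟧
  s²≈t = proj₂ squareRoot

  s≉0 : s ≉ 0#
  s≉0 = *-≉0ˡ {y = s ^ 1} (≉0-resp s²≈t (ι.⟦⟧-≉0 t≉0))

  ^2-^q : ∀ x → (x ^ q) ^ 2 ≈ (x ^ 2) ^ q
  ^2-^q x = trans (^-assocʳ x q 2)
    (trans (reflexive (≡.cong (x ^_) (ℕ.*-comm q 2))) (sym (^-assocʳ x 2 q)))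

  square-fixed : ∀ {x a} → x ^ 2 ≈ ⟦ a ⟧ → x ^ q ≈ x ⊎ x ^ q ≈ - x
  square-fixed {x} {a} x²≈a = x²≈y²⇒x≈±y (begin
    (x ^ q) ^ 2 ≈⟨ ^2-^q x ⟩
    (x ^ 2) ^ q ≈⟨ ^-congˡ q x²≈a ⟩
    ⟦ a ⟧ ^ q   ≈⟨ ι.⟦⟧-fixed a ⟩
    ⟦ a ⟧       ≈⟨ x²≈a ⟨
    x ^ 2       ∎)
    where open import Relation.Binary.Reasoning.Setoid setoid

  -- The square of `s` lies in F, so Frobenius fixes or negates `s`; if it were fixed, it would lie
  -- in F and t would be a square.
  s^q≈-s : s ^ q ≈ - s
  s^q≈-s with square-fixed s²≈t
  ... | inj₂ e = e
  ... | inj₁ e with b , ⟦b⟧≈s ← ι.fixed⇒∈image e =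
    contradiction (ι.⟦⟧-injective (trans (ι.^-homo b 2) (trans (^-congˡ 2 ⟦b⟧≈s) s²≈t)))
                  (nonSquare b)

  -- Instead of the parity of q this uses that -1 comes from F, where the q-th power is the
  -- identity.
  -‿^q : ∀ x → (- x) ^ q ≈ - (x ^ q)
  -‿^q x = begin
    (- x) ^ q                 ≈⟨ ^-congˡ q (solve (x ∷ []) λ x → :- x := (:- :1) :* x) ⟩
    (- 1# * x) ^ q            ≈⟨ ^-distrib-* (- 1#) x q ⟩
    (- 1#) ^ q * x ^ q        ≈⟨ *-congʳ (^-congˡ q -1≈) ⟩
    ⟦ F.- F.1# ⟧ ^ q * x ^ q  ≈⟨ *-congʳ (trans (ι.⟦⟧-fixed _) (sym -1≈)) ⟩
    - 1# * x ^ q              ≈⟨ solve (x ^ q ∷ []) (λ x → (:- :1) :* x := :- x) ⟩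
    - (x ^ q)                 ∎
    where
    open import Relation.Binary.Reasoning.Setoid setoid
    -1≈ : - 1# ≈ ⟦ F.- F.1# ⟧
    -1≈ = sym (ι.expand [] (:- :1))

  multiple-^q : ∀ w → (⟦ w ⟧ * s) ^ q ≈ - (⟦ w ⟧ * s)
  multiple-^q w = trans (^-distrib-* ⟦ w ⟧ s q)
    (trans (*-cong (ι.⟦⟧-fixed w) s^q≈-s)
             (solve (⟦ w ⟧ ∷ s ∷ []) λ w s → w :* (:- s) := :- (w :* s)))

  -- Frobenius negates both x and `s`, so it fixes x s, which thus lies in F. Division by s² = t
  -- gives the coefficient of `s`.
  anti-fixed⇒multiple : ∀ {x} → x ^ q ≈ - x → ∃ λ w → ⟦ w ⟧ * s ≈ x
  anti-fixed⇒multiple {x} x^q≈-x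
    with b , ⟦b⟧≈xs ← ι.fixed⇒∈image (trans (^-distrib-* x s q)
      (trans (*-cong x^q≈-x s^q≈-s) (solve (x ∷ s ∷ []) λ x s → (:- x) :* (:- s) := x :* s))) =
    b F.* t F.⁻¹ ,
    *-cancelˡ (ι.⟦⟧-≉0 t≉0) (solve (⟦ t ⟧ ∷ ⟦ t F.⁻¹ ⟧ ∷ ⟦ b ⟧ ∷ ⟦ b F.* t F.⁻¹ ⟧ ∷ x ∷ s ∷ [])
      (λ t t⁻¹ b w x s →
        t :* s ⊛ w := b :* t⁻¹ ⇒
        b :* s ⊛ t :* t⁻¹ := :1 ⇒
        s ⊛ b := x :* s ⇒
        x ⊛ s :^ 2 := t ⇒
        t :* (w :* s) := t :* x)
      (ι.*-homo _ _)
      (trans (sym (ι.*-homo _ _)) (trans (ι.⟦⟧-cong (F.*-inverseʳ t≉0)) ι.1#-homo))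
      ⟦b⟧≈xs s²≈t)

  ^-q² : ∀ x → x ^ (q ℕ.^ 2) ≈ (x ^ q) ^ q
  ^-q² x = trans (reflexive (≡.cong (λ k → x ^ (q ℕ.* k)) (ℕ.*-identityʳ q)))
                   (sym (^-assocʳ x q q))

  fixed⇒∈L : ∀ {x} → x ^ q ≈ x → ∃ λ b → _↪_.⟦_⟧ κ b ≈ x
  fixed⇒∈L {x} e = κ.fixed⇒∈image (trans (^-q² x) (trans (^-congˡ q e) e))

  anti-fixed⇒∈L : ∀ {x} → x ^ q ≈ - x → ∃ λ b → _↪_.⟦_⟧ κ b ≈ x
  anti-fixed⇒∈L {x} e = κ.fixed⇒∈image (trans (^-q² x) (trans (^-congˡ q e)
    (trans (-‿^q x) (trans (-‿cong e) (solve (x ∷ []) λ x → :- (:- x) := x)))))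

  anti-fixed⇒∉F : ∀ {x} → x ≉ 0# → x ^ q ≈ - x → ¬ ∃ λ b → ⟦ b ⟧ ≈ x
  anti-fixed⇒∉F {x} x≉0 e (b , ⟦b⟧≈x) = x≉0 (*-cancelˡ 2≉0
    (solve (x ∷ x ^ q ∷ []) (λ x x^q → (:- :1) ⊛ x^q := x ⇒ :1 ⊛ x^q := :- x ⇒
      2 :· :1 :* x := 2 :· :1 :* :0)
      (sym (trans (sym ⟦b⟧≈x) (trans (sym (ι.⟦⟧-fixed b)) (^-congˡ q ⟦b⟧≈x)))) e))

  Rational : (E : WeierstrassCurve F.fieldᴱ) → Subgroup (baseChange ι E) → Set (c ⊔ ℓ)
  Rational E G = HasOrder G 3 × FrobeniusStable G q
                 × NonzeroPoints G (λ P → DefinedOver κ P × ¬ DefinedOver ι P)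

  module Descent (E : WeierstrassCurve F.fieldᴱ) (Δ≉0 : IsElliptic E) where
    private
      module E = WeierstrassCurve E
      Eᴷ = baseChange ι E
      module I = Invariants E
      as : Vec F.Carrier 5
      as = E.a₁ ∷ E.a₂ ∷ E.a₃ ∷ E.a₄ ∷ E.a₆ ∷ []
    open WeierstrassCurve Eᴷ
    open Flexes ι.codomain Eᴷ public

    Δᴷ≉0 : IsElliptic Eᴷ
    Δᴷ≉0 = ≉0-resp (sym (ι.expand as :Δ)) (ι.⟦⟧-≉0 Δ≉0)

    record Descended (G : Subgroup Eᴷ) : Set (c ⊔ ℓ) where
      field
        x w       : F.Carrier
        y         : Carrier
        flex      : DescendedFlex E x w
        η≈        : η ⟦ x ⟧ y ≈ ⟦ w ⟧ * s
        onCurve   : OnCurve Eᴷ (aff ⟦ x ⟧ y)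
        member    : Subgroup.Member G (aff ⟦ x ⟧ y)
        spans     : ∀ {Q} → Subgroup.Member G Q → Spans ⟦ x ⟧ y Q

    descendFlex : ∀ {x y w} (f : Flex ⟦ x ⟧ y) → η ⟦ x ⟧ y ≈ ⟦ w ⟧ * s → DescendedFlex E x w
    descendFlex {x} {y} {w} f η≈ws = record
      { curve = ι.reflect (E.a₁ ∷ E.a₂ ∷ E.a₃ ∷ E.a₄ ∷ E.a₆ ∷ t ∷ x ∷ w ∷ [])
          (λ a₁ a₂ a₃ a₄ a₆ t x w → t :* w :^ 2)
          (λ a₁ a₂ a₃ a₄ a₆ t x w →
            :cubic a₁ a₂ a₃ a₄ a₆ x)
          (solve (a₁ ∷ a₂ ∷ a₃ ∷ a₄ ∷ a₆ ∷ ⟦ t ⟧ ∷ ⟦ x ⟧ ∷ y ∷ ⟦ w ⟧ ∷ s ∷ []) (λ a₁ a₂ a₃ a₄ a₆ t x y w s →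
            (:- (:η a₁ a₃ x y :+ w :* s)) ⊛ :η a₁ a₃ x y := w :* s ⇒
            (:- w :^ 2) ⊛ s :^ 2 := t ⇒
            (4 :· :1) ⊛ :left a₁ a₃ x y := :right a₂ a₄ a₆ x ⇒
            t :* w :^ 2 := :cubic a₁ a₂ a₃ a₄ a₆ x)
            η≈ws s²≈t f.onCurve)
      ; flex = ι.reflect (E.a₁ ∷ E.a₂ ∷ E.a₃ ∷ E.a₄ ∷ t ∷ x ∷ w ∷ [])
          (λ a₁ a₂ a₃ a₄ t x w → (:quadratic a₁ a₂ a₃ a₄ x) :^ 2)
          (λ a₁ a₂ a₃ a₄ t x w → (12 :· x :+ :b₂ a₁ a₂) :* (t :* w :^ 2))
          (solve (a₁ ∷ a₂ ∷ a₃ ∷ a₄ ∷ ⟦ t ⟧ ∷ ⟦ x ⟧ ∷ y ∷ ⟦ w ⟧ ∷ s ∷ f.m ∷ []) (λ a₁ a₂ a₃ a₄ t x y w s m →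
            let N = :quadratic a₁ a₂ a₃ a₄ x
                η = :η a₁ a₃ x y
            in
            (:- (2 :· (N :+ (2 :· m :+ a₁) :* η))) ⊛
              m :* η := :slope a₁ a₂ a₄ x y ⇒
            (4 :· η :^ 2) ⊛ m :^ 2 :+ a₁ :* m :- a₂ := 3 :· x ⇒
            ((12 :· x :+ :b₂ a₁ a₂) :* (η :+ w :* s)) ⊛ η := w :* s ⇒
            ((12 :· x :+ :b₂ a₁ a₂) :* w :^ 2) ⊛ s :^ 2 := t ⇒
            N :^ 2 := (12 :· x :+ :b₂ a₁ a₂) :* (t :* w :^ 2))
            f.tangent f.flex η≈ws s²≈t)
      ; w≉0 = λ w≈0 → f.η≉0 (trans η≈ws (trans (*-congʳ (trans (ι.⟦⟧-cong w≈0) ι.0#-homo)) (zeroˡ s)))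
      }
      where module f = Flex f

    half : ∀ {b x y} → η ⟦ x ⟧ y ≈ ⟦ b ⟧ → ∃ λ d → ⟦ d ⟧ ≈ y
    half {b} {x} {y} η≈b = (b F.- E.a₁ F.* x F.- E.a₃) F.* 3 F.· F.h ,
      trans (ι.expand (b ∷ E.a₁ ∷ x ∷ E.a₃ ∷ F.h ∷ []) (λ b a₁ x a₃ h → (b :- a₁ :* x :- a₃) :* 3 :· h))
        (solve (⟦ b ⟧ ∷ a₁ ∷ ⟦ x ⟧ ∷ a₃ ∷ ⟦ F.h ⟧ ∷ y ∷ []) (λ b a₁ x a₃ h y →
          (:- (3 :· h)) ⊛ :η a₁ a₃ x y := b ⇒ y ⊛ 6 :· h := :1 ⇒
          (b :- a₁ :* x :- a₃) :* 3 :· h := y) η≈b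
          (ι.preserve (F.h ∷ []) (λ h → 6 :· h) (λ h → :1) F.6h≈1))

    private
      module _ (G : Subgroup Eᴷ)
               (defined : NonzeroPoints G (λ P → DefinedOver κ P × ¬ DefinedOver ι P)) where
        open Subgroup G using (Member; resp)

        -- The square of `η` is a value of a cubic over F at an abscissa in F, so Frobenius fixes or
        -- negates `η`. If `η` were fixed, it would lie in F together with y, contrary to the
        -- assumption on the field of definition. Hence `η` is a multiple of √t.
        descendAt : ∀ {x′ y} → Flex ⟦ x′ ⟧ y → Member (aff ⟦ x′ ⟧ y) →
                    (∀ {Q} → Member Q → Spans ⟦ x′ ⟧ y Q) → Descended G
        descendAt {x′} {y} f′ p′ spans = record
          { x       = x′
          ; w       = proj₁ w
          ; y       = y
          ; flex    = descendFlex f′ (sym (proj₂ w))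
          ; η≈      = sym (proj₂ w)
          ; onCurve = Flex.onCurve f′
          ; member  = p′
          ; spans   = spans
          }
          where
          η²≈ : η ⟦ x′ ⟧ y ^ 2 ≈ ⟦ 4 F.· x′ F.^ 3 F.+ I.b₂ F.* x′ F.^ 2 F.+ 2 F.· (I.b₄ F.* x′) F.+ I.b₆ ⟧
          η²≈ = trans
            (solve (a₁ ∷ a₂ ∷ a₃ ∷ a₄ ∷ a₆ ∷ ⟦ x′ ⟧ ∷ y ∷ []) (λ a₁ a₂ a₃ a₄ a₆ x y →
              (4 :· :1) ⊛ :left a₁ a₃ x y := :right a₂ a₄ a₆ x ⇒
              :η a₁ a₃ x y :^ 2
                := :cubic a₁ a₂ a₃ a₄ a₆ x)
              (Flex.onCurve f′))
            (sym (ι.expand (E.a₁ ∷ E.a₂ ∷ E.a₃ ∷ E.a₄ ∷ E.a₆ ∷ x′ ∷ []) (λ a₁ a₂ a₃ a₄ a₆ x →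
              :cubic a₁ a₂ a₃ a₄ a₆ x)))
          w : ∃ λ w → ⟦ w ⟧ * s ≈ η ⟦ x′ ⟧ y
          w with square-fixed η²≈
          ... | inj₂ e = anti-fixed⇒multiple e
          ... | inj₁ e = contradiction
            ((x′ , ≈-refl) , half (sym (proj₂ (ι.fixed⇒∈image e)))) (proj₂ (defined p′ λ ()))

        -- The image of the generator under Frobenius is again O, P or -P. It is affine, and it is
        -- not P, whose coordinates would then lie in F. So it is -P, and the abscissa is fixed.
        descendFrom : ∀ {x y} → Flex x y → Member (aff x y) → (∀ {Q} → Member Q → Spans x y Q) →
                      Spans x y (frobenius {K = K} q (aff x y)) → Descended G
        descendFrom f p spans (inj₂ (inj₁ (just (x^q≈x , y^q≈y)))) =
          contradiction (ι.fixed⇒∈image x^q≈x , ι.fixed⇒∈image y^q≈y) (proj₂ (defined p λ ()))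
        descendFrom {x} {y} f p spans (inj₂ (inj₂ (just (x^q≈x , _)))) =
          descendAt (flex-resp x≈ f) (resp (just (x≈ , ≈-refl)) p)
                    (λ q∈G → spans-⊆ x≈ (inj₁ ≈-refl) (spans q∈G))
          where
          x≈ : x ≈ ⟦ proj₁ (ι.fixed⇒∈image x^q≈x) ⟧
          x≈ = sym (proj₂ (ι.fixed⇒∈image x^q≈x))

    abstract
      descend : ∀ G → Rational E G → Descended G
      descend G (order , stable , defined) with x , y , f , p , spans ← Order3.generator G order Δᴷ≉0 =
        descendFrom G defined f p spans (spans (stable p))

  -- The coefficients are prescribed only up to `_≈_`, which covers both the models with f = 1 and
  -- the curves written as in the theorem.
  module FourSubgroups (e f : F.Carrier) (ns : HesseForms.Nonsingular F e f) (A B : F.Carrier)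
    (A≈ : A F.≈ t F.^ 2 F.* HesseForms.formA F e f)
    (B≈ : B F.≈ t F.^ 3 F.* HesseForms.formB F e f) where
    private
      module Four = HesseForms.FourFlexes F t e f t≉0 ns
      open Four using (X; Y)
      module Tw = HesseForms.TwistedFlex
      E = shortWeierstrass F.fieldᴱ A B
      Eᴷ = baseChange ι E
    open HesseForms F using (TwistedFlex; TwistedFlex-resp)

    isElliptic : IsElliptic E
    isElliptic = F.≉0-resp (F.trans
      (F.solve (A ∷ B ∷ []) λ A B →
        :Δ :0 :0 :0 A B := :- ((2 :· :1) :^ 4 :* (4 :· A :^ 3 :+ 27 :· B :^ 2)))
      (F.solve (A ∷ B ∷ t ∷ a ∷ b ∷ []) (λ A B t a b →
        (:- ((2 :· :1) :^ 4 :* 4 :· (A :^ 2 :+ A :* (t :^ 2 :* a) :+ (t :^ 2 :* a) :^ 2))) ⊛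
          A := t :^ 2 :* a ⇒
        (:- ((2 :· :1) :^ 4 :* 27 :· (B :+ t :^ 3 :* b))) ⊛ B := t :^ 3 :* b ⇒
        :- ((2 :· :1) :^ 4 :* (4 :· A :^ 3 :+ 27 :· B :^ 2))
          := :- ((2 :· :1) :^ 4 :* (t :^ 6 :* (4 :· a :^ 3 :+ 27 :· b :^ 2)))) A≈ B≈))
      (F.-‿≉0 (F.*-≉0 (F.^-≉0 4 F.2≉0) (F.*-≉0 (F.^-≉0 6 t≉0) (HesseForms.4A³+27B²≉0 F ns))))
      where
      a = HesseForms.formA F e f
      b = HesseForms.formB F e f

    open Descent E isElliptic
    open WeierstrassCurve Eᴷ

    private
      -- The base change of a short model has the image of 0 as its coefficients a₁, a₂, a₃; the
      -- certificates below remove these terms by means of this equation.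
      0≈0 : ⟦ F.0# ⟧ ≈ 0#
      0≈0 = ι.0#-homo

    ascend : ∀ {x y} → TwistedFlex t A B x y → Flex ⟦ x ⟧ (⟦ y ⟧ * s)
    ascend {x} {y} φ = record
      { onCurve = solve (a₁ ∷ a₂ ∷ a₃ ∷ a₄ ∷ a₆ ∷ ⟦ t ⟧ ∷ ⟦ x ⟧ ∷ ⟦ y ⟧ ∷ s ∷ []) (λ a₁ a₂ a₃ A B t x y s →
          (x :* (y :* s)) ⊛ a₁ := :0 ⇒ (:- x :^ 2) ⊛ a₂ := :0 ⇒ (y :* s) ⊛ a₃ := :0 ⇒
          y :^ 2 ⊛ s :^ 2 := t ⇒
          :1 ⊛ t :* y :^ 2 := x :^ 3 :+ A :* x :+ B ⇒
          (y :* s) :^ 2 :+ a₁ :* x :* (y :* s) :+ a₃ :* (y :* s)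
            := x :^ 3 :+ a₂ :* x :^ 2 :+ A :* x :+ B) 0≈0 0≈0 0≈0 s²≈t
          (ι.preserve (t ∷ A ∷ B ∷ x ∷ y ∷ []) (λ t A B x y → t :* y :^ 2)
            (λ t A B x y → x :^ 3 :+ A :* x :+ B) (Tw.curve φ))
      ; η≉0     = ≉0-resp (solve (a₁ ∷ a₃ ∷ ⟦ x ⟧ ∷ ⟦ y ⟧ ∷ s ∷ []) (λ a₁ a₃ x y s →
          x ⊛ a₁ := :0 ⇒ :1 ⊛ a₃ := :0 ⇒ :η a₁ a₃ x (y :* s) := 2 :· :1 :* (y :* s)) 0≈0 0≈0) 2ys≉0
      ; m       = m
      ; tangent = solve (a₁ ∷ a₂ ∷ a₃ ∷ a₄ ∷ ⟦ x ⟧ ∷ ⟦ y ⟧ ∷ s ∷ m ∷ []) (λ a₁ a₂ a₃ A x y s m →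
          (m :* x :+ y :* s) ⊛ a₁ := :0 ⇒ (:- (2 :· x)) ⊛ a₂ := :0 ⇒ m ⊛ a₃ := :0 ⇒
          :1 ⊛ m :* (2 :· :1 :* (y :* s)) := 3 :· x :^ 2 :+ A ⇒
          m :* :η a₁ a₃ x (y :* s) := 3 :· x :^ 2 :+ 2 :· a₂ :* x :+ A :- a₁ :* (y :* s))
          0≈0 0≈0 0≈0 m-slope
      -- Multiplication by the square of 2ys clears the denominator of the slope, after which s² = t
      -- applies.
      ; flex    = *-cancelˡ (^-≉0 2 2ys≉0)
          (solve (a₁ ∷ a₂ ∷ a₄ ∷ ⟦ t ⟧ ∷ ⟦ x ⟧ ∷ ⟦ y ⟧ ∷ s ∷ m ∷ []) (λ a₁ a₂ A t x y s m →
          let z = 2 :· :1 :* (y :* s)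
              N = 3 :· x :^ 2 :+ A
          in
          (z :^ 2 :* m) ⊛ a₁ := :0 ⇒ (:- z :^ 2) ⊛ a₂ := :0 ⇒
          (m :* z :+ N) ⊛ m :* z := N ⇒
          :1 ⊛ N :^ 2 := 12 :· x :* (t :* y :^ 2) ⇒
          (:- (12 :· x :* y :^ 2)) ⊛ s :^ 2 := t ⇒
          z :^ 2 :* (m :^ 2 :+ a₁ :* m :- a₂) := z :^ 2 :* 3 :· x) 0≈0 0≈0 m-slope
          (ι.preserve (t ∷ A ∷ x ∷ y ∷ []) (λ t A x y → (3 :· x :^ 2 :+ A) :^ 2)
            (λ t A x y → 12 :· x :* (t :* y :^ 2)) (Tw.flex φ)) s²≈t)
      }
      where
      2ys≉0 : 2 · 1# * (⟦ y ⟧ * s) ≉ 0#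
      2ys≉0 = *-≉0 2≉0 (*-≉0 (ι.⟦⟧-≉0 (Tw.y≉0 φ)) s≉0)
      m : Carrier
      m = (3 · ⟦ x ⟧ ^ 2 + a₄) / (2 · 1# * (⟦ y ⟧ * s))
      m-slope : m * (2 · 1# * (⟦ y ⟧ * s)) ≈ 3 · ⟦ x ⟧ ^ 2 + a₄
      m-slope = /-*-cancel 2ys≉0

    neg≈- : ∀ {x y} → neg x y ≈ - y
    neg≈- {x} {y} = solve (a₁ ∷ a₃ ∷ x ∷ y ∷ []) (λ a₁ a₃ x y →
      (:- x) ⊛ a₁ := :0 ⇒ (:- :1) ⊛ a₃ := :0 ⇒ :- y :- a₁ :* x :- a₃ := :- y) 0≈0 0≈0

    module _ {x y : F.Carrier} (φ : TwistedFlex t A B x y) where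
      private
        G : Subgroup Eᴷ
        G = FlexSubgroup.subgroup (ascend φ)

        abscissa-fixed : ∀ {z} → z ≈ ⟦ x ⟧ → z ^ q ≈ z
        abscissa-fixed e = trans (^-congˡ q e) (trans (ι.⟦⟧-fixed x) (sym e))

        ordinate : ∀ {z} → z ≈ ⟦ y ⟧ * s ⊎ z ≈ neg ⟦ x ⟧ (⟦ y ⟧ * s) → z ^ q ≈ - z
        ordinate (inj₁ e) = trans (^-congˡ q e) (trans (multiple-^q y) (-‿cong (sym e)))
        ordinate (inj₂ e) = trans (^-congˡ q e′) (trans (-‿^q _)
          (trans (-‿cong (multiple-^q y)) (-‿cong (sym e′))))
          where e′ = trans e neg≈-

        ordinate≉0 : ∀ {z} → z ≈ ⟦ y ⟧ * s ⊎ z ≈ neg ⟦ x ⟧ (⟦ y ⟧ * s) → z ≉ 0#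
        ordinate≉0 (inj₁ e) = ≉0-resp e (*-≉0 (ι.⟦⟧-≉0 (Tw.y≉0 φ)) s≉0)
        ordinate≉0 (inj₂ e) = ≉0-resp (trans e neg≈-)
          (-‿≉0 (*-≉0 (ι.⟦⟧-≉0 (Tw.y≉0 φ)) s≉0))

        stable : FrobeniusStable G q
        stable (inj₁ nothing) = inj₁ nothing
        stable (inj₂ (inj₁ (just (e , e′)))) = inj₂ (inj₂ (just
          (trans (abscissa-fixed e) e ,
           trans (ordinate (inj₁ e′)) (trans (-‿cong e′) (sym neg≈-)))))
        stable (inj₂ (inj₂ (just (e , e′)))) = inj₂ (inj₁ (just
          (trans (abscissa-fixed e) e ,
           trans (ordinate (inj₂ e′)) (trans (-‿cong (trans e′ neg≈-))
             (solve (⟦ y ⟧ * s ∷ []) λ z → :- (:- z) := z)))))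

        definedAt : ∀ {z z′} → z ≈ ⟦ x ⟧ → z′ ≈ ⟦ y ⟧ * s ⊎ z′ ≈ neg ⟦ x ⟧ (⟦ y ⟧ * s) →
                    DefinedOver κ (aff z z′) × ¬ DefinedOver ι (aff z z′)
        definedAt e e′ =
          (fixed⇒∈L (abscissa-fixed e) , anti-fixed⇒∈L (ordinate e′)) ,
          λ { (_ , b) → anti-fixed⇒∉F (ordinate≉0 e′) (ordinate e′) b }

        defined : NonzeroPoints G (λ P → DefinedOver κ P × ¬ DefinedOver ι P)
        defined (inj₁ e)                      P≉𝒪 = contradiction e P≉𝒪
        defined (inj₂ (inj₁ (just (e , e′)))) P≉𝒪 = definedAt e (inj₁ e′)
        defined (inj₂ (inj₂ (just (e , e′)))) P≉𝒪 = definedAt e (inj₂ e′)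

      rationalSubgroup : ∃ (Rational E)
      rationalSubgroup = G , FlexSubgroup.hasOrder-3 (ascend φ) , stable , defined

    private
      twistedFlex : ∀ i → TwistedFlex t A B (X i) (Y i)
      twistedFlex i = TwistedFlex-resp (F.sym A≈) (F.sym B≈) (Four.twistedFlex i)

    hasFourSubgroups : HasFourSubgroups ι κ q E
    hasFourSubgroups = subgroup , injective , surjective
      where
      subgroup : Fin 4 → ∃ (Rational E)
      subgroup i = rationalSubgroup (twistedFlex i)

      Member : Fin 4 → Point K → Set (c ⊔ ℓ)
      Member i = Subgroup.Member (proj₁ (subgroup i))

      abscissa : ∀ {x y x′ y′} → y ≉ 0# → Spans x′ y′ (aff x y) → x ≈ x′
      abscissa _ (inj₂ (inj₁ (just (e , _)))) = e
      abscissa _ (inj₂ (inj₂ (just (e , _)))) = e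

      injective : ∀ {i j} → Member i ≐ Member j → i ≡ j
      injective {i} {j} (⊆ , _) = Four.X-injective (ι.⟦⟧-injective
        (abscissa {y = ⟦ Y i ⟧ * s} {x′ = ⟦ X j ⟧} {y′ = ⟦ Y j ⟧ * s}
          (*-≉0 (ι.⟦⟧-≉0 (Tw.y≉0 (twistedFlex i))) s≉0) (⊆ (inj₂ (inj₁ ≈ₚ-refl)))))

      module _ (G : Subgroup Eᴷ) (rational : Rational E G) where
        private
          module D = Descended (descend G rational)
          found : ∃ λ i → D.x F.≈ X i
          found = Four.exhaustive (TwistedFlex-resp A≈ B≈ (DescendedFlexes.halve F t D.flex))
          i = proj₁ found
          x≈Xᵢ : ⟦ D.x ⟧ ≈ ⟦ X i ⟧
          x≈Xᵢ = ι.⟦⟧-cong (proj₂ found)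
          onCurveᵢ : OnCurve Eᴷ (aff ⟦ X i ⟧ (⟦ Y i ⟧ * s))
          onCurveᵢ = Flex.onCurve (ascend (twistedFlex i))

        -- The descended abscissa is one of the four `X i`, and a subgroup {O, ±P} is determined by
        -- the abscissa of P.
        locate : ∃ λ i → Member i ≐ Subgroup.Member G
        locate = i ,
          (λ p → spans⇒member G D.member
            (spans-⊆ (sym x≈Xᵢ) (same-abscissa (sym x≈Xᵢ) onCurveᵢ D.onCurve) p)) ,
          (λ p → spans-⊆ x≈Xᵢ (same-abscissa x≈Xᵢ D.onCurve onCurveᵢ) (D.spans p))

      surjective : ∀ (G : ∃ (Rational E)) →
                   ∃ λ i → ∀ {j} → j ≡ i → Member j ≐ Subgroup.Member (proj₁ G)
      surjective (G , rational) = proj₁ (locate G rational) , λ { refl → proj₂ (locate G rational) }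

-- Isomorphisms with short models, and the parameters of a curve with two rational flexes

module ShortModels {c ℓ} (F : EisensteinField c ℓ) where
  open EisensteinProperties F
  open import Relation.Binary.Reasoning.Setoid setoid

  module _ (E : WeierstrassCurve fieldᴱ) where
    open WeierstrassCurve E

    -- With aᵢ = 6ⁱ αᵢ the substitution that completes the square and the cube, and the coefficients
    -- it produces, are polynomials in the αᵢ over ℤ. No denominators enter the certificates.
    α₁ α₂ α₃ α₄ α₆ : Carrier
    α₁ = h * a₁
    α₂ = h ^ 2 * a₂
    α₃ = h ^ 3 * a₃
    α₄ = h ^ 4 * a₄
    α₆ = h ^ 6 * a₆

    private
      α : WeierstrassCurve fieldᴱ
      α = record { a₁ = α₁ ; a₂ = α₂ ; a₃ = α₃ ; a₄ = α₄ ; a₆ = α₆ }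

    -- E is isomorphic to y² = x³ + Ax + B with u = 1.
    normalA normalB : Carrier
    normalA = - (27 · 1# * Invariants.c₄ α)
    normalB = - (27 · 1# * 2 · 1# * Invariants.c₆ α)

    normalA≈ : normalA ≈ h ^ 4 * - (27 · 1# * Invariants.c₄ E)
    normalA≈ = solve (a₁ ∷ a₂ ∷ a₃ ∷ a₄ ∷ a₆ ∷ h ∷ []) λ a₁ a₂ a₃ a₄ a₆ h →
      :- (27 :· :1 :* :c₄ (h :* a₁) (h :^ 2 :* a₂) (h :^ 3 :* a₃) (h :^ 4 :* a₄) (h :^ 6 :* a₆))
      := h :^ 4 :* :- (27 :· :1 :* :c₄ a₁ a₂ a₃ a₄ a₆)

    normalB≈ : normalB ≈ h ^ 6 * - (27 · 1# * 2 · 1# * Invariants.c₆ E)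
    normalB≈ = solve (a₁ ∷ a₂ ∷ a₃ ∷ a₄ ∷ a₆ ∷ h ∷ []) λ a₁ a₂ a₃ a₄ a₆ h →
      :- (27 :· :1 :* 2 :· :1 :* :c₆ (h :* a₁) (h :^ 2 :* a₂) (h :^ 3 :* a₃) (h :^ 4 :* a₄) (h :^ 6 :* a₆))
      := h :^ 6 :* :- (27 :· :1 :* 2 :· :1 :* :c₆ a₁ a₂ a₃ a₄ a₆)

    private
      6h^n : ∀ n {a} → a ≈ (6 · 1#) ^ n * (h ^ n * a)
      6h^n n {a} = begin
        a                             ≈⟨ *-identityˡ a ⟨
        1# * a                        ≈⟨ *-congʳ (1^n n) ⟨
        1# ^ n * a                    ≈⟨ *-congʳ (Exp.^-congˡ semiring n 6h≈1) ⟨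
        (6 · h) ^ n * a               ≈⟨ *-congʳ (Exp.^-congˡ semiring n
                                           (solve (h ∷ []) λ h → 6 :· h := 6 :· :1 :* h)) ⟩
        (6 · 1# * h) ^ n * a          ≈⟨ *-congʳ (CommutativeExp.^-distrib-* commutativeSemiring _ h n) ⟩
        ((6 · 1#) ^ n * h ^ n) * a    ≈⟨ *-assoc _ _ _ ⟩
        (6 · 1#) ^ n * (h ^ n * a)    ∎
        where
        1^n : ∀ n → 1# ^ n ≈ 1#
        1^n zero    = ≈-refl
        1^n (suc n) = trans (*-identityˡ _) (1^n n)

      a₁≈ : a₁ ≈ 6 · 1# * α₁
      a₁≈ = trans (6h^n 1) (solve (h ∷ a₁ ∷ []) λ h a₁ →
        (6 :· :1) :^ 1 :* (h :^ 1 :* a₁) := 6 :· :1 :* (h :* a₁))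
      a₂≈ : a₂ ≈ (6 · 1#) ^ 2 * α₂
      a₂≈ = 6h^n 2
      a₃≈ : a₃ ≈ (6 · 1#) ^ 3 * α₃
      a₃≈ = 6h^n 3
      a₄≈ : a₄ ≈ (6 · 1#) ^ 4 * α₄
      a₄≈ = 6h^n 4
      a₆≈ : a₆ ≈ (6 · 1#) ^ 6 * α₆
      a₆≈ = 6h^n 6

      :6 : ∀ {n} → Expr n
      :6 = 6 :· :1

    toShort : ∀ {A B} u → u ≉ 0# → normalA ≈ u ^ 4 * A → normalB ≈ u ^ 6 * B →
              E ≅ shortWeierstrass fieldᴱ A B
    toShort {A} {B} u u≉0 A≈ B≈ = record
      { u = u ; r = r ; s = s ; t = t ; u≉0 = u≉0
      ; a₁-eq = solve (u ∷ a₁ ∷ α₁ ∷ []) (λ u a₁ α₁ → (:- :1) ⊛ a₁ := :6 :* α₁ ⇒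
          u :* :0 := a₁ :+ 2 :· :- (3 :· α₁)) a₁≈
      ; a₂-eq = solve (u ∷ a₁ ∷ a₂ ∷ α₁ ∷ α₂ ∷ []) (λ u a₁ a₂ α₁ α₂ →
          let s = :- (3 :· α₁)
              r = :- (3 :· :b₂ α₁ α₂)
          in s ⊛ a₁ := :6 :* α₁ ⇒ (:- :1) ⊛ a₂ := :6 :^ 2 :* α₂ ⇒
          u :^ 2 :* :0 := a₂ :- s :* a₁ :+ 3 :· r :- s :^ 2) a₁≈ a₂≈
      ; a₃-eq = solve (u ∷ a₁ ∷ a₃ ∷ α₁ ∷ α₂ ∷ α₃ ∷ []) (λ u a₁ a₃ α₁ α₂ α₃ →
          let r = :- (3 :· :b₂ α₁ α₂)
              t = :- (4 :· :1 :* 27 :· :1 :* α₃) :+ 9 :· (α₁ :* :b₂ α₁ α₂)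
          in (:- r) ⊛ a₁ := :6 :* α₁ ⇒ (:- :1) ⊛ a₃ := :6 :^ 3 :* α₃ ⇒
          u :^ 3 :* :0 := a₃ :+ r :* a₁ :+ 2 :· t) a₁≈ a₃≈
      ; a₄-eq = trans (sym A≈) (solve (a₁ ∷ a₂ ∷ a₃ ∷ a₄ ∷ α₁ ∷ α₂ ∷ α₃ ∷ α₄ ∷ α₆ ∷ [])
          (λ a₁ a₂ a₃ a₄ α₁ α₂ α₃ α₄ α₆ →
          let s = :- (3 :· α₁)
              r = :- (3 :· :b₂ α₁ α₂)
              t = :- (4 :· :1 :* 27 :· :1 :* α₃) :+ 9 :· (α₁ :* :b₂ α₁ α₂)
          in (t :+ r :* s) ⊛ a₁ := :6 :* α₁ ⇒ (:- (2 :· r)) ⊛ a₂ := :6 :^ 2 :* α₂ ⇒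
          s ⊛ a₃ := :6 :^ 3 :* α₃ ⇒ (:- :1) ⊛ a₄ := :6 :^ 4 :* α₄ ⇒
          :- (27 :· :1 :* :c₄ α₁ α₂ α₃ α₄ α₆)
            := a₄ :- s :* a₃ :+ 2 :· r :* a₂ :- (t :+ r :* s) :* a₁ :+ 3 :· r :^ 2 :- 2 :· s :* t)
          a₁≈ a₂≈ a₃≈ a₄≈)
      ; a₆-eq = trans (sym B≈) (solve (a₁ ∷ a₂ ∷ a₃ ∷ a₄ ∷ a₆ ∷ α₁ ∷ α₂ ∷ α₃ ∷ α₄ ∷ α₆ ∷ [])
          (λ a₁ a₂ a₃ a₄ a₆ α₁ α₂ α₃ α₄ α₆ →
          let r = :- (3 :· :b₂ α₁ α₂)
              t = :- (4 :· :1 :* 27 :· :1 :* α₃) :+ 9 :· (α₁ :* :b₂ α₁ α₂)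
          in (r :* t) ⊛ a₁ := :6 :* α₁ ⇒ (:- r :^ 2) ⊛ a₂ := :6 :^ 2 :* α₂ ⇒
          t ⊛ a₃ := :6 :^ 3 :* α₃ ⇒ (:- r) ⊛ a₄ := :6 :^ 4 :* α₄ ⇒
          (:- :1) ⊛ a₆ := :6 :^ 6 :* α₆ ⇒
          :- (27 :· :1 :* 2 :· :1 :* :c₆ α₁ α₂ α₃ α₄ α₆)
            := a₆ :+ r :* a₄ :+ r :^ 2 :* a₂ :+ r :^ 3 :- t :* a₃ :- t :^ 2 :- r :* t :* a₁)
          a₁≈ a₂≈ a₃≈ a₄≈ a₆≈)
      }
      where
      b s r t : Carrier
      b = α₁ ^ 2 + 4 · α₂
      -- In terms of the original coefficients: -a₁/2, then -b₂/12, then -(a₃ + r a₁)/2.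
      s = - (3 · α₁)
      r = - (3 · b)
      t = - (4 · 1# * 27 · 1# * α₃) + 9 · (α₁ * b)

    -- Built directly instead of by inverting `toShort`: the count needs isomorphisms that start at
    -- a short model, while the list of curves needs isomorphisms that end at one.
    fromShort : ∀ {A B} u → u ≉ 0# → A ≈ u ^ 4 * normalA → B ≈ u ^ 6 * normalB →
                shortWeierstrass fieldᴱ A B ≅ E
    fromShort {A} {B} u u≉0 A≈ B≈ = record
      { u = u ; r = r ; s = s ; t = t ; u≉0 = u≉0
      ; a₁-eq = solve (u ∷ a₁ ∷ α₁ ∷ []) (λ u a₁ α₁ → u ⊛ a₁ := :6 :* α₁ ⇒
          u :* a₁ := :0 :+ 2 :· (3 :· (u :* α₁))) a₁≈
      ; a₂-eq = solve (u ∷ a₂ ∷ α₁ ∷ α₂ ∷ []) (λ u a₂ α₁ α₂ →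
          let s = 3 :· (u :* α₁)
              r = 3 :· (u :^ 2 :* :b₂ α₁ α₂)
          in u :^ 2 ⊛ a₂ := :6 :^ 2 :* α₂ ⇒
          u :^ 2 :* a₂ := :0 :- s :* :0 :+ 3 :· r :- s :^ 2) a₂≈
      ; a₃-eq = solve (u ∷ a₃ ∷ α₁ ∷ α₂ ∷ α₃ ∷ []) (λ u a₃ α₁ α₂ α₃ →
          let r = 3 :· (u :^ 2 :* :b₂ α₁ α₂)
              t = 4 :· :1 :* 27 :· :1 :* (u :^ 3 :* α₃)
          in u :^ 3 ⊛ a₃ := :6 :^ 3 :* α₃ ⇒
          u :^ 3 :* a₃ := :0 :+ r :* :0 :+ 2 :· t) a₃≈
      ; a₄-eq = solve (u ∷ A ∷ a₄ ∷ α₁ ∷ α₂ ∷ α₃ ∷ α₄ ∷ α₆ ∷ [])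
          (λ u A a₄ α₁ α₂ α₃ α₄ α₆ →
          let s = 3 :· (u :* α₁)
              r = 3 :· (u :^ 2 :* :b₂ α₁ α₂)
              t = 4 :· :1 :* 27 :· :1 :* (u :^ 3 :* α₃)
          in u :^ 4 ⊛ a₄ := :6 :^ 4 :* α₄ ⇒
          (:- :1) ⊛ A := u :^ 4 :* :- (27 :· :1 :* :c₄ α₁ α₂ α₃ α₄ α₆) ⇒
          u :^ 4 :* a₄ := A :- s :* :0 :+ 2 :· r :* :0 :- (t :+ r :* s) :* :0
                          :+ 3 :· r :^ 2 :- 2 :· s :* t)
          a₄≈ A≈
      ; a₆-eq = solve (u ∷ A ∷ B ∷ a₆ ∷ α₁ ∷ α₂ ∷ α₃ ∷ α₄ ∷ α₆ ∷ [])
          (λ u A B a₆ α₁ α₂ α₃ α₄ α₆ →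
          let r = 3 :· (u :^ 2 :* :b₂ α₁ α₂)
              t = 4 :· :1 :* 27 :· :1 :* (u :^ 3 :* α₃)
          in u :^ 6 ⊛ a₆ := :6 :^ 6 :* α₆ ⇒
          (:- r) ⊛ A := u :^ 4 :* :- (27 :· :1 :* :c₄ α₁ α₂ α₃ α₄ α₆) ⇒
          (:- :1) ⊛ B := u :^ 6 :* :- (27 :· :1 :* 2 :· :1 :* :c₆ α₁ α₂ α₃ α₄ α₆) ⇒
          u :^ 6 :* a₆ := B :+ r :* A :+ r :^ 2 :* :0 :+ r :^ 3 :- t :* :0 :- t :^ 2 :- r :* t :* :0)
          a₆≈ A≈ B≈
      }
      where
      b s r t : Carrier
      b = α₁ ^ 2 + 4 · α₂
      -- In terms of the original coefficients: u a₁/2, then u² b₂/12, then u³ a₃/2.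
      s = 3 · (u * α₁)
      r = 3 · (u ^ 2 * b)
      t = 4 · 1# * 27 · 1# * (u ^ 3 * α₃)

  -- As 2 and 3 are invertible, the three vanishing coefficients force s = r = t = 0, so that only
  -- the scaling by u is left.
  between-short : ∀ {A B A′ B′} → shortWeierstrass fieldᴱ A B ≅ shortWeierstrass fieldᴱ A′ B′ →
                  ∃ λ u → u ≉ 0# × A ≈ u ^ 4 * A′ × B ≈ u ^ 6 * B′
  between-short {A} {B} {A′} {B′} i = u , u≉0 ,
    solve (u ∷ r ∷ s ∷ t ∷ A ∷ A′ ∷ []) (λ u r s t A A′ →
      (:- :1) ⊛ u :^ 4 :* A′ := A :- s :* :0 :+ 2 :· r :* :0 :- (t :+ r :* s) :* :0
                                :+ 3 :· r :^ 2 :- 2 :· s :* t ⇒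
      (2 :· t) ⊛ s := :0 ⇒ (:- (3 :· r)) ⊛ r := :0 ⇒ A := u :^ 4 :* A′) a₄-eq s≈0 r≈0 ,
    solve (u ∷ r ∷ t ∷ A ∷ B ∷ B′ ∷ []) (λ u r t A B B′ →
      (:- :1) ⊛ u :^ 6 :* B′ := B :+ r :* A :+ r :^ 2 :* :0 :+ r :^ 3 :- t :* :0 :- t :^ 2 :- r :* t :* :0 ⇒
      (:- (A :+ r :^ 2)) ⊛ r := :0 ⇒ t ⊛ t := :0 ⇒ B := u :^ 6 :* B′) a₆-eq r≈0 t≈0
    where
    open _≅_ i
    s≈0 : s ≈ 0#
    s≈0 = *-cancelˡ 2≉0 (solve (u ∷ s ∷ []) (λ u s →
      (:- :1) ⊛ u :* :0 := :0 :+ 2 :· s ⇒ 2 :· :1 :* s := 2 :· :1 :* :0) a₁-eq)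
    r≈0 : r ≈ 0#
    r≈0 = *-cancelˡ 3≉0 (solve (u ∷ r ∷ s ∷ []) (λ u r s →
      (:- :1) ⊛ u :^ 2 :* :0 := :0 :- s :* :0 :+ 3 :· r :- s :^ 2 ⇒ s ⊛ s := :0 ⇒
      3 :· :1 :* r := 3 :· :1 :* :0) a₂-eq s≈0)
    t≈0 : t ≈ 0#
    t≈0 = *-cancelˡ 2≉0 (solve (u ∷ r ∷ t ∷ []) (λ u r t →
      (:- :1) ⊛ u :^ 3 :* :0 := :0 :+ r :* :0 :+ 2 :· t ⇒ 2 :· :1 :* t := 2 :· :1 :* :0) a₃-eq)

module Parameters {c ℓ} (F : EisensteinField c ℓ) (t : EisensteinField.Carrier F)
                  (t≉0 : EisensteinField._≉_ F t (EisensteinField.0# F)) where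
  open EisensteinProperties F
  open HesseForms F

  -- The first flex determines e through its slope 3e√t; since 4t(f² + fe + e²) is then
  -- the difference of the abscissae and 4t(e³ - f³) the ordinate, their quotient gives f.
  abstract
    parametrise : ∀ {A B x₀ y₀ x₁ y₁} → TwistedFlex t A B x₀ y₀ → TwistedFlex t A B x₁ y₁ → x₀ ≉ x₁ →
      ∃₂ λ e f → A ≈ t ^ 2 * formA e f × B ≈ t ^ 3 * formB e f
    parametrise {A} {B} {x₀} {y₀} {x₁} {y₁} φ₀ φ₁ x₀≉x₁ = e , e + g ,
      trans A≈ (solve (t ∷ e ∷ g ∷ d ∷ []) (λ t e g d →
        (6 :· (t :* (g :* e))) ⊛ d := :D t e g ⇒
        :A t e g d := t :^ 2 :* :formA e (e :+ g)) d≈D) ,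
      trans B≈ (solve (t ∷ e ∷ g ∷ d ∷ []) (λ t e g d →
        (t :* g :^ 2 :* (d :+ :D t e g) :- 18 :· (t :^ 2 :* e :^ 3 :* g)) ⊛ d := :D t e g ⇒
        :B t e g d := t :^ 3 :* :formB e (e :+ g)) d≈D)
      where
      module φ₀ = TwistedFlex φ₀
      module φ₁ = TwistedFlex φ₁
      :D : ∀ {n} → (t e g : Expr n) → Expr n
      :D t e g = :- (4 :· (t :* (3 :· e :^ 2 :+ 3 :· (e :* g) :+ g :^ 2)))
      :A :B : ∀ {n} → (t e g d : Expr n) → Expr n
      :A t e g d = 6 :· (t :* (g :* d) :* e) :- 27 :· (t :* e :^ 2) :^ 2
      :B t e g d = t :* (g :* d) :^ 2 :- 27 :· (t :* e :^ 2) :^ 3 :- :A t e g d :* 3 :· (t :* e :^ 2)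

      N d e g A′ B′ : Carrier
      N = 3 · x₀ ^ 2 + A
      d = x₁ - x₀
      e = N / (6 · 1# * (t * y₀))
      -- This is f - e, because 4t(e³ - f³) is divided by -4t(e² + ef + f²). The cube root of unity
      -- that belongs to x₁ is absorbed into f, which enters the forms only through its cube.
      g = y₀ / d
      -- Put x₀ = 3te² and y₀ = g d. The slope equation 6t e y₀ = 3x₀² + A gives A, and then the
      -- curve equation gives B.
      A′ = 6 · (t * (g * d) * e) - 27 · (t * e ^ 2) ^ 2
      B′ = t * (g * d) ^ 2 - 27 · (t * e ^ 2) ^ 3 - A′ * 3 · (t * e ^ 2)

      6≉0 : 6 · 1# ≉ 0#
      6≉0 = ≉0-resp (solve [] (6 :· :1 := 2 :· :1 :* 3 :· :1)) (*-≉0 2≉0 3≉0)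
      6ty₀≉0 : 6 · 1# * (t * y₀) ≉ 0#
      6ty₀≉0 = *-≉0 6≉0 (*-≉0 t≉0 φ₀.y≉0)
      d≉0 : d ≉ 0#
      d≉0 = x≉y⇒x-y≉0 (x₀≉x₁ ∘ sym)
      e-eq : e * (6 · 1# * (t * y₀)) ≈ N
      e-eq = /-*-cancel 6ty₀≉0
      g-eq : g * d ≈ y₀
      g-eq = /-*-cancel d≉0
      x₀≈ : x₀ ≈ 3 · (t * e ^ 2)
      x₀≈ = *-cancelˡ (*-≉0 (*-≉0 6≉0 2≉0) (*-≉0 t≉0 (^-≉0 2 φ₀.y≉0))) (solve (t ∷ A ∷ x₀ ∷ y₀ ∷ e ∷ [])
        (λ t A x y e →
          let N = 3 :· x :^ 2 :+ A in
          (:- (e :* (6 :· :1 :* (t :* y)) :+ N)) ⊛ e :* (6 :· :1 :* (t :* y)) := N ⇒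
          (:- :1) ⊛ N :^ 2 := 12 :· x :* (t :* y :^ 2) ⇒
          6 :· :1 :* 2 :· :1 :* (t :* y :^ 2) :* x := 6 :· :1 :* 2 :· :1 :* (t :* y :^ 2) :* 3 :· (t :* e :^ 2))
        e-eq φ₀.flex)
      A≈ : A ≈ A′
      A≈ = solve (t ∷ A ∷ x₀ ∷ y₀ ∷ e ∷ g ∷ d ∷ []) (λ t A x y e g d →
        (:- :1) ⊛ e :* (6 :· :1 :* (t :* y)) := 3 :· x :^ 2 :+ A ⇒
        (:- (6 :· (t :* e))) ⊛ g :* d := y ⇒
        (:- (3 :· (x :+ 3 :· (t :* e :^ 2)))) ⊛ x := 3 :· (t :* e :^ 2) ⇒
        A := :A t e g d) e-eq g-eq x₀≈
      B≈ : B ≈ B′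
      B≈ = solve (t ∷ A ∷ B ∷ x₀ ∷ y₀ ∷ e ∷ g ∷ d ∷ []) (λ t A B x y e g d →
        let x′ = 3 :· (t :* e :^ 2) in
        (:- :1) ⊛ t :* y :^ 2 := x :^ 3 :+ A :* x :+ B ⇒
        (:- (t :* (g :* d :+ y))) ⊛ g :* d := y ⇒
        (:- (x :^ 2 :+ x :* x′ :+ x′ :^ 2) :- A) ⊛ x := x′ ⇒
        (:- x′) ⊛ A := :A t e g d ⇒
        B := :B t e g d) φ₀.curve g-eq x₀≈ A≈
      :ψ : Expr 3
      :ψ = (λ A B x → (3 :· x :^ 2 :+ A) :^ 2 :- 12 :· x :* (x :^ 3 :+ A :* x :+ B)) $ⁿ vars
      ψ≈0 : ⟦ :ψ ⟧ (A ∷ B ∷ x₁ ∷ []) ≈ 0#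
      ψ≈0 = solve (t ∷ A ∷ B ∷ x₁ ∷ y₁ ∷ []) (λ t A B x y →
        :1 ⊛ (3 :· x :^ 2 :+ A) :^ 2 := 12 :· x :* (t :* y :^ 2) ⇒
        (12 :· x) ⊛ t :* y :^ 2 := x :^ 3 :+ A :* x :+ B ⇒
        (3 :· x :^ 2 :+ A) :^ 2 :- 12 :· x :* (x :^ 3 :+ A :* x :+ B) := :0) φ₁.flex φ₁.curve
      x₁≈ : x₁ ≈ 3 · (t * e ^ 2) + d
      x₁≈ = solve (t ∷ e ∷ x₀ ∷ x₁ ∷ []) (λ t e x₀ x₁ →
        :1 ⊛ x₀ := 3 :· (t :* e :^ 2) ⇒ x₁ := 3 :· (t :* e :^ 2) :+ (x₁ :- x₀)) x₀≈
      -- After substitution of A′ and B′ the flex polynomial at x₀ + d is -3d³ (d - D), and d is not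
      -- zero.
      d≈D : d ≈ - (4 · (t * (3 · e ^ 2 + 3 · (e * g) + g ^ 2)))
      d≈D = *-cancelˡ (*-≉0 3≉0 (^-≉0 3 d≉0)) (solve (t ∷ e ∷ g ∷ d ∷ []) (λ t e g d →
        let x = 3 :· (t :* e :^ 2) :+ d in
        (:- :1) ⊛ (3 :· x :^ 2 :+ :A t e g d) :^ 2 :- 12 :· x :* (x :^ 3 :+ :A t e g d :* x :+ :B t e g d) := :0 ⇒
        3 :· :1 :* d :^ 3 :* d := 3 :· :1 :* d :^ 3 :* :D t e g)
        (trans (sym (⟦ :ψ ⟧-cong {v = A ∷ B ∷ x₁ ∷ []} {w = A′ ∷ B′ ∷ 3 · (t * e ^ 2) + d ∷ []}
          λ { zero → A≈ ; (suc zero) → B≈ ; (suc (suc zero)) → x₁≈ })) ψ≈0))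

-- Transversals of a partition into blocks of equal size

module Transversals {a ℓ} (S : DecSetoid a ℓ) where
  open DecSetoid S renaming (Carrier to A; refl to ≈-refl)
  open Membership setoid using (_∈_; _∉_)
  open Unique setoid using (Unique)
  private
    module ∈ = MembershipProperties

  infixl 6 _─_
  _─_ : List A → A → List A
  xs ─ y = List.filter (λ z → ¬? (z ≟ y)) xs

  private
    ≉-resp : ∀ {y z z′} → z ≈ z′ → ¬ z ≈ y → ¬ z′ ≈ y
    ≉-resp z≈z′ z≉y z′≈y = z≉y (trans z≈z′ z′≈y)

  ∈-─⁺ : ∀ {xs y z} → z ∈ xs → ¬ z ≈ y → z ∈ xs ─ y
  ∈-─⁺ = ∈.∈-filter⁺ setoid _ ≉-resp

  ∈-─⁻ : ∀ {xs y z} → z ∈ xs ─ y → z ∈ xs × ¬ z ≈ y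
  ∈-─⁻ {xs} = ∈.∈-filter⁻ setoid _ ≉-resp {xs = xs}

  unique-─ : ∀ {xs} y → Unique xs → Unique (xs ─ y)
  unique-─ y = UniqueProperties.filter⁺ setoid (λ z → ¬? (z ≟ y))

  length-─ : ∀ {xs y} → Unique xs → y ∈ xs → length xs ≡ suc (length (xs ─ y))
  length-─ {x ∷ xs} {y} (x∉xs ∷ u) (here y≈x)
    rewrite List.filter-reject (λ z → ¬? (z ≟ y)) {x} {xs} (λ x≉y → x≉y (sym y≈x))
          | List.filter-all (λ z → ¬? (z ≟ y)) (All.map (λ x≉z z≈y → x≉z (sym (trans z≈y y≈x))) x∉xs)
    = refl
  length-─ {x ∷ xs} {y} (x∉xs ∷ u) (there y∈xs)
    rewrite List.filter-accept (λ z → ¬? (z ≟ y)) {x} {xs}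
              (λ x≈y → ∈.All[≉]⇒∉ setoid x∉xs (∈.∈-resp-≈ setoid (sym x≈y) y∈xs))
    = ≡.cong suc (length-─ u y∈xs)

  infixl 6 _∖_
  _∖_ : List A → List A → List A
  xs ∖ []       = xs
  xs ∖ (y ∷ ys) = (xs ─ y) ∖ ys

  ∈-∖⁺ : ∀ {xs z} ys → z ∈ xs → z ∉ ys → z ∈ xs ∖ ys
  ∈-∖⁺ []       z∈xs z∉ys = z∈xs
  ∈-∖⁺ (y ∷ ys) z∈xs z∉ys = ∈-∖⁺ ys (∈-─⁺ z∈xs (z∉ys ∘ here)) (z∉ys ∘ there)

  ∈-∖⁻ : ∀ {xs z} ys → z ∈ xs ∖ ys → z ∈ xs × z ∉ ys
  ∈-∖⁻ []       z∈ = z∈ , λ ()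
  ∈-∖⁻ {xs} (y ∷ ys) z∈ with z∈─ , z∉ys ← ∈-∖⁻ ys z∈ with z∈xs , z≉y ← ∈-─⁻ {xs} z∈─ =
    z∈xs , λ { (here z≈y) → z≉y z≈y ; (there z∈ys) → z∉ys z∈ys }

  unique-∖ : ∀ {xs} ys → Unique xs → Unique (xs ∖ ys)
  unique-∖ []       u = u
  unique-∖ (y ∷ ys) u = unique-∖ ys (unique-─ y u)

  length-∖ : ∀ {xs} ys → Unique xs → Unique ys → (∀ {y} → y ∈ ys → y ∈ xs) →
             length xs ≡ length ys ℕ.+ length (xs ∖ ys)
  length-∖ []       _ _             _     = refl
  length-∖ (y ∷ ys) u (y∉ys ∷ u′) ys⊆xs = ≡.trans (length-─ u (ys⊆xs (here ≈-refl)))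
    (≡.cong suc (length-∖ ys (unique-─ y u) u′ λ z∈ys →
      ∈-─⁺ (ys⊆xs (there z∈ys)) λ z≈y →
        ∈.All[≉]⇒∉ setoid y∉ys (∈.∈-resp-≈ setoid z≈y z∈ys)))

  module Blocks {p} (P : A → Set p) (block : A → List A) (m : ℕ)
    (block-unique : ∀ {x} → P x → Unique (block x))
    (block-length : ∀ x → length (block x) ≡ suc m)
    (block-refl   : ∀ {x y} → y ≈ x → y ∈ block x)
    (block-sym    : ∀ {x y} → P x → P y → y ∈ block x → x ∈ block y)
    (block-trans  : ∀ {x y z} → P x → P y → P z → y ∈ block x → z ∈ block y → z ∈ block x) where

    record Transversal (xs : List A) : Set (a ⊔ ℓ) where
      field
        reps     : List A
        counted  : length xs ≡ length reps ℕ.* suc m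
        reps∈    : All (_∈ xs) reps
        distinct : AllPairs (λ r s → s ∉ block r) reps
        covers   : ∀ {x} → x ∈ xs → Any (λ r → x ∈ block r) reps

    -- The bound `n` serves termination: each round removes the whole block of the first element,
    -- and what remains is again a union of blocks.
    transversal : ∀ n xs → length xs ℕ.≤ n → Unique xs → (∀ {x} → x ∈ xs → P x) →
                  (∀ {x y} → x ∈ xs → y ∈ block x → y ∈ xs) → Transversal xs
    transversal n       []           _  _ _ _ = record
      { reps = [] ; counted = refl ; reps∈ = [] ; distinct = [] ; covers = λ () }
    transversal (suc n) xs@(x ∷ xs′) le u P-all closed = record
      { reps     = x ∷ T.reps
      ; counted  = ≡.trans length-xs (≡.cong (suc m ℕ.+_) T.counted)
      ; reps∈    = here ≈-refl ∷ All.map (proj₁ ∘ ∈-∖⁻ (block x)) T.reps∈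
      ; distinct = All.map (proj₂ ∘ ∈-∖⁻ (block x)) T.reps∈ ∷ T.distinct
      ; covers   = covers
      }
      where
      ys : List A
      ys = xs ∖ block x
      length-xs : length xs ≡ suc m ℕ.+ length ys
      length-xs = ≡.trans (length-∖ (block x) u (block-unique (P-all (here ≈-refl))) (closed (here ≈-refl)))
                          (≡.cong (ℕ._+ length ys) (block-length x))
      length-ys : length ys ℕ.≤ n
      length-ys = ℕ.≤-trans (ℕ.m≤n+m (length ys) m)
        (ℕ.≤-pred (≡.subst (ℕ._≤ suc n) length-xs le))
      ys⊆xs : ∀ {y} → y ∈ ys → y ∈ xs
      ys⊆xs y∈ys = proj₁ (∈-∖⁻ (block x) y∈ys)
      closed′ : ∀ {y z} → y ∈ ys → z ∈ block y → z ∈ ys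
      -- An element shared with the block of x would, by symmetry and transitivity, put y itself
      -- into that block, which has been removed.
      closed′ {y} {z} y∈ys z∈y = ∈-∖⁺ (block x) z∈xs λ z∈x →
        proj₂ (∈-∖⁻ (block x) y∈ys)
          (block-trans Px Pz Py z∈x (block-sym Py Pz z∈y))
        where
        z∈xs = closed (ys⊆xs y∈ys) z∈y
        Px   = P-all (here ≈-refl)
        Py   = P-all (ys⊆xs y∈ys)
        Pz   = P-all z∈xs
      module T = Transversal (transversal n ys length-ys (unique-∖ (block x) u) (P-all ∘ ys⊆xs) closed′)
      covers : ∀ {y} → y ∈ xs → Any (λ r → y ∈ block r) (x ∷ T.reps)
      covers {y} y∈xs with Any.any? (y ≟_) (block x)
      ... | yes y∈x = here y∈x
      ... | no  y∉x = there (T.covers (∈-∖⁺ (block x) y∈xs y∉x))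

all-lookup : ∀ {a p} {A : Set a} {P : A → Set p} {xs} → All P xs → ∀ i → P (List.lookup xs i)
all-lookup (p ∷ ps) zero    = p
all-lookup (p ∷ ps) (suc i) = all-lookup ps i

allPairs-lookup : ∀ {a r} {A : Set a} {R : A → A → Set r} → (∀ {x y} → R x y → R y x) →
  ∀ {xs} → AllPairs R xs → ∀ i j → ¬ i ≡ j → R (List.lookup xs i) (List.lookup xs j)
allPairs-lookup sym (p ∷ ps) zero    zero    i≢j = contradiction refl i≢j
allPairs-lookup sym (p ∷ ps) zero    (suc j) i≢j = all-lookup p j
allPairs-lookup sym (p ∷ ps) (suc i) zero    i≢j = sym (allPairs-lookup sym (p ∷ ps) zero (suc i) (i≢j ∘ ≡.sym))
allPairs-lookup sym (p ∷ ps) (suc i) (suc j) i≢j = allPairs-lookup sym ps i j (i≢j ∘ ≡.cong suc)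

-- Isomorphism classes in the family (e , f) = (l , 1)

module Classes {c ℓ} (F : EisensteinField c ℓ) where
  open EisensteinProperties F
  open HesseForms F

  infix 4 _∼_
  -- Isomorphism over F of the twisted models with parameters l and m: the powers t² and t³ occur on
  -- both sides and cancel, so t is absent here.
  _∼_ : Carrier → Carrier → Set (c ⊔ ℓ)
  l ∼ m = ∃ λ u → u ≉ 0# × formA l 1# ≈ u ^ 4 * formA m 1# × formB l 1# ≈ u ^ 6 * formB m 1#

  formA-cong : ∀ {e e′ f f′} → e ≈ e′ → f ≈ f′ → formA e f ≈ formA e′ f′
  formA-cong e≈e′ f≈f′ = ⟦ (λ e f → :formA e f) $ⁿ vars ⟧-cong {v = _ ∷ _ ∷ []} {w = _ ∷ _ ∷ []}
    λ { zero → e≈e′ ; (suc zero) → f≈f′ }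

  formB-cong : ∀ {e e′ f f′} → e ≈ e′ → f ≈ f′ → formB e f ≈ formB e′ f′
  formB-cong e≈e′ f≈f′ = ⟦ (λ e f → :formB e f) $ⁿ vars ⟧-cong {v = _ ∷ _ ∷ []} {w = _ ∷ _ ∷ []}
    λ { zero → e≈e′ ; (suc zero) → f≈f′ }

  ∼-refl : ∀ {l m} → l ≈ m → l ∼ m
  ∼-refl {l} {m} l≈m = 1# , 1≉0 ,
    trans (formA-cong l≈m ≈-refl) (solve (formA m 1# ∷ []) λ a → a := :1 :^ 4 :* a) ,
    trans (formB-cong l≈m ≈-refl) (solve (formB m 1# ∷ []) λ b → b := :1 :^ 6 :* b)

  ∼-sym : ∀ {l m} → l ∼ m → m ∼ l
  ∼-sym {l} {m} (u , u≉0 , A≈ , B≈) = u ⁻¹ , *-≉0ʳ (≉0-resp uv≈1 1≉0) ,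
    solve (u ∷ u ⁻¹ ∷ formA l 1# ∷ formA m 1# ∷ []) (λ u v a b →
      (:- v :^ 4) ⊛ a := u :^ 4 :* b ⇒
      (:- (:geometric 4 (u :* v) :* b)) ⊛ u :* v := :1 ⇒
      b := v :^ 4 :* a) A≈ uv≈1 ,
    solve (u ∷ u ⁻¹ ∷ formB l 1# ∷ formB m 1# ∷ []) (λ u v a b →
      (:- v :^ 6) ⊛ a := u :^ 6 :* b ⇒
      (:- (:geometric 6 (u :* v) :* b)) ⊛
        u :* v := :1 ⇒
      b := v :^ 6 :* a) B≈ uv≈1
    where
    uv≈1 = *-inverseʳ u≉0

  ∼-trans : ∀ {l m n} → l ∼ m → m ∼ n → l ∼ n
  ∼-trans {l} {m} {n} (u , u≉0 , A≈ , B≈) (v , v≉0 , A≈′ , B≈′) = u * v , *-≉0 u≉0 v≉0 ,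
    solve (u ∷ v ∷ formA l 1# ∷ formA m 1# ∷ formA n 1# ∷ []) (λ u v a b c →
      :1 ⊛ a := u :^ 4 :* b ⇒ u :^ 4 ⊛ b := v :^ 4 :* c ⇒ a := (u :* v) :^ 4 :* c) A≈ A≈′ ,
    solve (u ∷ v ∷ formB l 1# ∷ formB m 1# ∷ formB n 1# ∷ []) (λ u v a b c →
      :1 ⊛ a := u :^ 6 :* b ⇒ u :^ 6 ⊛ b := v :^ 6 :* c ⇒ a := (u :* v) :^ 6 :* c) B≈ B≈′

  A≈0-resp : ∀ {l m} → l ∼ m → formA l 1# ≈ 0# → formA m 1# ≈ 0#
  A≈0-resp (u , u≉0 , A≈ , _) A≈0 =
    *-cancelˡ (^-≉0 4 u≉0) (trans (sym A≈) (trans A≈0 (sym (zeroʳ _))))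

  B≈0-resp : ∀ {l m} → l ∼ m → formB l 1# ≈ 0# → formB m 1# ≈ 0#
  B≈0-resp (u , u≉0 , _ , B≈) B≈0 =
    *-cancelˡ (^-≉0 6 u≉0) (trans (sym B≈) (trans B≈0 (sym (zeroʳ _))))

  Regular : Carrier → Set ℓ
  Regular l = Nonsingular l 1#

  ∼-regular : ∀ {l m} → l ∼ m → Regular l → Regular m
  ∼-regular {l} {m} (u , _ , A≈ , B≈) reg = nonsingular (*-≉0ʳ {x = u ^ 12} (≉0-resp
    (solve (u ∷ formA l 1# ∷ formB l 1# ∷ formA m 1# ∷ formB m 1# ∷ []) (λ u a b a′ b′ →
      (:- (4 :· (a :^ 2 :+ a :* (u :^ 4 :* a′) :+ (u :^ 4 :* a′) :^ 2))) ⊛ a := u :^ 4 :* a′ ⇒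
      (:- (27 :· (b :+ u :^ 6 :* b′))) ⊛ b := u :^ 6 :* b′ ⇒
      u :^ 12 :* (4 :· a′ :^ 3 :+ 27 :· b′ :^ 2) := 4 :· a :^ 3 :+ 27 :· b :^ 2) A≈ B≈)
    (4A³+27B²≉0 reg)))

  -- The pairs (e , f) with A(e , f) = A(l , 1) and B(e , f) = B(l , 1) up to sign and a
  -- cube root of unity in f, one for each flex 3e² of the curve.
  e′ f′ : Fin 4 → Carrier → Carrier
  e′ zero    l = l
  e′ (suc k) l = (l + 2 · ω k) * θ ⁻¹
  f′ zero    l = 1#
  f′ (suc k) l = (l - ω k) * θ ⁻¹

  private
    θθ⁻¹≈1 : θ * θ ⁻¹ ≈ 1#
    θθ⁻¹≈1 = *-inverseʳ θ≉0

    :A : ∀ {n} → (l ω w : Expr n) → Claim n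
    :A l ω w = :geometric 4 (:θ :* w) :* :formA l :1 ⊛ :θ :* w := :1 ⇒
      :formA ((l :+ 2 :· ω) :* w) ((l :- ω) :* w) := :formA l :1

    :B : ∀ {n} → (l ω w : Expr n) → Claim n
    :B l ω w = :geometric 6 (:θ :* w)
      :* :formB l :1 ⊛ :θ :* w := :1 ⇒
      :formB ((l :+ 2 :· ω) :* w) ((l :- ω) :* w) := :formB l :1

  formA-e′f′ : ∀ i l → formA (e′ i l) (f′ i l) ≈ formA l 1#
  formA-e′f′ zero                   l = ≈-refl
  formA-e′f′ (suc zero)             l = solve (l ∷ θ ⁻¹ ∷ []) (λ l → :A l :1) θθ⁻¹≈1
  formA-e′f′ (suc (suc zero))       l = solve (l ∷ θ ⁻¹ ∷ []) (λ l → :A l :ρ) θθ⁻¹≈1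
  formA-e′f′ (suc (suc (suc zero))) l = solve (l ∷ θ ⁻¹ ∷ []) (λ l → :A l (:ρ :^ 2)) θθ⁻¹≈1

  formB-e′f′ : ∀ i l → formB (e′ i l) (f′ i l) ≈ formB l 1#
  formB-e′f′ zero                   l = ≈-refl
  formB-e′f′ (suc zero)             l = solve (l ∷ θ ⁻¹ ∷ []) (λ l → :B l :1) θθ⁻¹≈1
  formB-e′f′ (suc (suc zero))       l = solve (l ∷ θ ⁻¹ ∷ []) (λ l → :B l :ρ) θθ⁻¹≈1
  formB-e′f′ (suc (suc (suc zero))) l = solve (l ∷ θ ⁻¹ ∷ []) (λ l → :B l (:ρ :^ 2)) θθ⁻¹≈1

  f′≉0 : ∀ {l} → Regular l → ∀ i → f′ i l ≉ 0#
  f′≉0 reg zero            = 1≉0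
  f′≉0 {l} (_ , l³≉1) (suc k) = *-≉0
    (≉0-resp (+-congˡ (-‿cong (sym (*-identityʳ (ω k))))) (e-ωf≉0 l³≉1 k))
    (*-≉0ʳ (≉0-resp θθ⁻¹≈1 1≉0))

  private
    module Four {l} (reg : Regular l) = FourFlexes 1# l 1# 1≉0 reg

    3e²≈X : ∀ {l} (reg : Regular l) i → 3 · e′ i l ^ 2 ≈ Four.X reg i
    3e²≈X {l} reg zero    = solve (l ∷ []) λ l → 3 :· l :^ 2 := 3 :· (:1 :* l :^ 2)
    3e²≈X {l} reg (suc k) = solve (l ∷ ω k ∷ θ ⁻¹ ∷ []) (λ l ω w →
      (:- ((:θ :* w :+ :1) :* (l :+ 2 :· ω) :^ 2)) ⊛ :θ :* w := :1 ⇒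
      3 :· ((l :+ 2 :· ω) :* w) :^ 2 := :- (:1 :* (l :+ 2 :· (ω :* :1)) :^ 2)) θθ⁻¹≈1

  -- m lies in the orbit of l under the tetrahedral group, generated by
  -- l ↦ ρl and l ↦ (l + 2) / (l - 1).
  abstract
    orbit⇒∼ : ∀ {l m ζ} → Regular l → ∀ i → ζ ^ 3 ≈ 1# → m * f′ i l ≈ ζ * e′ i l →
              ∃ λ ((u , _) : l ∼ m) → u * m ≈ e′ i l
    orbit⇒∼ {l} {m} {ζ} reg i ζ³≈1 mf≈ζe =
      -- This scaling sends m to ζ² (m f) = ζ³ e = e. The factor ζ⁸ from its fourth power offsets
      -- the ζ that `formA` acquires from ζe. In `formB` only e³ occurs, and ζ¹² = 1.
      (f * ζ ^ 2 , *-≉0 (f′≉0 reg i) (^-≉0 2 ζ≉0) , A≈ , B≈) ,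
      solve (e ∷ f ∷ m ∷ ζ ∷ []) (λ e f m ζ →
        ζ :^ 2 ⊛ m :* f := ζ :* e ⇒ e ⊛ ζ :^ 3 := :1 ⇒ f :* ζ :^ 2 :* m := e) mf≈ζe ζ³≈1
      where
      e f : Carrier
      e = e′ i l
      f = f′ i l
      ζ≉0 : ζ ≉ 0#
      ζ≉0 = *-≉0ˡ (≉0-resp ζ³≈1 1≉0)
      A≈ : formA l 1# ≈ (f * ζ ^ 2) ^ 4 * formA m 1#
      A≈ = trans (sym (formA-e′f′ i l)) (trans
        (solve (e ∷ f ∷ ζ ∷ []) (λ e f ζ →
          3 :· (e :* (e :^ 3 :* :geometric 4 (ζ :^ 3) :+ 8 :· (f :^ 3 :* :geometric 3 (ζ :^ 3))))
            ⊛ ζ :^ 3 := :1 ⇒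
          :formA e f := ζ :^ 8 :* :formA (ζ :* e) f) ζ³≈1)
        (trans (*-congˡ (formA-cong (sym mf≈ζe) ≈-refl))
          (solve (f ∷ m ∷ ζ ∷ []) λ f m ζ →
            ζ :^ 8 :* :formA (m :* f) f := (f :* ζ :^ 2) :^ 4 :* :formA m :1)))
      B≈ : formB l 1# ≈ (f * ζ ^ 2) ^ 6 * formB m 1#
      B≈ = trans (sym (formB-e′f′ i l)) (trans
        (solve (e ∷ f ∷ ζ ∷ []) (λ e f ζ →
          2 :· (e :^ 6 :* :geometric 6 (ζ :^ 3) :- 20 :· (e :^ 3 :* f :^ 3 :* :geometric 5 (ζ :^ 3))
          :- 8 :· (f :^ 6 :* :geometric 4 (ζ :^ 3))) ⊛ ζ :^ 3 := :1 ⇒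
          :formB e f := ζ :^ 12 :* :formB (ζ :* e) f) ζ³≈1)
        (trans (*-congˡ (formB-cong (sym mf≈ζe) ≈-refl))
          (solve (f ∷ m ∷ ζ ∷ []) λ f m ζ →
            ζ :^ 12 :* :formB (m :* f) f := (f :* ζ :^ 2) :^ 6 :* :formB m :1)))

  ω³≈1 : ∀ k → ω k ^ 3 ≈ 1#
  ω³≈1 zero             = solve [] (:1 :^ 3 := :1)
  ω³≈1 (suc zero)       = solve [] (:ρ :^ 3 := :1)
  ω³≈1 (suc (suc zero)) = solve [] ((:ρ :^ 2) :^ 3 := :1)

  abstract
    cubeRoot : ∀ {x y} → x ^ 3 ≈ y ^ 3 → ∃ λ k → x ≈ ω k * y
    cubeRoot {x} {y} x³≈y³ with x*y≈0⇒x≈0⊎y≈0 (solve (x ∷ y ∷ []) (λ x y →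
      :1 ⊛ x :^ 3 := y :^ 3 ⇒
      (x :- :1 :* y) :* ((x :- :ρ :* y) :* (x :- :ρ :^ 2 :* y)) := :0) x³≈y³)
    ... | inj₁ d = zero , x-y≈0⇒x≈y d
    ... | inj₂ d with x*y≈0⇒x≈0⊎y≈0 d
    ...   | inj₁ d′ = suc zero , x-y≈0⇒x≈y d′
    ...   | inj₂ d′ = suc (suc zero) , x-y≈0⇒x≈y d′

  ω-inverse : ∀ k → ∃ λ j → ω j * ω k ≈ 1#
  ω-inverse zero             = zero , *-identityˡ 1#
  ω-inverse (suc zero)       = suc (suc zero) , solve [] (:ρ :^ 2 :* :ρ := :1)
  ω-inverse (suc (suc zero)) = suc zero , solve [] (:ρ :* :ρ :^ 2 := :1)

  ω-injective : ∀ {j k} → ω j ≈ ω k → j ≡ k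
  ω-injective {zero}           {zero}           _ = refl
  ω-injective {suc zero}       {suc zero}       _ = refl
  ω-injective {suc (suc zero)} {suc (suc zero)} _ = refl
  ω-injective {zero}           {suc zero}       e = contradiction e (x-y≉0⇒x≉y 1-ρ≉0)
  ω-injective {suc zero}       {zero}           e = contradiction (sym e) (x-y≉0⇒x≉y 1-ρ≉0)
  ω-injective {zero}           {suc (suc zero)} e = contradiction
    (solve [] ((:- :ρ) ⊛ :1 := :ρ :^ 2 ⇒ :1 :- :ρ := :0) e) 1-ρ≉0
  ω-injective {suc (suc zero)} {zero}           e = contradiction
    (solve [] (:ρ ⊛ :ρ :^ 2 := :1 ⇒ :1 :- :ρ := :0) e) 1-ρ≉0
  ω-injective {suc zero}       {suc (suc zero)} e = contradiction
    (solve [] (:ρ :^ 2 ⊛ :ρ := :ρ :^ 2 ⇒ :1 :- :ρ := :0) e) 1-ρ≉0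
  ω-injective {suc (suc zero)} {suc zero}       e = contradiction
    (solve [] ((:- :ρ :^ 2) ⊛ :ρ :^ 2 := :ρ ⇒ :1 :- :ρ := :0) e) 1-ρ≉0

  -- An isomorphism carries the flex of abscissa 3m² to one of abscissa 3e² with e = e′ i l, so u m
  -- = ±e, and the sign can be moved into u. Now A(e, u) = u⁴ A(m, 1) = A(e, f) leaves e = 0, in
  -- which case m = 0, or u³ = f³. Either way m f is a cube root of unity times e.
  ∼⇒orbit : ∀ {l m} → Regular l → Regular m → l ∼ m → ∃₂ λ i j → m * f′ i l ≈ ω j * e′ i l
  ∼⇒orbit {l} {m} reg reg′ (u , u≉0 , A≈ , B≈) = i , align (x²≈y²⇒x≈±y e²≈)
    where
    scaled : TwistedFlex 1# (Four.A reg) (Four.B reg) (u ^ 2 * Four.X reg′ zero) (u ^ 3 * Four.Y reg′ zero)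
    scaled = TwistedFlex-resp
      (trans (solve (u ∷ formA m 1# ∷ []) (λ u a → u :^ 4 :* (:1 :^ 2 :* a) := :1 :^ 2 :* (u :^ 4 :* a)))
               (*-congˡ (sym A≈)))
      (trans (solve (u ∷ formB m 1# ∷ []) (λ u b → u :^ 6 :* (:1 :^ 3 :* b) := :1 :^ 3 :* (u :^ 6 :* b)))
               (*-congˡ (sym B≈)))
      (TwistedFlex-scale u≉0 (Four.twistedFlex reg′ zero))
    found : ∃ λ i → u ^ 2 * Four.X reg′ zero ≈ Four.X reg i
    found = Four.exhaustive reg scaled
    i : Fin 4
    i = proj₁ found
    e f : Carrier
    e = e′ i l
    f = f′ i l
    e²≈ : (u * m) ^ 2 ≈ e ^ 2
    e²≈ = *-cancelˡ 3≉0 (solve (u ∷ m ∷ e ∷ Four.X reg i ∷ []) (λ u m e x →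
      :1 ⊛ u :^ 2 :* 3 :· (:1 :* m :^ 2) := x ⇒ (:- :1) ⊛ 3 :· e :^ 2 := x ⇒
      3 :· :1 :* (u :* m) :^ 2 := 3 :· :1 :* e :^ 2) (proj₂ found) (3e²≈X reg i))
    module _ {v} (v≉0 : v ≉ 0#) (vm≈e : v * m ≈ e) where
      e≈0-case : e ≈ 0# → ∃ λ j → m * f ≈ ω j * e
      e≈0-case e≈0 = zero , *-cancelˡ v≉0 (solve (v ∷ m ∷ e ∷ f ∷ []) (λ v m e f →
        f ⊛ v :* m := e ⇒ (f :- v) ⊛ e := :0 ⇒ v :* (m :* f) := v :* (:1 :* e)) vm≈e e≈0)

      v≈ωf-case : ∃ (λ k → v ≈ ω k * f) → ∃ λ j → m * f ≈ ω j * e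
      v≈ωf-case (k , v≈ωf) = j ,
        solve (v ∷ m ∷ e ∷ f ∷ ω j ∷ ω k ∷ []) (λ v m e f ωj ωk →
          (:- (m :* f)) ⊛ ωj :* ωk := :1 ⇒ (:- (ωj :* m)) ⊛ v := ωk :* f ⇒ ωj ⊛ v :* m := e ⇒
          m :* f := ωj :* e) (proj₂ (ω-inverse k)) v≈ωf vm≈e
        where j = proj₁ (ω-inverse k)

      aligned : formA l 1# ≈ v ^ 4 * formA m 1# → ∃ λ j → m * f ≈ ω j * e
      aligned A≈ = [ e≈0-case , v≈ωf-case ∘ cubeRoot ∘ x-y≈0⇒x≈y ]′ (x*y≈0⇒x≈0⊎y≈0
        (*-cancelˡ (*-≉0 3≉0 (^-≉0 3 2≉0)) (solve (v ∷ e ∷ f ∷ v ^ 4 * formA m 1# ∷ [])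
          (λ v e f a → :1 ⊛ :formA e f := a ⇒ (:- :1) ⊛ :formA e v := a ⇒
            3 :· :1 :* (2 :· :1) :^ 3 :* (e :* (v :^ 3 :- f :^ 3)) := 3 :· :1 :* (2 :· :1) :^ 3 :* :0)
          (trans (formA-e′f′ i l) A≈)
          (trans (formA-cong (sym vm≈e) ≈-refl)
            (solve (v ∷ m ∷ []) λ v m → :formA (v :* m) v := v :^ 4 :* :formA m :1)))))
    align : u * m ≈ e ⊎ u * m ≈ - e → ∃ λ j → m * f ≈ ω j * e
    align (inj₁ p) = aligned u≉0 p A≈
    align (inj₂ p) = aligned (-‿≉0 u≉0)
      (solve (u ∷ m ∷ e ∷ []) (λ u m e → (:- :1) ⊛ u :* m := :- e ⇒ (:- u) :* m := e) p)
      (trans A≈ (solve (u ∷ formA m 1# ∷ []) λ u a → u :^ 4 :* a := (:- u) :^ 4 :* a))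

  -- Leaves out j = 0 and j = 1728, where automorphisms other than ±1 make the orbits shorter.
  Generic : Carrier → Set ℓ
  Generic l = Regular l × formA l 1# ≉ 0# × formB l 1# ≉ 0#

  ∼-generic : ∀ {l m} → l ∼ m → Generic l → Generic m
  ∼-generic l∼m (reg , A≉0 , B≉0) =
    ∼-regular l∼m reg , A≉0 ∘ A≈0-resp (∼-sym l∼m) , B≉0 ∘ B≈0-resp (∼-sym l∼m)

  -- The isomorphisms from the curve of l to that of m are unique up to sign, and
  -- determine the flex that is sent to the one with parameter m.
  orbit-injective : ∀ {l m} → Generic l → ∀ {i j i′ j′} → m * f′ i l ≈ ω j * e′ i l →
                    m * f′ i′ l ≈ ω j′ * e′ i′ l → (i , j) ≡ (i′ , j′)
  orbit-injective {l} {m} gen@(reg , A≉0 , B≉0) {i} {j} {i′} {j′} mf≈ mf≈′ = conclude i≡i′ mf≈′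
    where
    iso  = orbit⇒∼ reg i (ω³≈1 j) mf≈
    iso′ = orbit⇒∼ reg i′ (ω³≈1 j′) mf≈′
    genᵐ : Generic m
    genᵐ = ∼-generic (proj₁ iso) gen
    u v : Carrier
    u = proj₁ (proj₁ iso)
    v = proj₁ (proj₁ iso′)
    A : formA l 1# ≈ u ^ 4 * formA m 1#
    A = proj₁ (proj₂ (proj₂ (proj₁ iso)))
    A′ : formA l 1# ≈ v ^ 4 * formA m 1#
    A′ = proj₁ (proj₂ (proj₂ (proj₁ iso′)))
    B : formB l 1# ≈ u ^ 6 * formB m 1#
    B = proj₂ (proj₂ (proj₂ (proj₁ iso)))
    B′ : formB l 1# ≈ v ^ 6 * formB m 1#
    B′ = proj₂ (proj₂ (proj₂ (proj₁ iso′)))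
    -- As A and B do not vanish at m, the two scalings have equal fourth and sixth powers, hence
    -- equal squares. This is the uniqueness up to sign.
    u⁴≈v⁴ : u ^ 4 ≈ v ^ 4
    u⁴≈v⁴ = *-cancelˡ (proj₁ (proj₂ genᵐ))
      (trans (*-comm _ _) (trans (sym A) (trans A′ (*-comm _ _))))
    u⁶≈v⁶ : u ^ 6 ≈ v ^ 6
    u⁶≈v⁶ = *-cancelˡ (proj₂ (proj₂ genᵐ))
      (trans (*-comm _ _) (trans (sym B) (trans B′ (*-comm _ _))))
    u²≈v² : u ^ 2 ≈ v ^ 2
    u²≈v² = *-cancelˡ (^-≉0 4 (proj₁ (proj₂ (proj₁ iso)))) (solve (u ∷ v ∷ []) (λ u v →
      :1 ⊛ u :^ 6 := v :^ 6 ⇒ (:- v :^ 2) ⊛ u :^ 4 := v :^ 4 ⇒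
      u :^ 4 :* u :^ 2 := u :^ 4 :* v :^ 2) u⁶≈v⁶ u⁴≈v⁴)
    e²≈e² : e′ i l ^ 2 ≈ e′ i′ l ^ 2
    e²≈e² = solve (u ∷ v ∷ m ∷ e′ i l ∷ e′ i′ l ∷ []) (λ u v m e e′ →
      (:- (u :* m :+ e)) ⊛ u :* m := e ⇒ (v :* m :+ e′) ⊛ v :* m := e′ ⇒
      m :^ 2 ⊛ u :^ 2 := v :^ 2 ⇒ e :^ 2 := e′ :^ 2) (proj₂ iso) (proj₂ iso′) u²≈v²
    i≡i′ : i ≡ i′
    i≡i′ = Four.X-injective reg (trans (sym (3e²≈X reg i)) (trans
      (solve (e′ i l ∷ e′ i′ l ∷ []) (λ e e′ → (3 :· :1) ⊛ e :^ 2 := e′ :^ 2 ⇒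
        3 :· e :^ 2 := 3 :· e′ :^ 2) e²≈e²)
      (3e²≈X reg i′)))
    e≉0 : e′ i l ≉ 0#
    e≉0 e≈0 = A≉0 (trans (sym (formA-e′f′ i l)) (solve (e′ i l ∷ f′ i l ∷ []) (λ e f →
      (:- (3 :· (e :^ 3 :+ 8 :· f :^ 3))) ⊛ e := :0 ⇒ :formA e f := :0) e≈0))
    conclude : i ≡ i′ → m * f′ i′ l ≈ ω j′ * e′ i′ l → (i , j) ≡ (i′ , j′)
    conclude refl mf≈′ = ≡.cong (i ,_) (ω-injective (*-cancelˡ e≉0
      (trans (*-comm _ _) (trans (sym mf≈) (trans mf≈′ (*-comm _ _))))))

-- Counting the classes over a field of q elements

count-7 : ∀ k {q} → q ≡ 7 ℕ.+ k ℕ.* 12 → (q ℕ.+ 12 ∸ q % 12) ℕ./ 12 ≡ suc k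
count-7 k refl = begin
  (7 ℕ.+ k ℕ.* 12 ℕ.+ 12 ∸ (7 ℕ.+ k ℕ.* 12) % 12) ℕ./ 12
    ≡⟨ ≡.cong (λ r → (7 ℕ.+ k ℕ.* 12 ℕ.+ 12 ∸ r) ℕ./ 12) (ℕ.[m+kn]%n≡m%n 7 k 12) ⟩
  (k ℕ.* 12 ℕ.+ 12) ℕ./ 12
    ≡⟨ ≡.cong (ℕ._/ 12) (ℕ.+-comm (k ℕ.* 12) 12) ⟩
  (suc k ℕ.* 12) ℕ./ 12
    ≡⟨ ℕ.m*n/n≡m (suc k) 12 ⟩
  suc k ∎
  where open ≡.≡-Reasoning

count-13 : ∀ k {q} → q ≡ 13 ℕ.+ k ℕ.* 12 → (q ℕ.+ 12 ∸ q % 12) ℕ./ 12 ≡ suc (suc k)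
count-13 k refl = begin
  (13 ℕ.+ k ℕ.* 12 ℕ.+ 12 ∸ (13 ℕ.+ k ℕ.* 12) % 12) ℕ./ 12
    ≡⟨ ≡.cong (λ r → (13 ℕ.+ k ℕ.* 12 ℕ.+ 12 ∸ r) ℕ./ 12) (ℕ.[m+kn]%n≡m%n 1 (suc k) 12) ⟩
  (12 ℕ.+ k ℕ.* 12 ℕ.+ 12) ℕ./ 12
    ≡⟨ ≡.cong (ℕ._/ 12) (ℕ.+-comm (12 ℕ.+ k ℕ.* 12) 12) ⟩
  (suc (suc k) ℕ.* 12) ℕ./ 12
    ≡⟨ ℕ.m*n/n≡m (suc (suc k)) 12 ⟩
  suc (suc k) ∎
  where open ≡.≡-Reasoning

-- The field splits into 3 cube roots of unity, 4 roots of A, `b` roots of B and `k` orbits of 12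
-- elements. The classes are one for the roots of A, `r` for those of B and `k` for the orbits.
count : ∀ b r k {n q} → (b , r) ≡ (0 , 0) ⊎ (b , r) ≡ (6 , 1) → q ≡ 7 ℕ.+ b ℕ.+ k ℕ.* 12 →
        n ≡ suc (r ℕ.+ k) → n ≡ (q ℕ.+ 12 ∸ q % 12) ℕ./ 12
count b r k (inj₁ refl) q≡ n≡ = ≡.trans n≡ (≡.sym (count-7 k q≡))
count b r k (inj₂ refl) q≡ n≡ = ≡.trans n≡ (≡.sym (count-13 k q≡))

refine-allPairs : ∀ {a p r s} {A : Set a} {P : A → Set p} {R : A → A → Set r} {S : A → A → Set s} →
  (∀ {x y} → P x → P y → R x y → S x y) → ∀ {xs} → All P xs → AllPairs R xs → AllPairs S xs
refine-allPairs f []        []        = []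
refine-allPairs f (p ∷ ps) (rs ∷ rss) = All.zipWith (λ (p′ , r) → f p p′ r) (ps , rs) ∷ refine-allPairs f ps rss

refine-any : ∀ {a p r s} {A : Set a} {P : A → Set p} {R : A → Set r} {S : A → Set s} →
  (∀ {x} → P x → R x → S x) → ∀ {xs} → All P xs → Any R xs → Any S xs
refine-any f (p ∷ ps) (here r)  = here (f p r)
refine-any f (p ∷ ps) (there x) = there (refine-any f ps x)

module Representatives {c ℓ} (F : EisensteinField c ℓ) {q : ℕ}
                       (size : FieldOfSize (EisensteinField.fieldᴱ F) q) where
  open EisensteinProperties F
  open HesseForms F
  open Classes F
  open Enumerated fieldᴱ size

  decSetoid : DecSetoid c ℓ
  decSetoid = record { isDecEquivalence = record { isEquivalence = isEquivalence ; _≟_ = _≟_ } }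

  open Transversals decSetoid
  open Membership setoid using (_∈_; _∉_)
  open Unique setoid using (Unique)
  private
    module ∈ = MembershipProperties
    module Uniq = UniqueProperties

  -- The function is explicit, since it cannot be inferred from a list of known length.
  ∈-tabulate⁺ : ∀ {n} (f : Fin n → Carrier) i → f i ∈ List.tabulate f
  ∈-tabulate⁺ f = ∈.∈-tabulate⁺ setoid {f = f}

  ∈-tabulate⁻ : ∀ {n} (f : Fin n → Carrier) {x} → x ∈ List.tabulate f → ∃ λ i → x ≈ f i
  ∈-tabulate⁻ f = ∈.∈-tabulate⁻ setoid {f = f}

  tabulate-unique : ∀ {n} (f : Fin n → Carrier) → (∀ {i j} → f i ≈ f j → i ≡ j) →
                    Unique (List.tabulate f)
  tabulate-unique f = Uniq.tabulate⁺ setoid {f = f}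

  remQuot-injective : ∀ {m n} (f : Fin m × Fin n → Carrier) →
    (∀ {x y} → f x ≈ f y → x ≡ y) → ∀ {k k′} → f (Fin.remQuot n k) ≈ f (Fin.remQuot n k′) → k ≡ k′
  remQuot-injective {m} {n} f f-injective {k} {k′} e =
    ≡.trans (≡.sym (Fin.combine-remQuot {m} n k))
      (≡.trans (≡.cong (λ (i , j) → Fin.combine i j) (f-injective e)) (Fin.combine-remQuot {m} n k′))

  orbitPoint : Carrier → Fin 4 × Fin 3 → Carrier
  orbitPoint l (i , j) = ω j * e′ i l / f′ i l

  orbit : Carrier → List Carrier
  orbit l = List.tabulate {n = 12} (orbitPoint l ∘ Fin.remQuot 3)

  private
    /-eq : ∀ {m e f} → f ≉ 0# → m ≈ e / f → m * f ≈ e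
    /-eq f≉0 m≈e/f = trans (*-congʳ m≈e/f) (/-*-cancel f≉0)

    eq-/ : ∀ {m e f} → f ≉ 0# → m * f ≈ e → m ≈ e / f
    eq-/ {m} {e} {f} f≉0 mf≈e = solve (m ∷ e ∷ f ∷ f ⁻¹ ∷ []) (λ m e f f⁻¹ →
      f⁻¹ ⊛ m :* f := e ⇒ (:- m) ⊛ f :* f⁻¹ := :1 ⇒ m := e :* f⁻¹) mf≈e (*-inverseʳ f≉0)

  ∈-orbit⁺ : ∀ {l m} i j → f′ i l ≉ 0# → m * f′ i l ≈ ω j * e′ i l → m ∈ orbit l
  ∈-orbit⁺ {l} i j f≉0 mf≈ωe = ∈.∈-resp-≈ setoid
    (trans (reflexive (≡.cong (orbitPoint l) (Fin.remQuot-combine i j)))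
             (sym (eq-/ f≉0 mf≈ωe)))
    (∈-tabulate⁺ (orbitPoint l ∘ Fin.remQuot 3) (Fin.combine i j))

  ∈-orbit⁻ : ∀ {l m} → Regular l → m ∈ orbit l → ∃₂ λ i j → m * f′ i l ≈ ω j * e′ i l
  ∈-orbit⁻ {l} {m} reg m∈ = onOrbit (∈-tabulate⁻ (orbitPoint l ∘ Fin.remQuot 3) m∈)
    where
    onOrbit : (∃ λ k → m ≈ orbitPoint l (Fin.remQuot 3 k)) → ∃₂ λ i j → m * f′ i l ≈ ω j * e′ i l
    onOrbit (k , m≈) = proj₁ (Fin.remQuot {4} 3 k) , proj₂ (Fin.remQuot {4} 3 k) ,
      /-eq (f′≉0 reg (proj₁ (Fin.remQuot {4} 3 k))) m≈

  ∈orbit⇒∼ : ∀ {l m} → Regular l → m ∈ orbit l → l ∼ m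
  ∈orbit⇒∼ reg m∈ with i , j , e ← ∈-orbit⁻ reg m∈ = proj₁ (orbit⇒∼ reg i (ω³≈1 j) e)

  ∼⇒∈orbit : ∀ {l m} → Regular l → Regular m → l ∼ m → m ∈ orbit l
  ∼⇒∈orbit reg reg′ l∼m = member (∼⇒orbit reg reg′ l∼m)
    where
    member : ∀ {m} → (∃₂ λ i j → m * f′ i _ ≈ ω j * e′ i _) → m ∈ orbit _
    member (i , j , e) = ∈-orbit⁺ i j (f′≉0 reg i) e

  orbit-unique : ∀ {l} → Generic l → Unique (orbit l)
  orbit-unique {l} gen@(reg , _) = tabulate-unique _
    (remQuot-injective (orbitPoint l) λ {(i , j)} {(i′ , j′)} e →
      orbit-injective gen {i} {j} {i′} {j′} (/-eq (f′≉0 reg i) ≈-refl) (/-eq (f′≉0 reg i′) e))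

  -- `Blocks` takes the predecessor of the block size, which is 12.
  open Blocks Generic orbit 11 orbit-unique (λ _ → refl)
    (λ {x} {y} y≈x → ∈-orbit⁺ zero zero 1≉0
      (trans (*-identityʳ y) (trans y≈x (sym (*-identityˡ x)))))
    (λ Px Py y∈x → ∼⇒∈orbit (proj₁ Py) (proj₁ Px) (∼-sym (∈orbit⇒∼ (proj₁ Px) y∈x)))
    (λ Px Py Pz y∈x z∈y → ∼⇒∈orbit (proj₁ Px) (proj₁ Pz)
      (∼-trans (∈orbit⇒∼ (proj₁ Px) y∈x) (∈orbit⇒∼ (proj₁ Py) z∈y)))

  all : List Carrier
  all = List.tabulate enum

  all-unique : Unique all
  all-unique = tabulate-unique enum enum-injective

  ∈-all : ∀ x → x ∈ all
  ∈-all x = ∈.∈-resp-≈ setoid (enum-index x) (∈-tabulate⁺ enum (index x))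

  cubeRoots : List Carrier
  cubeRoots = List.tabulate ω

  regular⇒∉cubeRoots : ∀ {l} → Regular l → l ∉ cubeRoots
  regular⇒∉cubeRoots (_ , l³≉1) l∈ with k , l≈ω ← ∈-tabulate⁻ ω l∈ =
    l³≉1 (trans (Exp.^-congˡ semiring 3 l≈ω) (trans (ω³≈1 k) (solve [] (:1 := :1 :^ 3))))

  ∉cubeRoots⇒regular : ∀ {l} → l ∉ cubeRoots → Regular l
  ∉cubeRoots⇒regular l∉ = 1≉0 , λ l³≈1 → let k , l≈ω = cubeRoot l³≈1 in
    l∉ (∈.∈-resp-≈ setoid (sym (trans l≈ω (*-identityʳ _))) (∈-tabulate⁺ ω k))

  rootA : Fin 4 → Carrier
  rootA zero    = 0#
  rootA (suc k) = - (2 · ω k)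

  rootsA : List Carrier
  rootsA = List.tabulate rootA

  private
    4≉0 : 2 · 1# * 2 · 1# ≉ 0#
    4≉0 = *-≉0 2≉0 2≉0

    -2ω≉0 : ∀ k → - (2 · ω k) ≉ 0#
    -2ω≉0 k = -‿≉0 (≉0-resp (solve (ω k ∷ []) (λ ω → 2 :· ω := 2 :· :1 :* ω)) (*-≉0 2≉0 (ω≉0 k)))

  rootA-injective : ∀ {i j} → rootA i ≈ rootA j → i ≡ j
  rootA-injective {zero}  {zero}  _ = refl
  rootA-injective {zero}  {suc k} e = contradiction (sym e) (-2ω≉0 k)
  rootA-injective {suc k} {zero}  e = contradiction e (-2ω≉0 k)
  rootA-injective {suc j} {suc k} e = ≡.cong suc (ω-injective (*-cancelˡ 2≉0
    (solve (ω j ∷ ω k ∷ []) (λ x y → (:- :1) ⊛ :- (2 :· x) := :- (2 :· y) ⇒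
      2 :· :1 :* x := 2 :· :1 :* y) e)))

  formA-rootA : ∀ i → formA (rootA i) 1# ≈ 0#
  formA-rootA zero    = solve [] (:formA :0 :1 := :0)
  formA-rootA (suc k) = solve (ω k ∷ []) (λ ω →
    (:- (3 :· (:- (2 :· ω) :* (:- (8 :· :1))))) ⊛ ω :^ 3 := :1 ⇒ :formA (:- (2 :· ω)) :1 := :0) (ω³≈1 k)

  A≈0⇒rootA : ∀ {l} → formA l 1# ≈ 0# → ∃ λ i → rootA i ≈ l
  A≈0⇒rootA {l} A≈0 with x*y≈0⇒x≈0⊎y≈0 (*-cancelˡ (-‿≉0 3≉0) (solve (l ∷ []) (λ l →
    :1 ⊛ :formA l :1 := :0 ⇒ (:- (3 :· :1)) :* (l :* (l :^ 3 :+ 8 :· :1)) := (:- (3 :· :1)) :* :0) A≈0))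
  ... | inj₁ l≈0 = zero , sym l≈0
  ... | inj₂ d with k , l≈ ← cubeRoot {x = l} {y = - (2 · 1#)}
                  (solve (l ∷ []) (λ l → :1 ⊛ l :^ 3 :+ 8 :· :1 := :0 ⇒ l :^ 3 := (:- (2 :· :1)) :^ 3) d) =
    suc k , trans (solve (ω k ∷ []) λ ω → :- (2 :· ω) := ω :* :- (2 :· :1)) (sym l≈)

  -- The values are 16 and -432 = -2⁴ · 3³.
  B≉0-rootA : ∀ i → formB (rootA i) 1# ≉ 0#
  B≉0-rootA zero    = ≉0-resp (solve [] (:formB :0 :1 := (2 :· :1) :^ 4)) (^-≉0 4 2≉0)
  B≉0-rootA (suc k) = ≉0-resp (solve (ω k ∷ []) (λ ω →
    (:- (2 :· ((8 :· :1) :^ 2 :* (ω :^ 3 :+ :1) :+ (20 :· :1) :* 8 :· :1))) ⊛ ω :^ 3 := :1 ⇒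
    :formB (:- (2 :· ω)) :1 := :- ((2 :· :1) :^ 4 :* (3 :· :1) :^ 3)) (ω³≈1 k))
    (-‿≉0 (*-≉0 (^-≉0 4 2≉0) (^-≉0 3 3≉0)))

  A≈0⇒B≉0 : ∀ {l} → formA l 1# ≈ 0# → formB l 1# ≉ 0#
  A≈0⇒B≉0 A≈0 with i , r≈l ← A≈0⇒rootA A≈0 = ≉0-resp (formB-cong (sym r≈l) ≈-refl) (B≉0-rootA i)

  regular-A≈0 : ∀ {l} → formA l 1# ≈ 0# → Regular l
  regular-A≈0 {l} A≈0 = nonsingular (≉0-resp (solve (formA l 1# ∷ formB l 1# ∷ []) (λ a b →
    (4 :· a :^ 2) ⊛ a := :0 ⇒ 4 :· a :^ 3 :+ 27 :· b :^ 2 := 27 :· :1 :* b :^ 2) A≈0)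
    (*-≉0 27≉0 (^-≉0 2 (A≈0⇒B≉0 A≈0))))

  regular-B≈0 : ∀ {l} → formB l 1# ≈ 0# → Regular l
  regular-B≈0 {l} B≈0 = nonsingular (≉0-resp (solve (formA l 1# ∷ formB l 1# ∷ []) (λ a b →
    (27 :· b) ⊛ b := :0 ⇒ 4 :· a :^ 3 :+ 27 :· b :^ 2 := 2 :· :1 :* 2 :· :1 :* a :^ 3) B≈0)
    (*-≉0 4≉0 (^-≉0 3 λ A≈0 → A≈0⇒B≉0 A≈0 B≈0)))

  -- At l = 0 the flex for ω = 1 has e/f = (2/θ) / (-1/θ) = -2, and multiplication by the cube roots
  -- of unity yields the other roots.
  0∼rootA : ∀ i → 0# ∼ rootA i
  0∼rootA i = proj₁ (orbit⇒∼ (regular-A≈0 (formA-rootA zero)) (index′ i) (ω³≈1 (twist i)) (eq i))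
    where
    index′ : Fin 4 → Fin 4
    index′ zero    = zero
    index′ (suc _) = suc zero
    twist : Fin 4 → Fin 3
    twist zero    = zero
    twist (suc k) = k
    eq : ∀ i → rootA i * f′ (index′ i) 0# ≈ ω (twist i) * e′ (index′ i) 0#
    eq zero    = solve [] (:0 :* :1 := :1 :* :0)
    eq (suc k) = solve (ω k ∷ θ ⁻¹ ∷ []) λ ω w →
      (:- (2 :· ω)) :* ((:0 :- :1) :* w) := ω :* ((:0 :+ 2 :· :1) :* w)

  -- There are six roots of B, in one class, or none, according as 3 is a square or not.
  record RootsB : Set (c ⊔ ℓ) where
    field
      rootsB  : List Carrier
      reps    : List Carrier
      unique  : Unique rootsB
      B≈0     : ∀ {l} → l ∈ rootsB → formB l 1# ≈ 0#
      B≈0⇒∈   : ∀ {l} → formB l 1# ≈ 0# → l ∈ rootsB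
      counted : (length rootsB , length reps) ≡ (0 , 0) ⊎ (length rootsB , length reps) ≡ (6 , 1)
      rep-B≈0 : All (λ r → formB r 1# ≈ 0#) reps
      distinct : AllPairs (λ r s → ¬ r ∼ s) reps
      covers  : ∀ {l} → l ∈ rootsB → Any (_∼ l) reps

  -- B(l , 1) = -2 ∏ ((ωl - 1)² - 3), over the cube roots of unity ω.
  B≈0⇒3-square : ∀ {l} → formB l 1# ≈ 0# → ∃ λ j → (ω j * l - 1#) ^ 2 ≈ 3 · 1#
  B≈0⇒3-square {l} B≈0 with x*y≈0⇒x≈0⊎y≈0 (*-cancelˡ (-‿≉0 2≉0) (solve (l ∷ []) (λ l →
    :1 ⊛ :formB l :1 := :0 ⇒
    (:- (2 :· :1)) :* (((:1 :* l :- :1) :^ 2 :- 3 :· :1) :*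
      (((:ρ :* l :- :1) :^ 2 :- 3 :· :1) :* ((:ρ :^ 2 :* l :- :1) :^ 2 :- 3 :· :1)))
    := (:- (2 :· :1)) :* :0) B≈0))
  ... | inj₁ d = zero , x-y≈0⇒x≈y d
  ... | inj₂ d with x*y≈0⇒x≈0⊎y≈0 d
  ...   | inj₁ d′ = suc zero , x-y≈0⇒x≈y d′
  ...   | inj₂ d′ = suc (suc zero) , x-y≈0⇒x≈y d′

  no-rootsB : (∀ r → r ^ 2 ≉ 3 · 1#) → RootsB
  no-rootsB 3-nonSquare = record
    { rootsB = [] ; reps = [] ; unique = [] ; B≈0 = λ ()
    ; B≈0⇒∈ = λ B≈0 → ⊥-elim (3-nonSquare _ (proj₂ (B≈0⇒3-square B≈0)))
    ; counted = inj₁ refl ; rep-B≈0 = [] ; distinct = [] ; covers = λ () }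

  module _ {r : Carrier} (r²≈3 : r ^ 2 ≈ 3 · 1#) where
    private
      r≉0 : r ≉ 0#
      r≉0 = *-≉0ˡ {y = r ^ 1} (≉0-resp r²≈3 3≉0)

      base : Fin 2 → Carrier
      base zero       = 1# + r
      base (suc zero) = 1# - r

      rootB : Fin 2 × Fin 3 → Carrier
      rootB (i , j) = ω j * base i

      base-B : ∀ i j → formB (rootB (i , j)) 1# ≈ 0#
      base-B i j = trans (formB-ω i) (lemma i)
        where
        formB-ω : ∀ i → formB (ω j * base i) 1# ≈ formB (base i) 1#
        formB-ω i = solve (ω j ∷ base i ∷ []) (λ ω b →
          (:- (2 :· (b :^ 6 :* (ω :^ 3 :+ :1) :- 20 :· b :^ 3))) ⊛ ω :^ 3 := :1 ⇒
          :formB (ω :* b) :1 := :formB b :1) (ω³≈1 j)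
        lemma : ∀ i → formB (base i) 1# ≈ 0#
        -- The multiplier is -2 times the factors of B(l , 1) for ρ and ρ²; at l = 1 + r the factor
        -- for 1 is r² - 3.
        lemma zero       = solve (r ∷ []) (λ r →
          (:- (2 :· (((:ρ :* (:1 :+ r) :- :1) :^ 2 :- 3 :· :1)
            :* ((:ρ :^ 2 :* (:1 :+ r) :- :1) :^ 2 :- 3 :· :1)))) ⊛ r :^ 2 := 3 :· :1 ⇒
          :formB (:1 :+ r) :1 := :0) r²≈3
        lemma (suc zero) = solve (r ∷ []) (λ r →
          (:- (2 :· (((:ρ :* (:1 :- r) :- :1) :^ 2 :- 3 :· :1)
            :* ((:ρ :^ 2 :* (:1 :- r) :- :1) :^ 2 :- 3 :· :1)))) ⊛ r :^ 2 := 3 :· :1 ⇒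
          :formB (:1 :- r) :1 := :0) r²≈3

      -2≉0 : - (2 · 1#) ≉ 0#
      -2≉0 = -‿≉0 2≉0

      base≉0 : ∀ i → base i ≉ 0#
      base≉0 zero       = *-≉0ˡ {y = 1# - r} (≉0-resp (solve (r ∷ []) (λ r →
        (:- :1) ⊛ r :^ 2 := 3 :· :1 ⇒ (:1 :+ r) :* (:1 :- r) := :- (2 :· :1)) r²≈3) -2≉0)
      base≉0 (suc zero) = *-≉0ˡ {y = 1# + r} (≉0-resp (solve (r ∷ []) (λ r →
        (:- :1) ⊛ r :^ 2 := 3 :· :1 ⇒ (:1 :- r) :* (:1 :+ r) := :- (2 :· :1)) r²≈3) -2≉0)

      -- The cubes are 10 ± 6r.
      base³-injective : ∀ {i i′} → base i ^ 3 ≈ base i′ ^ 3 → i ≡ i′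
      base³-injective {zero}     {zero}     _ = refl
      base³-injective {suc zero} {suc zero} _ = refl
      base³-injective {zero}     {suc zero} e = contradiction (solve (r ∷ []) (λ r →
        :1 ⊛ (:1 :+ r) :^ 3 := (:1 :- r) :^ 3 ⇒ (:- (2 :· r)) ⊛ r :^ 2 := 3 :· :1 ⇒
        (2 :· :1) :^ 2 :* 3 :· :1 :* r := :0) e r²≈3) (*-≉0 (*-≉0 (^-≉0 2 2≉0) 3≉0) r≉0)
      base³-injective {suc zero} {zero}     e = contradiction (solve (r ∷ []) (λ r →
        (:- :1) ⊛ (:1 :- r) :^ 3 := (:1 :+ r) :^ 3 ⇒ (:- (2 :· r)) ⊛ r :^ 2 := 3 :· :1 ⇒
        (2 :· :1) :^ 2 :* 3 :· :1 :* r := :0) e r²≈3) (*-≉0 (*-≉0 (^-≉0 2 2≉0) 3≉0) r≉0)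

      rootB-injective : ∀ {x y} → rootB x ≈ rootB y → x ≡ y
      rootB-injective {i , j} {i′ , j′} e = conclude (base³-injective cubes) e
        where
        cubes : base i ^ 3 ≈ base i′ ^ 3
        cubes = solve (base i ∷ base i′ ∷ ω j ∷ ω j′ ∷ []) (λ b b′ w w′ →
          ((w :* b) :^ 2 :+ w :* b :* (w′ :* b′) :+ (w′ :* b′) :^ 2) ⊛ w :* b := w′ :* b′ ⇒
          (:- b :^ 3) ⊛ w :^ 3 := :1 ⇒ b′ :^ 3 ⊛ w′ :^ 3 := :1 ⇒
          b :^ 3 := b′ :^ 3) e (ω³≈1 j) (ω³≈1 j′)
        conclude : i ≡ i′ → ω j * base i ≈ ω j′ * base i′ → (i , j) ≡ (i′ , j′)
        conclude refl e = ≡.cong (i ,_) (ω-injective (*-cancelˡ (base≉0 i)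
          (trans (*-comm _ _) (trans e (*-comm _ _)))))

      roots : List Carrier
      roots = List.tabulate {n = 6} (rootB ∘ Fin.remQuot 3)

      ∈-roots : ∀ x → rootB x ∈ roots
      ∈-roots (i , j) = ∈.∈-resp-≈ setoid (reflexive (≡.cong rootB (Fin.remQuot-combine i j)))
        (∈-tabulate⁺ (rootB ∘ Fin.remQuot 3) (Fin.combine i j))

      ∈-roots⁻ : ∀ {l} → l ∈ roots → ∃₂ λ i j → l ≈ rootB (i , j)
      ∈-roots⁻ l∈ with k , l≈ ← ∈-tabulate⁻ (rootB ∘ Fin.remQuot 3) l∈ =
        proj₁ (Fin.remQuot {2} 3 k) , proj₂ (Fin.remQuot {2} 3 k) , l≈

      roots-B≈0 : ∀ {l} → (∃₂ λ i j → l ≈ rootB (i , j)) → formB l 1# ≈ 0#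
      roots-B≈0 (i , j , l≈) = trans (formB-cong l≈ ≈-refl) (base-B i j)

      roots-unique : Unique roots
      roots-unique = tabulate-unique _ (remQuot-injective rootB rootB-injective)

      -- 1 - r = ρ (l + 2ρ) / (l - ρ) for l = 1 + r.
      rep∼ : ∀ i j → 1# + r ∼ rootB (i , j)
      rep∼ zero       j = proj₁ (orbit⇒∼ (regular-B≈0 rep-B) zero (ω³≈1 j) (*-identityʳ _))
        where rep-B = trans (formB-cong (sym (*-identityˡ (1# + r))) ≈-refl) (base-B zero zero)
      rep∼ (suc zero) j = proj₁ (orbit⇒∼ (regular-B≈0 rep-B) (suc (suc zero)) ζ³≈1
        (solve (r ∷ ω j ∷ θ ⁻¹ ∷ []) (λ r ω w → (:- (ω :* w)) ⊛ r :^ 2 := 3 :· :1 ⇒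
          ω :* (:1 :- r) :* ((:1 :+ r :- :ρ) :* w) := ω :* :ρ :* ((:1 :+ r :+ 2 :· :ρ) :* w)) r²≈3))
        where
        rep-B = trans (formB-cong (sym (*-identityˡ (1# + r))) ≈-refl) (base-B zero zero)
        ζ³≈1 : (ω j * ρ) ^ 3 ≈ 1#
        ζ³≈1 = solve (ω j ∷ []) (λ ω → :1 ⊛ ω :^ 3 := :1 ⇒ (ω :* :ρ) :^ 3 := :1) (ω³≈1 j)

      rep-covers : ∀ {l} → (∃₂ λ i j → l ≈ rootB (i , j)) → 1# + r ∼ l
      rep-covers (i , j , l≈) = ∼-trans (rep∼ i j) (∼-refl (sym l≈))

      root-form : ∀ {l} → formB l 1# ≈ 0# → ∃ λ x → l ≈ rootB x
      root-form {l} B≈0 with j , sq ← B≈0⇒3-square B≈0 with k , ωω≈1 ← ω-inverse j =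
        [ (λ e → (zero , k) , recover (+ₛ e)) , (λ e → (suc zero , k) , recover (-ₛ e)) ]′
          (x²≈y²⇒x≈±y (trans sq (sym r²≈3)))
        where
        +ₛ : ω j * l - 1# ≈ r → ω j * l ≈ 1# + r
        +ₛ = solve (ω j * l ∷ r ∷ []) λ x r → :1 ⊛ x :- :1 := r ⇒ x := :1 :+ r
        -ₛ : ω j * l - 1# ≈ - r → ω j * l ≈ 1# - r
        -ₛ = solve (ω j * l ∷ r ∷ []) λ x r → :1 ⊛ x :- :1 := :- r ⇒ x := :1 :- r
        recover : ∀ {b} → ω j * l ≈ b → l ≈ ω k * b
        recover {b} = solve (ω j ∷ ω k ∷ l ∷ b ∷ []) (λ x y l b →
          (:- l) ⊛ y :* x := :1 ⇒ y ⊛ x :* l := b ⇒ l := y :* b) ωω≈1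

    six-rootsB : RootsB
    six-rootsB = record
      { rootsB   = roots
      ; reps     = 1# + r ∷ []
      ; unique   = roots-unique
      ; B≈0      = λ l∈ → roots-B≈0 (∈-roots⁻ l∈)
      ; B≈0⇒∈    = λ B≈0 → ∈.∈-resp-≈ setoid (sym (proj₂ (root-form B≈0))) (∈-roots (proj₁ (root-form B≈0)))
      ; counted  = inj₂ refl
      ; rep-B≈0  = trans (formB-cong (sym (*-identityˡ (1# + r))) ≈-refl) (base-B zero zero) ∷ []
      ; distinct = [] ∷ []
      ; covers   = λ l∈ → here (rep-covers (∈-roots⁻ l∈))
      }

  findRootsB : RootsB
  findRootsB with Fin.any? (λ i → enum i ^ 2 ≟ 3 · 1#)
  ... | yes (i , r²≈3) = six-rootsB r²≈3
  ... | no  ∄i         = no-rootsB λ r r²≈3 → ∄i (index r ,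
    trans (Exp.^-congˡ semiring 2 (enum-index r)) r²≈3)

  record ClassRepresentatives : Set (c ⊔ ℓ) where
    field
      reps        : List Carrier
      counted     : length reps ≡ (q ℕ.+ 12 ∸ q % 12) ℕ./ 12
      all-regular : All Regular reps
      distinct    : AllPairs (λ r s → ¬ r ∼ s) reps
      covers      : ∀ {l} → Regular l → Any (_∼ l) reps

  private module Assembly (rb : RootsB) where
    private module RB = RootsB rb

    -- The parameters outside the orbits of full length: the singular ones and those with j = 0 or j
    -- = 1728.
    special : List Carrier
    special = cubeRoots List.++ rootsA List.++ RB.rootsB

    rootsA⇒A≈0 : ∀ {l} → l ∈ rootsA → formA l 1# ≈ 0#
    rootsA⇒A≈0 l∈ with i , l≈ ← ∈-tabulate⁻ rootA l∈ = trans (formA-cong l≈ ≈-refl) (formA-rootA i)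

    A≈0⇒∈rootsA : ∀ {l} → formA l 1# ≈ 0# → l ∈ rootsA
    A≈0⇒∈rootsA A≈0 with i , r≈l ← A≈0⇒rootA A≈0 = ∈.∈-resp-≈ setoid r≈l (∈-tabulate⁺ rootA i)

    roots-regular : ∀ {l} → l ∈ rootsA List.++ RB.rootsB → Regular l
    roots-regular l∈ with ∈.∈-++⁻ setoid rootsA l∈
    ... | inj₁ l∈A = regular-A≈0 (rootsA⇒A≈0 l∈A)
    ... | inj₂ l∈B = regular-B≈0 (RB.B≈0 l∈B)

    special-unique : Unique special
    special-unique = Uniq.++⁺ setoid (tabulate-unique ω ω-injective)
      (Uniq.++⁺ setoid (tabulate-unique rootA rootA-injective) RB.unique
        (λ (l∈A , l∈B) → A≈0⇒B≉0 (rootsA⇒A≈0 l∈A) (RB.B≈0 l∈B)))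
      (λ (l∈U , l∈AB) → regular⇒∉cubeRoots (roots-regular l∈AB) l∈U)

    generic⇒∉special : ∀ {l} → Generic l → l ∉ special
    generic⇒∉special (reg , A≉0 , B≉0) l∈ with ∈.∈-++⁻ setoid cubeRoots l∈
    ... | inj₁ l∈U = regular⇒∉cubeRoots reg l∈U
    ... | inj₂ l∈AB with ∈.∈-++⁻ setoid rootsA l∈AB
    ...   | inj₁ l∈A = A≉0 (rootsA⇒A≈0 l∈A)
    ...   | inj₂ l∈B = B≉0 (RB.B≈0 l∈B)

    ∉special⇒generic : ∀ {l} → l ∉ special → Generic l
    ∉special⇒generic l∉ =
      ∉cubeRoots⇒regular (l∉ ∘ ∈.∈-++⁺ˡ setoid) ,
      (l∉ ∘ ∈.∈-++⁺ʳ setoid cubeRoots ∘ ∈.∈-++⁺ˡ setoid ∘ A≈0⇒∈rootsA) ,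
      (l∉ ∘ ∈.∈-++⁺ʳ setoid cubeRoots ∘ ∈.∈-++⁺ʳ setoid rootsA ∘ RB.B≈0⇒∈)

    rest : List Carrier
    rest = all ∖ special

    rest-generic : ∀ {l} → l ∈ rest → Generic l
    rest-generic l∈ = ∉special⇒generic (proj₂ (∈-∖⁻ {xs = all} special l∈))

    generic⇒∈rest : ∀ {l} → Generic l → l ∈ rest
    generic⇒∈rest {l} gen = ∈-∖⁺ {xs = all} special (∈-all l) (generic⇒∉special gen)

    rest-transversal : Transversal rest
    rest-transversal = transversal (length rest) rest ℕ.≤-refl (unique-∖ {xs = all} special all-unique) rest-generic
      (λ l∈ m∈ → generic⇒∈rest (∼-generic (∈orbit⇒∼ (proj₁ (rest-generic l∈)) m∈) (rest-generic l∈)))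

    module Complete (transversalᴿ : Transversal rest) where
      private module T = Transversal transversalᴿ

      T-generic : All Generic T.reps
      T-generic = All.map rest-generic T.reps∈

      q-eq : q ≡ length special ℕ.+ length T.reps ℕ.* 12
      q-eq = ≡.trans (≡.sym (List.length-tabulate enum)) (≡.trans
        (length-∖ {xs = all} special all-unique special-unique (λ {x} _ → ∈-all x))
        (≡.cong (length special ℕ.+_) T.counted))

      counted : length (0# ∷ RB.reps List.++ T.reps) ≡ (q ℕ.+ 12 ∸ q % 12) ℕ./ 12
      -- `length special` computes to 7 plus the number of roots of B, since the cube roots and the
      -- roots of A are tabulated lists of lengths 3 and 4.
      counted = count (length RB.rootsB) (length RB.reps) (length T.reps) RB.counted q-eq
        (≡.cong suc (List.length-++ RB.reps))

      private
        A[0]≈0 : formA 0# 1# ≈ 0#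
        A[0]≈0 = formA-rootA zero

        generic⇒regular : ∀ {r} → Generic r → Regular r
        generic⇒regular = proj₁

        0≁rootB : ∀ {r} → formB r 1# ≈ 0# → ¬ 0# ∼ r
        0≁rootB B≈0 0∼r = A≈0⇒B≉0 (A≈0-resp 0∼r A[0]≈0) B≈0

        0≁generic : ∀ {r} → Generic r → ¬ 0# ∼ r
        0≁generic (_ , A≉0 , _) 0∼r = A≉0 (A≈0-resp 0∼r A[0]≈0)

        rootB≁generic : ∀ {r} → formB r 1# ≈ 0# → All (λ s → ¬ r ∼ s) T.reps
        rootB≁generic {r} B≈0 = All.map distinguish T-generic
          where
          distinguish : ∀ {s} → Generic s → ¬ r ∼ s
          distinguish (_ , _ , B≉0) r∼s = B≉0 (B≈0-resp r∼s B≈0)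

        generic-distinct : AllPairs (λ r s → ¬ r ∼ s) T.reps
        generic-distinct = refine-allPairs {R = λ r s → s ∉ orbit r} inequivalent T-generic T.distinct
          where
          inequivalent : ∀ {r s} → Generic r → Generic s → s ∉ orbit r → ¬ r ∼ s
          inequivalent (reg , _) (reg′ , _) s∉r r∼s = s∉r (∼⇒∈orbit reg reg′ r∼s)

        generic-covers : ∀ {l} → Generic l → Any (_∼ l) T.reps
        generic-covers {l} gen =
          refine-any {R = λ r → l ∈ orbit r} equivalent T-generic (T.covers (generic⇒∈rest gen))
          where
          equivalent : ∀ {r} → Generic r → l ∈ orbit r → r ∼ l
          equivalent (reg , _) = ∈orbit⇒∼ reg

        rootA-covers : ∀ {l} → (∃ λ i → rootA i ≈ l) → 0# ∼ l
        rootA-covers (i , r≈l) = ∼-trans (0∼rootA i) (∼-refl r≈l)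

        covers : ∀ {l} → Dec (formA l 1# ≈ 0#) → Dec (formB l 1# ≈ 0#) → Regular l →
                 Any (_∼ l) (0# ∷ RB.reps List.++ T.reps)
        covers (yes A≈0) _         _   = here (rootA-covers (A≈0⇒rootA A≈0))
        covers (no  _)   (yes B≈0) _   = there (AnyProperties.++⁺ˡ (RB.covers (RB.B≈0⇒∈ B≈0)))
        covers (no  A≉0) (no  B≉0) reg =
          there (AnyProperties.++⁺ʳ RB.reps (generic-covers (reg , A≉0 , B≉0)))

      complete : ClassRepresentatives
      complete = record
        -- The parameter 0 stands for all four roots of A; `RB.reps` contributes a class only if B
        -- has roots.
        { reps        = 0# ∷ RB.reps List.++ T.reps
        ; counted     = counted
        ; all-regular = regular-A≈0 A[0]≈0
            ∷ AllProperties.++⁺ (All.map regular-B≈0 RB.rep-B≈0) (All.map generic⇒regular T-generic)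
        ; distinct    = AllProperties.++⁺ (All.map 0≁rootB RB.rep-B≈0) (All.map 0≁generic T-generic)
            ∷ AllPairsProperties.++⁺ RB.distinct generic-distinct (All.map rootB≁generic RB.rep-B≈0)
        ; covers      = λ {l} → covers (formA l 1# ≟ 0#) (formB l 1# ≟ 0#)
        }

  abstract
    representatives : ClassRepresentatives
    representatives = Complete.complete rest-transversal
      where open Assembly findRootsB

-- The classification

module CubeRoots {c ℓ} (F : Field c ℓ) where
  open Field F hiding (zero) renaming (refl to ≈-refl)
  open FieldProperties F
  private
    module S = NaturalSolver commutativeSemiring

  primitive⇒≉1 : ∀ {ρ} → IsPrimitiveRootOfUnity 3 ρ → ρ ≉ 1#
  primitive⇒≉1 {ρ} (_ , ρ^k≉1) ρ≈1 =
    ρ^k≉1 1 (ℕ.s≤s ℕ.z≤n) (ℕ.s≤s (ℕ.s≤s ℕ.z≤n)) (trans (*-identityʳ ρ) ρ≈1)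

  -- Multiplication by ρ permutes the terms of S = 1 + ρ + ρ², so S ρ = S, and S ≠ 0 would give ρ =
  -- 1.
  primitive⇒eisenstein : ∀ {ρ} → IsPrimitiveRootOfUnity 3 ρ → IsEisenstein commutativeRing ρ
  primitive⇒eisenstein {ρ} prim@(ρ³≈1 , _) with 1# + ρ + ρ * ρ ≟ 0#
  ... | yes S≈0 = S≈0
  ... | no  S≉0 = contradiction (*-cancelˡ S≉0 (begin
    (1# + ρ + ρ * ρ) * ρ    ≈⟨ S.solve 1 (λ x → (S.con 1 S.:+ x S.:+ x S.:* x) S.:* x
                                 S.:= x S.:* (x S.:* (x S.:* S.con 1)) S.:+ x S.:+ x S.:* x) ≈-refl ρ ⟩
    ρ ^ 3 + ρ + ρ * ρ       ≈⟨ +-congʳ (+-congʳ ρ³≈1) ⟩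
    1# + ρ + ρ * ρ          ≈⟨ *-identityʳ _ ⟨
    (1# + ρ + ρ * ρ) * 1#   ∎)) (primitive⇒≉1 prim)
    where open import Relation.Binary.Reasoning.Setoid setoid

  -- In characteristic 3 the polynomial x² + x + 1 is (x - 1)².
  primitive⇒3≉0 : ∀ {ρ} → IsPrimitiveRootOfUnity 3 ρ → 3 · 1# ≉ 0#
  primitive⇒3≉0 {ρ} prim 3≈0 = *-≉0 ρ-1≉0 ρ-1≉0 (solve []
    ((:- :ρ) ⊛ 3 :· :1 := :0 ⇒ (:ρ :- :1) :* (:ρ :- :1) := :0) 3≈0)
    where
    open Reflection commutativeRing ρ (primitive⇒eisenstein prim)
    ρ-1≉0 = x≉y⇒x-y≉0 (primitive⇒≉1 prim)

-- The coefficients of the theorem as values of the forms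

module FamilyForms {c ℓ} (F : EisensteinField c ℓ) where
  open EisensteinProperties F
  open HesseForms F
  open Classes F
  open Family fieldᴱ ρ

  parameter : Carrier → Carrier
  parameter a = 1# + 3 · (θ * a)

  144≉0 : 144 · 1# ≉ 0#
  144≉0 = ≉0-resp (solve [] (144 :· :1 := (2 :· :1) :^ 4 :* (3 :· :1) :^ 2))
                  (*-≉0 (^-≉0 4 2≉0) (^-≉0 2 3≉0))

  864≉0 : 864 · 1# ≉ 0#
  864≉0 = ≉0-resp (solve [] (864 :· :1 := (2 :· :1) :^ 5 :* (3 :· :1) :^ 3))
                  (*-≉0 (^-≉0 5 2≉0) (^-≉0 3 3≉0))

  -- With h = 1/6 the denominators fit because 6⁴ = 9 · 144; for B the relation is 6⁶ = 54 · 864.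
  A≈formA : ∀ a → A a ≈ formA (h * parameter a) (h * 1#)
  A≈formA a = solve (a ∷ h ∷ (144 · 1#) ⁻¹ ∷ []) (λ a h w →
    let P = (9 :· a :- :1 :- 2 :· :ρ) :* (3 :· a :- :1 :- 2 :· :ρ) :* (3 :· a :- :1) :* (3 :· a :+ :1)
        s = 6 :· h
    in
    (P :* w :* :geometric 4 s) ⊛ s := :1 ⇒
    (:- (9 :· (h :^ 4 :* P))) ⊛ 144 :· :1 :* w := :1 ⇒
    (:- P) :* w := :formA (h :* (:1 :+ 3 :· (:θ :* a))) (h :* :1)) 6h≈1 (*-inverseʳ 144≉0)

  B≈formB : ∀ a → B a ≈ formB (h * parameter a) (h * 1#)
  B≈formB a = solve (a ∷ h ∷ (864 · 1#) ⁻¹ ∷ []) (λ a h w →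
    let Q = (:1 :+ 9 :· a :^ 2) :* (9 :· a :^ 2 :- 6 :· a :- 6 :· :ρ :* a :- :1)
            :* (9 :· a :^ 2 :- 6 :· :ρ :* a :- :1)
        s = 6 :· h
    in
    (:- (Q :* w :* :geometric 6 s)) ⊛ s := :1 ⇒
    (27 :· 2 :· (h :^ 6 :* Q)) ⊛ 864 :· :1 :* w := :1 ⇒
    Q :* w := :formB (h :* (:1 :+ 3 :· (:θ :* a))) (h :* :1)) 6h≈1 (*-inverseʳ 864≉0)

  formA-homogeneous : ∀ u e f → formA (u * e) (u * f) ≈ u ^ 4 * formA e f
  formA-homogeneous u e f = solve (u ∷ e ∷ f ∷ []) λ u e f →
    :formA (u :* e) (u :* f) := u :^ 4 :* :formA e f

  formB-homogeneous : ∀ u e f → formB (u * e) (u * f) ≈ u ^ 6 * formB e f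
  formB-homogeneous u e f = solve (u ∷ e ∷ f ∷ []) λ u e f →
    :formB (u :* e) (u :* f) := u :^ 6 :* :formB e f

  private
    3θ≉0 : 3 · 1# * θ ≉ 0#
    3θ≉0 = *-≉0 3≉0 θ≉0

    3⁻¹ : Carrier
    3⁻¹ = (3 · 1#) ⁻¹

    33⁻¹≈1 : 3 · 1# * 3⁻¹ ≈ 1#
    33⁻¹≈1 = *-inverseʳ 3≉0

  -- `parameter` takes the excluded values 0, (ρ + 1)/3 and ρ/3 to 1, ρ and ρ², the cube roots of
  -- unity.
  admissible⇒regular : ∀ {a} → Admissible a → Regular (parameter a)
  admissible⇒regular {a} (a≉0 , a≉ρ/3 , a≉[ρ+1]/3) = 1≉0 , λ λ³≈1 → excluded (cubeRoot λ³≈1)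
    where
    excluded : ¬ ∃ λ k → parameter a ≈ ω k * 1#
    excluded (zero , e) = a≉0 (*-cancelˡ 3θ≉0 (solve (a ∷ []) (λ a →
      :1 ⊛ :1 :+ 3 :· (:θ :* a) := :1 :* :1 ⇒ 3 :· :1 :* :θ :* a := 3 :· :1 :* :θ :* :0) e))
    excluded (suc zero , e) = a≉[ρ+1]/3 (*-cancelˡ 3θ≉0 (solve (a ∷ 3⁻¹ ∷ []) (λ a w →
      :1 ⊛ :1 :+ 3 :· (:θ :* a) := :ρ :* :1 ⇒ (:- (:θ :* (:ρ :+ :1))) ⊛ 3 :· :1 :* w := :1 ⇒
      3 :· :1 :* :θ :* a := 3 :· :1 :* :θ :* ((:ρ :+ :1) :* w)) e 33⁻¹≈1))
    excluded (suc (suc zero) , e) = a≉ρ/3 (*-cancelˡ 3θ≉0 (solve (a ∷ 3⁻¹ ∷ []) (λ a w →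
      :1 ⊛ :1 :+ 3 :· (:θ :* a) := :ρ :^ 2 :* :1 ⇒ (:- (:θ :* :ρ)) ⊛ 3 :· :1 :* w := :1 ⇒
      3 :· :1 :* :θ :* a := 3 :· :1 :* :θ :* (:ρ :* w)) e 33⁻¹≈1))

  regular⇒admissible : ∀ {a} → Regular (parameter a) → Admissible a
  regular⇒admissible {a} (_ , λ³≉1) =
    (λ a≈0 → λ³≉1 (cube zero (solve (a ∷ []) (λ a →
      3 :· :θ ⊛ a := :0 ⇒ :1 :+ 3 :· (:θ :* a) := :1) a≈0))) ,
    (λ a≈ → λ³≉1 (cube (suc (suc zero)) (solve (a ∷ 3⁻¹ ∷ []) (λ a w →
      3 :· :θ ⊛ a := :ρ :* w ⇒ (:θ :* :ρ) ⊛ 3 :· :1 :* w := :1 ⇒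
      :1 :+ 3 :· (:θ :* a) := :ρ :^ 2) a≈ 33⁻¹≈1))) ,
    (λ a≈ → λ³≉1 (cube (suc zero) (solve (a ∷ 3⁻¹ ∷ []) (λ a w →
      3 :· :θ ⊛ a := (:ρ :+ :1) :* w ⇒ (:θ :* (:ρ :+ :1)) ⊛ 3 :· :1 :* w := :1 ⇒
      :1 :+ 3 :· (:θ :* a) := :ρ) a≈ 33⁻¹≈1)))
    where
    cube : ∀ k → parameter a ≈ ω k → parameter a ^ 3 ≈ 1# ^ 3
    cube k e = trans (Exp.^-congˡ semiring 3 e) (trans (ω³≈1 k) (solve [] (:1 := :1 :^ 3)))

  parameter⁻¹ : Carrier → Carrier
  parameter⁻¹ l = (l - 1#) / (3 · 1# * θ)

  parameter-parameter⁻¹ : ∀ l → parameter (parameter⁻¹ l) ≈ l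
  parameter-parameter⁻¹ l = solve (l ∷ (3 · 1# * θ) ⁻¹ ∷ []) (λ l w →
    (l :- :1) ⊛ 3 :· :1 :* :θ :* w := :1 ⇒ :1 :+ 3 :· (:θ :* ((l :- :1) :* w)) := l) (*-inverseʳ 3θ≉0)

module Classification {c ℓ} (F : EisensteinField c ℓ) (L K : Field c ℓ)
  (ι : EisensteinField.fieldᴱ F ↪ K) (κ : L ↪ K) (q : ℕ)
  (sizeF : FieldOfSize (EisensteinField.fieldᴱ F) q) (sizeL : FieldOfSize L (q ℕ.^ 2))
  (closure : IsAlgebraicClosure ι)
  (t : EisensteinField.Carrier F) (t≉0 : EisensteinField._≉_ F t (EisensteinField.0# F))
  (nonSquare : EisensteinField.NonSquare F t) where

  open EisensteinProperties F
  open HesseForms F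
  open Classes F
  open FamilyForms F
  open ShortModels F
  open Family fieldᴱ ρ
  open DescendedFlexes F t using (shortA; shortB; toShortModel)
  private
    module Twist = QuadraticTwist F L K ι κ q sizeF sizeL closure t t≉0 nonSquare
    module Reps = Representatives.ClassRepresentatives (Representatives.representatives F sizeF)

  Good : WeierstrassCurve fieldᴱ → Set (ℓsuc (c ⊔ ℓ))
  Good E = IsElliptic E × HasFourSubgroups ι κ q E

  model : Carrier → WeierstrassCurve fieldᴱ
  model l = shortWeierstrass fieldᴱ (t ^ 2 * formA l 1#) (t ^ 3 * formB l 1#)

  good-model : ∀ {l} → Regular l → Good (model l)
  good-model {l} reg = isElliptic , hasFourSubgroups
    where open Twist.FourSubgroups l 1# reg (t ^ 2 * formA l 1#) (t ^ 3 * formB l 1#) ≈-refl ≈-refl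

  good-curve : ∀ {a} → Admissible a → Good (curve t a)
  good-curve {a} adm = isElliptic , hasFourSubgroups
    where
    ns : Nonsingular (h * parameter a) (h * 1#)
    ns = *-≉0 h≉0 1≉0 , λ e → proj₂ (admissible⇒regular adm) (*-cancelˡ (^-≉0 3 h≉0)
      (solve (h ∷ parameter a ∷ []) (λ h l → :1 ⊛ (h :* l) :^ 3 := (h :* :1) :^ 3 ⇒
        h :^ 3 :* l :^ 3 := h :^ 3 :* :1 :^ 3) e))
    open Twist.FourSubgroups (h * parameter a) (h * 1#) ns (t ^ 2 * A a) (t ^ 3 * B a)
      (*-congˡ (A≈formA a)) (*-congˡ (B≈formB a))

  record Parameter (E : WeierstrassCurve fieldᴱ) : Set (c ⊔ ℓ) where
    field
      l u       : Carrier
      l-regular : Regular l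
      u≉0       : u ≉ 0#
      A≈        : normalA E ≈ u ^ 4 * (t ^ 2 * formA l 1#)
      B≈        : normalB E ≈ u ^ 6 * (t ^ 3 * formB l 1#)

  module _ {E : WeierstrassCurve fieldᴱ} (Δ≉0 : IsElliptic E) where
    private
      module E = Invariants E
      open Twist.Descent E Δ≉0 using (Descended; descend; spans⇒member; spans-⊆; same-abscissa)

      -- Both subgroups have the form {O, ±P}, and two points of the curve with the same abscissa
      -- are equal or opposite, so equal abscissae would identify the subgroups.
      distinct-abscissae : ∀ {G H} (D : Descended G) (D′ : Descended H) →
        ¬ Subgroup.Member G ≐ Subgroup.Member H → Descended.x D ≉ Descended.x D′
      distinct-abscissae {G} {H} D D′ G≢H x≈x′ = G≢H
        ((λ p → spans⇒member H D′.member (spans-⊆ e (same-abscissa e D.onCurve D′.onCurve) (D.spans p))) ,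
         (λ p → spans⇒member G D.member
           (spans-⊆ (K.sym e) (same-abscissa (K.sym e) D′.onCurve D.onCurve) (D′.spans p))))
        where
        module K = Field K
        module D = Descended D
        module D′ = Descended D′
        e = Embedding.⟦⟧-cong ι x≈x′

    fromForms : ∀ {e f} → shortA E ≈ t ^ 2 * formA e f → shortB E ≈ t ^ 3 * formB e f → Parameter E
    fromForms {e} {f} A≈ B≈ = record
      -- Homogeneity of degrees 4 and 6 extracts f from the pair (e, f), leaving (e/f, 1). The
      -- factor `h` relates `shortA` and `shortB` to the normal form, from which they differ by 6⁴
      -- and 6⁶.
      { l         = e / f
      ; u         = h * f
      ; l-regular = 1≉0 , λ e/f³≈1 → proj₂ ns (solve (e ∷ f ∷ e / f ∷ []) (λ e f l →
          (:- (e :^ 2 :+ e :* (f :* l) :+ (f :* l) :^ 2)) ⊛ f :* l := e ⇒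
          f :^ 3 ⊛ l :^ 3 := :1 :^ 3 ⇒ e :^ 3 := f :^ 3) fl≈e e/f³≈1)
      ; u≉0       = *-≉0 h≉0 (proj₁ ns)
      ; A≈        = trans (normalA≈ E) (trans (*-congˡ (trans A≈ (*-congˡ formA≈)))
          (solve (h ∷ f ∷ t ∷ formA (e / f) 1# ∷ []) λ h f t a →
            h :^ 4 :* (t :^ 2 :* (f :^ 4 :* a)) := (h :* f) :^ 4 :* (t :^ 2 :* a)))
      ; B≈        = trans (normalB≈ E) (trans (*-congˡ (trans B≈ (*-congˡ formB≈)))
          (solve (h ∷ f ∷ t ∷ formB (e / f) 1# ∷ []) λ h f t b →
            h :^ 6 :* (t :^ 3 :* (f :^ 6 :* b)) := (h :* f) :^ 6 :* (t :^ 3 :* b)))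
      }
      where
      c₄³-c₆²≉0 : E.c₄ ^ 3 - E.c₆ ^ 2 ≉ 0#
      c₄³-c₆²≉0 = x≉y⇒x-y≉0 (Flexes.c₄³≉c₆² F E Δ≉0)
      ns : Nonsingular e f
      ns = nonsingular (*-≉0ʳ {x = t ^ 6} (≉0-resp
        (solve (t ∷ formA e f ∷ formB e f ∷ E.c₄ ∷ E.c₆ ∷ []) (λ t a b c₄ c₆ →
          let A = :- (27 :· :1 :* c₄)
              B = :- (27 :· :1 :* 2 :· :1 :* c₆)
          in
          (:- (4 :· (A :^ 2 :+ A :* (t :^ 2 :* a) :+ (t :^ 2 :* a) :^ 2))) ⊛ A := t :^ 2 :* a ⇒
          (:- (27 :· (B :+ t :^ 3 :* b))) ⊛ B := t :^ 3 :* b ⇒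
          t :^ 6 :* (4 :· a :^ 3 :+ 27 :· b :^ 2)
            := (2 :· :1) :^ 2 :* (3 :· :1) :^ 9 :* :- (c₄ :^ 3 :- c₆ :^ 2)) A≈ B≈)
        (*-≉0 (*-≉0 (^-≉0 2 2≉0) (^-≉0 9 3≉0)) (-‿≉0 c₄³-c₆²≉0))))
      fl≈e : f * (e / f) ≈ e
      fl≈e = trans (*-comm _ _) (/-*-cancel (proj₁ ns))
      formA≈ : formA e f ≈ f ^ 4 * formA (e / f) 1#
      formA≈ = trans (formA-cong (sym fl≈e) (sym (*-identityʳ f))) (formA-homogeneous f (e / f) 1#)
      formB≈ : formB e f ≈ f ^ 6 * formB (e / f) 1#
      formB≈ = trans (formB-cong (sym fl≈e) (sym (*-identityʳ f))) (formB-homogeneous f (e / f) 1#)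

    findParameter : HasFourSubgroups ι κ q E → Parameter E
    findParameter (subgroup , injective , _) =
      fromForms (proj₁ (proj₂ (proj₂ forms))) (proj₂ (proj₂ (proj₂ forms)))
      where
      D₀ : Descended (proj₁ (subgroup zero))
      D₀ = descend (proj₁ (subgroup zero)) (proj₂ (subgroup zero))
      D₁ : Descended (proj₁ (subgroup (suc zero)))
      D₁ = descend (proj₁ (subgroup (suc zero))) (proj₂ (subgroup (suc zero)))
      module D₀ = Descended D₀
      module D₁ = Descended D₁
      D₀≢D₁ : D₀.x ≉ D₁.x
      D₀≢D₁ = distinct-abscissae D₀ D₁ λ G≐H → contradiction (injective {zero} {suc zero} G≐H) λ ()
      forms : ∃₂ λ e f → shortA E ≈ t ^ 2 * formA e f × shortB E ≈ t ^ 3 * formB e f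
      forms = Parameters.parametrise F t t≉0 (toShortModel E D₀.flex) (toShortModel E D₁.flex)
        λ X₀≈X₁ → D₀≢D₁ (*-cancelˡ (*-≉0 (^-≉0 2 2≉0) (^-≉0 2 3≉0))
          (solve (D₀.x ∷ D₁.x ∷ E.b₂ ∷ []) (λ x x′ b →
            :1 ⊛ 36 :· :1 :* x :+ 3 :· b := 36 :· :1 :* x′ :+ 3 :· b ⇒
            (2 :· :1) :^ 2 :* (3 :· :1) :^ 2 :* x := (2 :· :1) :^ 2 :* (3 :· :1) :^ 2 :* x′) X₀≈X₁))

  module _ {E : WeierstrassCurve fieldᴱ} (P : Parameter E) where
    open Parameter P

    ≅curve : ∃ λ a → Admissible a × E ≅ curve t a
    ≅curve = a , regular⇒admissible (1≉0 , λ e → proj₂ l-regular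
                   (trans (sym (Exp.^-congˡ semiring 3 (parameter-parameter⁻¹ l))) e)) ,
      -- The family has f = 1/6 where the models have f = 1, and the factor 6 makes up for it.
      toShort E (6 · u) 6u≉0
        (trans A≈ (trans
          (solve (h ∷ u ∷ t ∷ formA l 1# ∷ []) (λ h u t a →
            let s = 6 :· h in
            (:- (:geometric 4 s :* (u :^ 4 :* (t :^ 2 :* a)))) ⊛ s := :1 ⇒
            u :^ 4 :* (t :^ 2 :* a) := (6 :· u) :^ 4 :* (t :^ 2 :* (h :^ 4 :* a))) 6h≈1)
          (*-congˡ (*-congˡ (sym (trans (A≈formA a) (trans
            (formA-cong (*-congˡ (parameter-parameter⁻¹ l)) ≈-refl) (formA-homogeneous h l 1#))))))))
        (trans B≈ (trans
          (solve (h ∷ u ∷ t ∷ formB l 1# ∷ []) (λ h u t b →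
            let s = 6 :· h in
            (:- (:geometric 6 s :* (u :^ 6 :* (t :^ 3 :* b)))) ⊛ s := :1 ⇒
            u :^ 6 :* (t :^ 3 :* b) := (6 :· u) :^ 6 :* (t :^ 3 :* (h :^ 6 :* b))) 6h≈1)
          (*-congˡ (*-congˡ (sym (trans (B≈formB a) (trans
            (formB-cong (*-congˡ (parameter-parameter⁻¹ l)) ≈-refl) (formB-homogeneous h l 1#))))))))
      where
      a : Carrier
      a = parameter⁻¹ l
      6u≉0 : 6 · u ≉ 0#
      6u≉0 = ≉0-resp (solve (u ∷ []) λ u → 6 :· u := 2 :· :1 :* 3 :· :1 :* u) (*-≉0 (*-≉0 2≉0 3≉0) u≉0)

    model≅ : ∀ {r} → r ∼ l → model r ≅ E
    model≅ {r} (v , v≉0 , A≈′ , B≈′) = fromShort E (v * u ⁻¹) (*-≉0 v≉0 (*-≉0ʳ (≉0-resp uu⁻¹≈1 1≉0)))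
      (solve (u ∷ u ⁻¹ ∷ v ∷ t ∷ formA r 1# ∷ formA l 1# ∷ normalA E ∷ []) (λ u w v t a b n →
        let s = u :* w in
        (t :^ 2) ⊛ a := v :^ 4 :* b ⇒ (:- (v :* w) :^ 4) ⊛ n := u :^ 4 :* (t :^ 2 :* b) ⇒
        (:- (:geometric 4 s :* (v :^ 4 :* (t :^ 2 :* b)))) ⊛ s := :1 ⇒
        t :^ 2 :* a := (v :* w) :^ 4 :* n) A≈′ A≈ uu⁻¹≈1)
      (solve (u ∷ u ⁻¹ ∷ v ∷ t ∷ formB r 1# ∷ formB l 1# ∷ normalB E ∷ []) (λ u w v t a b n →
        let s = u :* w in
        (t :^ 3) ⊛ a := v :^ 6 :* b ⇒ (:- (v :* w) :^ 6) ⊛ n := u :^ 6 :* (t :^ 3 :* b) ⇒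
        (:- (:geometric 6 s :* (v :^ 6 :* (t :^ 3 :* b)))) ⊛ s := :1 ⇒
        t :^ 3 :* a := (v :* w) :^ 6 :* n) B≈′ B≈ uu⁻¹≈1)
      where
      uu⁻¹≈1 = *-inverseʳ u≉0

  model-injective : ∀ {l m} → model l ≅ model m → l ∼ m
  model-injective {l} {m} i = fromScaling (between-short i)
    where
    fromScaling : (∃ λ u → u ≉ 0# × t ^ 2 * formA l 1# ≈ u ^ 4 * (t ^ 2 * formA m 1#)
                              × t ^ 3 * formB l 1# ≈ u ^ 6 * (t ^ 3 * formB m 1#)) → l ∼ m
    fromScaling (u , u≉0 , A≈ , B≈) = u , u≉0 ,
      *-cancelˡ (^-≉0 2 t≉0) (trans A≈ (solve (u ∷ t ∷ formA m 1# ∷ []) λ u t a →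
        u :^ 4 :* (t :^ 2 :* a) := t :^ 2 :* (u :^ 4 :* a))) ,
      *-cancelˡ (^-≉0 3 t≉0) (trans B≈ (solve (u ∷ t ∷ formB m 1# ∷ []) λ u t b →
        u :^ 6 :* (t :^ 3 :* b) := t :^ 3 :* (u :^ 6 :* b)))

  cardinality : HasCardinality (∃ Good) (λ E E′ → proj₁ E ≅ proj₁ E′) ((q ℕ.+ 12 ∸ q % 12) ℕ./ 12)
  cardinality = ≡.subst (HasCardinality (∃ Good) (λ E E′ → proj₁ E ≅ proj₁ E′)) Reps.counted
    (class , injective , surjective)
    where
    class : Fin (length Reps.reps) → ∃ Good
    class i = model (List.lookup Reps.reps i) , good-model (all-lookup Reps.all-regular i)
    injective : ∀ {i j} → proj₁ (class i) ≅ proj₁ (class j) → i ≡ j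
    injective {i} {j} iso with i Fin.≟ j
    ... | yes i≡j = i≡j
    ... | no  i≢j = contradiction (model-injective iso)
      (allPairs-lookup (λ r≁s s∼r → r≁s (∼-sym s∼r)) Reps.distinct i j i≢j)
    surjective : ∀ (E : ∃ Good) → ∃ λ i → ∀ {j} → j ≡ i → proj₁ (class j) ≅ proj₁ E
    surjective (E , Δ≉0 , four) = Any.index covered , λ { refl → model≅ P (AnyProperties.lookup-index covered) }
      where
      P : Parameter E
      P = findParameter Δ≉0 four
      covered : Any (_∼ Parameter.l P) Reps.reps
      covered = Reps.covers (Parameter.l-regular P)

proposition12 : ∀ {c ℓ} (F L K : Field c ℓ) (ι : F ↪ K) (κ : L ↪ K) (q : ℕ) →
    FieldOfSize F q →
    FieldOfSize L (q ℕ.^ 2) →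
    IsAlgebraicClosure ι →
    let open Field F in
    2 · 1# ≉ 0# →
    q % 3 ≡ 1 →
    (ρ t : Carrier) →
    IsPrimitiveRootOfUnity 3 ρ →
    t ≉ 0# →
    NonSquare t →
    let open Family F ρ in
    HasCardinality
      (∃ λ (E : WeierstrassCurve F) → IsElliptic E × HasFourSubgroups ι κ q E)
      (λ E E′ → proj₁ E ≅ proj₁ E′)
      ((q ℕ.+ 12 ∸ q % 12) ℕ./ 12)
    × (∀ a → Admissible a → IsElliptic (curve t a) × HasFourSubgroups ι κ q (curve t a))
    × (∀ E → IsElliptic E → HasFourSubgroups ι κ q E → ∃ λ a → Admissible a × E ≅ curve t a)
proposition12 {c} {ℓ} F L K ι κ q sizeF sizeL closure 2≉0 _ ρ t isPrimitive t≉0 nonSquare =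
  cardinality ,
  (λ a → good-curve {a}) ,
  (λ E Δ≉0 four → ≅curve (findParameter Δ≉0 four))
  where
  open CubeRoots F
  𝔽 : EisensteinField c ℓ
  𝔽 = record
    { fieldᴱ     = F
    ; ρ          = ρ
    ; eisenstein = primitive⇒eisenstein isPrimitive
    ; 2≉0        = 2≉0
    ; 3≉0        = primitive⇒3≉0 isPrimitive
    }
  open Classification 𝔽 L K ι κ q sizeF sizeL closure t t≉0 nonSquare
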